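{- Let $\alpha=(\alpha_1,\dots,\alpha_n)$ be a weak integer composition. The sequence of key polynomials $\{\mathcal{K}_{k\alpha}(\mathbf{x})\}_{k=1}^\infty$ satisfies a linear recurrence with characteristic polynomial $$\prod_{T}\left(t-\mathbf{x}^{w(T)}\right),$$ where the product is taken over all key tableaux $T$ of shape $\lambda(\alpha)$ and basement $\beta(\alpha)$ such that columns of $T$ of equal height have the same filling, and where multiple roots in the product are ignored (i.e. each distinct monomial $\mathbf{x}^{w(T)}$ contributes exactly one factor).
   Context: A weak integer composition is a vector with non-negative integer entries; $k\alpha=(k\alpha_1,\dots,k\alpha_n)$. Rows are drawn left-justified, row 1 at the top. Augmented fillings. Let $\beta=(\beta_1,\dots,\beta_m)$ be a list of distinct positive integers and $\lambda=(\lambda_1\ge\dots\ge\lambda_m)$ a partition. An augmented filling $T$ of shape $\lambda$ and basement $\beta$ is a filling of the boxes $(i,j)$, $1\le i\le m$, $1\le j\le\lambda_i$ ($i$ = row, $j$ = column), with positive integers $T(i,j)$, augmented by a zeroth column (the basement) with $T(i,0)=\beta_i$. Assume the rows (including the basement entry) are weakly decreasing. An inversion triple (type A) is a triple of boxes $a,b,c$ with $a$ immediately to the left of $b$ (possibly $a$ in the basement), $c$ in the same column as $b$ and somewhere below $b$, the row containing $a,b$ at least as long as the row containing $c$ (automatic for partition shapes), and $T(a)\ge T(c)\ge T(b)$. A key tableau of shape $\lambda$ and basement $\beta$ is an augmented filling of shape $\lambda$ and basement $\beta$ with weakly decreasing rows and without inversion triples. (This is a semi-standard augmented filling of partition shape,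 for which only type A triples are relevant.) Weight. $w(T)=(w_1,w_2,\dots,w_n)$, where $w_i$ is the number of boxes of $T$ with content $i$, not including the basement; $\mathbf{x}^{w(T)}=\prod_i x_i^{w_i}$. Columns of a key tableau below are the non-basement columns. From $\alpha$ to $(\beta(\alpha),\lambda(\alpha))$. Draw the left-justified diagram with row lengths $\alpha_1,\dots,\alpha_n$ from top to bottom, and fill its zeroth column from top to bottom with $n,n-1,\dots,1$. Remove all rows with $\alpha_i=0$ and sort the remaining rows (together with their zeroth-column label) by decreasing number of boxes, preserving the relative order of rows of equal length. The resulting row lengths form the partition $\lambda(\alpha)$ and the resulting zeroth column is $\beta(\alpha)$. E.g. $\alpha=(0,2,3,4,2,0,1)$ gives $\beta(\alpha)=(4,5,6,3,1)$ and $\lambda(\alpha)=(4,3,2,2,1)$. Key polynomial. $\mathcal{K}_\alpha(\mathbf{x})=\sum_T \mathbf{x}^{w(T)}$, the sum over all key tableaux $T$ of shape $\lambda(\alpha)$ and basement $\beta(\alpha)$. Linear recurrence. A sequence $\{a_k\}_{k\ge k_0}$ of polynomials satisfies a linear recurrence with characteristic polynomial $\chi(t)=t^r+c_1t^{r-1}+\dots+c_r$ (the $c_i$ being polynomials in $\mathbf{x}$ independent of $k$) if $a_k+c_1a_{k-1}+\dots+c_ra_{k-r}=0$ for all $k\ge k_0+r$. -}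

module Defs where

open import Data.Bool.Base using (if_then_else_)
open import Data.Fin.Base as Fin using (Fin; zero; suc; toℕ; inject₁)
import Data.Fin.Properties as Fin
open import Data.Integer.Base as ℤ using (ℤ; 0ℤ; 1ℤ)
open import Data.List.Base as List
  using (List; []; _∷_; [_]; _++_; length; map; foldr; filter; concat; zip; take; drop;
         reverse; upTo; downFrom; deduplicate; cartesianProductWith)
import Data.List.Properties as List
open import Data.List.Membership.Propositional using (_∈_)
open import Data.List.Membership.Propositional.Properties
  using (∈-filter⁺; ∈-filter⁻; ∈-map⁺; ∈-upTo⁺; ∈-cartesianProductWith⁺)
open import Data.List.Relation.Unary.Any using (here)
open import Data.List.Relation.Unary.All using ([])
open import Data.List.Relation.Unary.AllPairs using ([]; _∷_)
open import Data.List.Relation.Unary.Unique.Propositional using (Unique)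
import Data.List.Relation.Unary.Unique.Propositional.Properties as Unique
open import Data.Nat.Base using (ℕ; zero; suc; _+_; _*_; _∸_; _⊔_; _≤_; _≥_)
open import Data.Nat.Properties using (_≟_; _≤?_; ≤-refl; ≤-trans)
open import Data.Product.Base using (Σ-syntax; ∃-syntax; _×_; _,_; proj₁; proj₂)
open import Data.Vec.Base as Vec using (Vec; []; _∷_; lookup; toList; fromList; replicate)
import Data.Vec.Properties as Vec
open import Data.Vec.Relation.Unary.All as All using (All; []; _∷_)
open import Data.Vec.Relation.Unary.All.Properties using (lookup⁺)
open import Function.Base using (_∘_)
open import Function.Bundles using (_⇔_; mk⇔)
open import Relation.Binary.PropositionalEquality using (_≡_; refl)
open import Relation.Nullary.Decidable
  using (Dec; does; map′; _×-dec_; _→-dec_; ¬?)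
open import Relation.Nullary.Negation using (¬_)

private
  variable
    m n : ℕ

-- A polynomial in x₁, …, xₙ over ℤ is a formal sum of terms (coefficient ,
-- exponent vector), in which an exponent vector may occur repeatedly; two
-- polynomials are identified (_≈_) when all their collected coefficients agree.

Poly : ℕ → Set
Poly n = List (ℤ × Vec ℕ n)

coeff : Poly n → Vec ℕ n → ℤ
coeff []            e = 0ℤ
coeff ((c , d) ∷ p) e = if does (Vec.≡-dec _≟_ d e) then c ℤ.+ coeff p e else coeff p e

infix 4 _≈_
_≈_ : Poly n → Poly n → Set
p ≈ q = ∀ e → coeff p e ≡ coeff q e

𝟘 : Poly n
𝟘 = []

x^_ : Vec ℕ n → Poly n
x^ w = [ (1ℤ , w) ]

𝟙 : Poly n
𝟙 = x^ (replicate _ 0)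

infixl 6 _⊕_
_⊕_ : Poly n → Poly n → Poly n
_⊕_ = _++_

⊖_ : Poly n → Poly n
⊖_ = map λ (c , d) → ℤ.- c , d

infixl 7 _⊗_
_⊗_ : Poly n → Poly n → Poly n
_⊗_ = cartesianProductWith λ (c , d) (c′ , d′) → c ℤ.* c′ , Vec.zipWith _+_ d d′

∑ : List (Poly n) → Poly n
∑ = foldr _⊕_ 𝟘

-- Polynomials in t over ℤ[x₁, …, xₙ]: the element at position i (counted from 0) is
-- the coefficient of tⁱ.

Poly[t] : ℕ → Set
Poly[t] n = List (Poly n)

coeffₜ : Poly[t] n → ℕ → Poly n
coeffₜ []      i       = 𝟘
coeffₜ (a ∷ p) zero    = a
coeffₜ (a ∷ p) (suc i) = coeffₜ p i

infix 4 _≈ₜ_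
_≈ₜ_ : Poly[t] n → Poly[t] n → Set
p ≈ₜ q = ∀ i → coeffₜ p i ≈ coeffₜ q i

infixl 6 _⊕ₜ_
_⊕ₜ_ : Poly[t] n → Poly[t] n → Poly[t] n
[]      ⊕ₜ q       = q
(a ∷ p) ⊕ₜ []      = a ∷ p
(a ∷ p) ⊕ₜ (b ∷ q) = (a ⊕ b) ∷ (p ⊕ₜ q)

infixl 7 _⊗ₜ_
_⊗ₜ_ : Poly[t] n → Poly[t] n → Poly[t] n
[]      ⊗ₜ q = []
(a ∷ p) ⊗ₜ q = map (a ⊗_) q ⊕ₜ (𝟘 ∷ (p ⊗ₜ q))

∏ₜ : List (Poly[t] n) → Poly[t] n
∏ₜ = foldr _⊗ₜ_ [ 𝟙 ]

t-_ : Poly n → Poly[t] n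
t- a = ⊖ a ∷ 𝟙 ∷ []

-- t^r + c₁ t^(r-1) + ⋯ + c_r
monic : ∀ {r} → Vec (Poly n) r → Poly[t] n
monic c = reverse (𝟙 ∷ toList c)

-- Only the values a k with k ≥ k₀ are constrained: the sequence starts at k₀.
SatisfiesLinearRecurrence : (k₀ : ℕ) → (ℕ → Poly n) → Poly[t] n → Set
SatisfiesLinearRecurrence {n} k₀ a χ =
  ∃[ r ] Σ[ c ∈ Vec (Poly n) r ]
    χ ≈ₜ monic c ×
    (∀ k → k₀ + r ≤ k →
      a k ⊕ ∑ (List.tabulate λ (i : Fin r) → lookup c i ⊗ a (k ∸ suc (toℕ i))) ≈ 𝟘)

-- Row i of a filling T of shape Λ consists of lookup Λ i entries.
Filling : Vec ℕ m → Set
Filling Λ = All (Vec ℕ) Λ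

module _ {Λ : Vec ℕ m} where

  -- Column zero is the basement, so that suc j is the column of the j-th box.
  entry : Vec ℕ m → Filling Λ → (i : Fin m) → Fin (suc (lookup Λ i)) → ℕ
  entry β T i j = lookup (lookup β i ∷ lookup⁺ T i) j

  -- The boxes are a = (i , j), b = (i , j + 1) and c = (i′ , j + 1), where the
  -- column numbers include the basement.
  InversionTriple : Vec ℕ m → Filling Λ →
                    (i i′ : Fin m) → Fin (lookup Λ i) → Fin (lookup Λ i′) → Set
  InversionTriple β T i i′ j j′ =
    i Fin.< i′ ×
    toℕ j ≡ toℕ j′ ×
    lookup Λ i ≥ lookup Λ i′ ×
    entry β T i (inject₁ j) ≥ entry β T i′ (suc j′) ×
    entry β T i′ (suc j′) ≥ entry β T i (suc j)

  record IsKeyTableau (β : Vec ℕ m) (T : Filling Λ) : Set where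
    constructor isKeyTableau
    field
      positive   : ∀ i (j : Fin (lookup Λ i)) → 1 ≤ entry β T i (suc j)
      decreasing : ∀ i (j : Fin (lookup Λ i)) → entry β T i (inject₁ j) ≥ entry β T i (suc j)
      noTriple   : ∀ i i′ j j′ → ¬ InversionTriple β T i i′ j j′

  open IsKeyTableau public

  inversionTriple? : ∀ β T i i′ j j′ → Dec (InversionTriple β T i i′ j j′)
  inversionTriple? β T i i′ j j′ =
    (i Fin.<? i′) ×-dec (toℕ j ≟ toℕ j′) ×-dec (lookup Λ i′ ≤? lookup Λ i) ×-dec
    (_ ≤? _) ×-dec (_ ≤? _)

  isKeyTableau? : ∀ β T → Dec (IsKeyTableau β T)
  isKeyTableau? β T = map′
    (λ (p , d , t) → isKeyTableau p d t)
    (λ k → positive k , decreasing k , noTriple k)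
    ((Fin.all? λ i → Fin.all? λ j → 1 ≤? _) ×-dec
     (Fin.all? λ i → Fin.all? λ j → _ ≤? _) ×-dec
     (Fin.all? λ i → Fin.all? λ i′ → Fin.all? λ j → Fin.all? λ j′ →
       ¬? (inversionTriple? β T i i′ j j′)))

-- The entries of the j-th non-basement column (counted from 0), top to bottom;
-- rows that do not reach this column are skipped.
column : {Λ : Vec ℕ m} → Filling Λ → ℕ → List ℕ
column []      j = []
column (r ∷ T) j = take 1 (drop j (toList r)) ++ column T j

width : Vec ℕ m → ℕ
width = Vec.foldr _ _⊔_ 0

EqualHeightColumnsAgree : {Λ : Vec ℕ m} → Filling Λ → Set
EqualHeightColumnsAgree {Λ = Λ} T = (j j′ : Fin (width Λ)) →
  length (column T (toℕ j)) ≡ length (column T (toℕ j′)) →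
  column T (toℕ j) ≡ column T (toℕ j′)

equalHeightColumnsAgree? : {Λ : Vec ℕ m} (T : Filling Λ) → Dec (EqualHeightColumnsAgree T)
equalHeightColumnsAgree? T = Fin.all? λ j → Fin.all? λ j′ →
  (_ ≟ _) →-dec List.≡-dec _≟_ _ _

contents : {Λ : Vec ℕ m} → Filling Λ → List ℕ
contents T = concat (toList (All.reduce toList T))

-- Position i : Fin n stands for the content i + 1.
weight : ∀ n {Λ : Vec ℕ m} → Filling Λ → Vec ℕ n
weight n T = Vec.tabulate λ i → length (filter (_≟ suc (toℕ i)) (contents T))

words : {A : Set} → List A → ∀ l → List (Vec A l)
words as zero    = [ [] ]
words as (suc l) = cartesianProductWith _∷_ as (words as l)

-- The fillings whose entries in row i lie between 1 and lookup β i.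
boundedFillings : (β Λ : Vec ℕ m) → List (Filling Λ)
boundedFillings []      []      = [ [] ]
boundedFillings (b ∷ β) (l ∷ Λ) =
  cartesianProductWith _∷_ (words (map suc (upTo b)) l) (boundedFillings β Λ)

keyTableaux : (β Λ : Vec ℕ m) → List (Filling Λ)
keyTableaux β Λ = filter (isKeyTableau? β) (boundedFillings β Λ)

-- The bound excludes no key tableau, and each key tableau is listed once.

private
  DecreasingFrom : ∀ {l} → ℕ → Vec ℕ l → Set
  DecreasingFrom {l} b r = ∀ (j : Fin l) → lookup (b ∷ r) (inject₁ j) ≥ lookup r j

  ∈-words : ∀ {l} b b′ (r : Vec ℕ l) → b′ ≤ b → (∀ j → 1 ≤ lookup r j) →
            DecreasingFrom b′ r → r ∈ words (map suc (upTo b)) l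
  ∈-words b b′ []          b′≤b pos dec = here refl
  ∈-words b b′ (zero ∷ r)  b′≤b pos dec with () ← pos zero
  ∈-words b b′ (suc x ∷ r) b′≤b pos dec =
    ∈-cartesianProductWith⁺ _∷_
      (∈-map⁺ suc (∈-upTo⁺ x<b))
      (∈-words b (suc x) r x<b (pos ∘ suc) (dec ∘ suc))
    where x<b = ≤-trans (dec zero) b′≤b

  ∈-boundedFillings : (β Λ : Vec ℕ m) (T : Filling Λ) →
                      (∀ i (j : Fin (lookup Λ i)) → 1 ≤ entry β T i (suc j)) →
                      (∀ i → DecreasingFrom (lookup β i) (lookup⁺ T i)) →
                      T ∈ boundedFillings β Λ
  ∈-boundedFillings []      []      []      pos dec = here refl
  ∈-boundedFillings (b ∷ β) (l ∷ Λ) (r ∷ T) pos dec =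
    ∈-cartesianProductWith⁺ _∷_
      (∈-words b b r ≤-refl (pos zero) (dec zero))
      (∈-boundedFillings β Λ T (pos ∘ suc) (dec ∘ suc))

  words-unique : {A : Set} {as : List A} → Unique as → ∀ l → Unique (words as l)
  words-unique u zero    = [] ∷ []
  words-unique u (suc l) =
    Unique.cartesianProductWith⁺ _∷_ Vec.∷-injective u (words-unique u l)

  boundedFillings-unique : (β Λ : Vec ℕ m) → Unique (boundedFillings β Λ)
  boundedFillings-unique []      []      = [] ∷ []
  boundedFillings-unique (b ∷ β) (l ∷ Λ) =
    Unique.cartesianProductWith⁺ _∷_ (λ { refl → refl , refl })
      (words-unique (Unique.map⁺ (λ { refl → refl }) (Unique.upTo⁺ b)) l)
      (boundedFillings-unique β Λ)

∈-keyTableaux : (β Λ : Vec ℕ m) (T : Filling Λ) → T ∈ keyTableaux β Λ ⇔ IsKeyTableau β T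
∈-keyTableaux β Λ T = mk⇔
  (λ T∈ → proj₂ (∈-filter⁻ (isKeyTableau? β) {xs = boundedFillings β Λ} T∈))
  (λ k → ∈-filter⁺ (isKeyTableau? β)
    (∈-boundedFillings β Λ T (positive k) (decreasing k)) k)

keyTableaux-unique : (β Λ : Vec ℕ m) → Unique (keyTableaux β Λ)
keyTableaux-unique β Λ = Unique.filter⁺ (isKeyTableau? β) (boundedFillings-unique β Λ)

-- Rows are pairs (zeroth-column label , number of boxes). Inserting a row before
-- the rows of equal length makes the sort below stable.

insertRow : ℕ × ℕ → List (ℕ × ℕ) → List (ℕ × ℕ)
insertRow r       []       = [ r ]
insertRow (b , l) (r ∷ rs) =
  if does (proj₂ r ≤? l) then (b , l) ∷ r ∷ rs else r ∷ insertRow (b , l) rs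

labelledRows : Vec ℕ n → List (ℕ × ℕ)
labelledRows {n} α = zip (map suc (downFrom n)) (toList α)

rows : Vec ℕ n → List (ℕ × ℕ)
rows α = foldr insertRow [] (filter (λ r → ¬? (proj₂ r ≟ 0)) (labelledRows α))

basement shape : (α : Vec ℕ n) → Vec ℕ (length (rows α))
basement α = Vec.map proj₁ (fromList (rows α))
shape    α = Vec.map proj₂ (fromList (rows α))

private
  α₀ : Vec ℕ 7
  α₀ = 0 ∷ 2 ∷ 3 ∷ 4 ∷ 2 ∷ 0 ∷ 1 ∷ []

  _ : basement α₀ ≡ 4 ∷ 5 ∷ 6 ∷ 3 ∷ 1 ∷ []
  _ = refl

  _ : shape α₀ ≡ 4 ∷ 3 ∷ 2 ∷ 2 ∷ 1 ∷ []
  _ = refl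

infixr 7 _·_
_·_ : ℕ → Vec ℕ n → Vec ℕ n
k · α = Vec.map (k *_) α

keyPolynomial : Vec ℕ n → Poly n
keyPolynomial {n} α = ∑ (map (λ T → x^ weight n T) (keyTableaux (basement α) (shape α)))

-- The distinct weights of the key tableaux of α whose columns of equal height agree.
columnConstantWeights : Vec ℕ n → List (Vec ℕ n)
columnConstantWeights {n} α = deduplicate (Vec.≡-dec _≟_)
  (map (weight n) (filter equalHeightColumnsAgree? (keyTableaux (basement α) (shape α))))

characteristicPolynomial : Vec ℕ n → Poly[t] n
characteristicPolynomial α = ∏ₜ (map (λ w → t- (x^ w)) (columnConstantWeights α))

-- Column b may follow column a in a key tableau if b ≤ a entrywise and no inversion triple
-- arises, a condition on two adjacent columns only. So 𝒦_{kα} is a sum over walks through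
-- columns, k dₕ of whose columns have height h. Along a walk the entries decrease, hence two
-- different comparable columns of the same height have different weights: the walk sums of
-- one height satisfy a triangular linear recurrence with distinct eigenvalues, and, up to a
-- factor that is not a zero divisor, 𝒦_{kα} is a linear combination of k-th powers of the
-- monomials ∏ₕ (x^{weight of Cₕ})^{dₕ}, for sequences of columns Cₕ, by decreasing height h,
-- the first of which is reachable from the basement and every other one from its predecessor.
--
-- The relation between adjacent columns is not transitive, so Cₕ need not be a possible right
-- neighbour of its predecessor. But it is dominated by it (sorted initial segments are
-- compared entrywise), and a dominated column can be rearranged greedily into a right
-- neighbour that dominates it. Rearranging all Cₕ in turn gives a key tableau of shape
-- λ(α) in which columns of equal height agree, with the same weight. Hence every monomial
-- above is a root of the characteristic polynomial.
module Submission where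

-- The obstacle is division: the solution of a triangular recurrence contains quotients by
-- differences of eigenvalues, and the ring is given only by formal sums. So every step multiplies
-- by a difference instead, and each difference that arises is shown to be regular: x^u - x^v is
-- regular as soon as u and v differ in energy, the sum of the entries, which drops strictly along a
-- walk. The coefficients of the exponential sums are never computed; what is tracked is a predicate
-- on the exponents that occur, since it alone decides which roots the recurrence must have.
--
-- For one height, the recurrence runs in the number N of columns of that height, while the smaller
-- heights contribute their own dependence on k. Hence N and k are independent indices until the
-- recurrence is solved; N = k d is substituted only afterwards.
--
-- Exponents are described by domination instead of by walks because a link of a chain must be
-- removable (for heights with d = 0) and replaceable (by a rearranged column).

open import Algebra.Bundles using (CommutativeRing)
open import Level using (0ℓ)

-- Exponential sums over a commutative ring, up to regular factors.

module ExponentialSums (R : CommutativeRing 0ℓ 0ℓ) where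
  open import Data.List.Base using (List; []; _∷_; _++_; map; foldr; concat)
  open import Data.List.Relation.Unary.All as All using (All; []; _∷_)
  import Data.List.Relation.Unary.All.Properties as All
  open import Data.List.Relation.Binary.Permutation.Propositional as Permutation using (_↭_)
  open import Data.List.Membership.Propositional using (_∈_)
  open import Data.List.Relation.Unary.Any using (here; there)
  open import Data.Nat.Base as ℕ using (ℕ; zero; suc; _≤_; _<_)
  import Data.Nat.Properties as ℕ
  open import Data.Nat.Induction using (<-wellFounded)
  open import Induction.WellFounded using (Acc; acc)
  open import Data.Product.Base using (_×_; _,_; proj₁; proj₂; ∃-syntax; uncurry; map₁)
  open import Data.Vec.Base using ([]; _∷_)
  open import Function.Base using (_∘_)
  open import Relation.Binary.PropositionalEquality as ≡ using (_≡_)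

  open CommutativeRing R
  open import Algebra.Properties.CommutativeSemiring.Exp commutativeSemiring using (_^_)
  open import Algebra.Properties.Ring ring using (-1*x≈-x)
  open import Algebra.Solver.Ring.NaturalCoefficients.Default commutativeSemiring
    using (_:+_; _:*_; _:=_) renaming (solve to solve-semiring)
  open import Relation.Binary.Reasoning.Setoid setoid

  *-swap : ∀ d c f → d * (c * f) ≈ c * (d * f)
  *-swap = solve-semiring 3 (λ d c f → d :* (c :* f) := c :* (d :* f)) refl

  -- Subtraction is written with the scalar `- 1#`, which the semiring solver can treat as one more
  -- variable; what remains of such an identity is this cancellation.
  x+-1*x≈0 : ∀ x → x + - 1# * x ≈ 0#
  x+-1*x≈0 x = trans (+-congˡ (-1*x≈-x x)) (-‿inverseʳ x)

  Regular : Carrier → Set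
  Regular c = ∀ {x} → c * x ≈ 0# → x ≈ 0#

  regular-1 : Regular 1#
  regular-1 {x} eq = trans (sym (*-identityˡ x)) eq

  regular-* : ∀ {c d} → Regular c → Regular d → Regular (c * d)
  regular-* c-regular d-regular eq = d-regular (c-regular (trans (sym (*-assoc _ _ _)) eq))

  total : {A : Set} → (A → Carrier) → List A → Carrier
  total f = foldr (λ a s → f a + s) 0#

  total-cong : {A : Set} {f g : A → Carrier} (as : List A) →
               (∀ {a} → a ∈ as → f a ≈ g a) → total f as ≈ total g as
  total-cong []       eq = refl
  total-cong (a ∷ as) eq = +-cong (eq (here ≡.refl)) (total-cong as (eq ∘ there))

  total-* : {A : Set} (c : Carrier) (f : A → Carrier) (as : List A) →
            total (λ a → c * f a) as ≈ c * total f as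
  total-* c f []       = sym (zeroʳ c)
  total-* c f (a ∷ as) = trans (+-congˡ (total-* c f as)) (sym (distribˡ c _ _))

  total-++ : {A : Set} (f : A → Carrier) (as bs : List A) →
             total f (as ++ bs) ≈ total f as + total f bs
  total-++ f []       bs = sym (+-identityˡ _)
  total-++ f (a ∷ as) bs = trans (+-congˡ (total-++ f as bs)) (sym (+-assoc _ _ _))

  total-map : {A B : Set} (f : B → Carrier) (g : A → B) (as : List A) →
              total f (map g as) ≡ total (f ∘ g) as
  total-map f g []       = ≡.refl
  total-map f g (a ∷ as) = ≡.cong (f (g a) +_) (total-map f g as)

  total-concat : {A B : Set} (f : B → Carrier) (g : A → List B) (as : List A) →
                 total f (concat (map g as)) ≈ total (λ a → total f (g a)) as
  total-concat f g []       = refl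
  total-concat f g (a ∷ as) = trans (total-++ f (g a) (concat (map g as))) (+-congˡ (total-concat f g as))

  total-↭ : {A : Set} (f : A → Carrier) {as bs : List A} → as ↭ bs → total f as ≈ total f bs
  total-↭ f Permutation.refl         = refl
  total-↭ f (Permutation.prep a p)   = +-congˡ (total-↭ f p)
  total-↭ f (Permutation.swap a b p) = trans (sym (+-assoc (f a) (f b) _))
    (trans (+-cong (+-comm (f a) (f b)) (total-↭ f p)) (+-assoc (f b) (f a) _))
  total-↭ f (Permutation.trans p q)  = trans (total-↭ f p) (total-↭ f q)

  -- Exponential χ Q F says that F, after multiplication by a regular element, is a
  -- linear combination of the sequences χ j with Q j. Instead of dividing by differences
  -- of eigenvalues we collect them in the regular factor.
  record Exponential {I J : Set} (χ : J → I → Carrier) (Q : J → Set) (F : I → Carrier) : Set where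
    constructor exponential
    field
      factor    : Carrier
      regular   : Regular factor
      terms     : List (Carrier × J)
      admitted  : All (Q ∘ proj₂) terms
      expansion : ∀ i → factor * F i ≈ total (λ (p , j) → p * χ j i) terms

  module _ {I J : Set} {χ : J → I → Carrier} where

    weaken : ∀ {Q Q′ F} → (∀ {j} → Q j → Q′ j) → Exponential χ Q F → Exponential χ Q′ F
    weaken Q⊆Q′ (exponential d reg ts ok eq) = exponential d reg ts (All.map Q⊆Q′ ok) eq

    respect : ∀ {Q F G} → (∀ i → F i ≈ G i) → Exponential χ Q F → Exponential χ Q G
    respect F≈G (exponential d reg ts ok eq) =
      exponential d reg ts ok λ i → trans (*-congˡ (sym (F≈G i))) (eq i)

    scaleTerms : Carrier → List (Carrier × J) → List (Carrier × J)
    scaleTerms c = map (map₁ (c *_))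

    total-scaleTerms : ∀ c ts i →
      total (λ (p , j) → p * χ j i) (scaleTerms c ts) ≈ c * total (λ (p , j) → p * χ j i) ts
    total-scaleTerms c ts i =
      trans (reflexive (total-map (λ (p , j) → p * χ j i) (map₁ (c *_)) ts))
        (trans (total-cong ts (λ {t} _ → *-assoc c (proj₁ t) (χ (proj₂ t) i))) (total-* c _ ts))

    exponential-0 : ∀ {Q} → Exponential χ Q (λ _ → 0#)
    exponential-0 = exponential 1# regular-1 [] [] λ i → zeroʳ 1#

    exponential-term : ∀ {Q} p {j} → Q j → Exponential χ Q (λ i → p * χ j i)
    exponential-term p {j} q = exponential 1# regular-1 ((p , j) ∷ []) (q ∷ [])
      λ i → trans (*-identityˡ _) (sym (+-identityʳ _))

    -- Addition of fractions over the product of the denominators: each list of terms is scaled by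
    -- the factor of the other.
    exponential-+ : ∀ {Q F G} → Exponential χ Q F → Exponential χ Q G →
                    Exponential χ Q (λ i → F i + G i)
    exponential-+ {Q} {F} {G} (exponential d reg ts ok eq) (exponential d′ reg′ ts′ ok′ eq′) =
      exponential (d * d′) (regular-* reg reg′) (scaleTerms d′ ts ++ scaleTerms d ts′)
        (All.++⁺ (All.map⁺ ok) (All.map⁺ ok′)) λ i → begin
          d * d′ * (F i + G i)                   ≈⟨ lemma d d′ (F i) (G i) ⟩
          d′ * (d * F i) + d * (d′ * G i)        ≈⟨ +-cong (*-congˡ (eq i)) (*-congˡ (eq′ i)) ⟩
          d′ * total _ ts + d * total _ ts′      ≈⟨ +-cong (total-scaleTerms d′ ts i) (total-scaleTerms d ts′ i) ⟨
          total _ (scaleTerms d′ ts) + total _ (scaleTerms d ts′)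
                                                 ≈⟨ total-++ _ (scaleTerms d′ ts) (scaleTerms d ts′) ⟨
          total _ (scaleTerms d′ ts ++ scaleTerms d ts′) ∎
      where
      lemma : ∀ d d′ f g → d * d′ * (f + g) ≈ d′ * (d * f) + d * (d′ * g)
      lemma = solve-semiring 4 (λ d d′ f g → (d :* d′) :* (f :+ g) := d′ :* (d :* f) :+ d :* (d′ :* g)) refl

    exponential-* : ∀ {Q F} c → Exponential χ Q F → Exponential χ Q (λ i → c * F i)
    exponential-* {F = F} c (exponential d reg ts ok eq) =
      exponential d reg (scaleTerms c ts) (All.map⁺ ok) λ i →
        trans (*-swap d c (F i)) (trans (*-congˡ (eq i)) (sym (total-scaleTerms c ts i)))

    -- This takes the place of division by `c`: the terms stay as they are and the factor absorbs
    -- `c`.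
    exponential-cancel : ∀ {Q F c} → Regular c → Exponential χ Q (λ i → c * F i) → Exponential χ Q F
    exponential-cancel c-regular (exponential d reg ts ok eq) =
      exponential (d * _) (regular-* reg c-regular) ts ok λ i → trans (*-assoc d _ _) (eq i)

    exponential-total : ∀ {Q} {A : Set} (F : A → I → Carrier) as →
                        (∀ {a} → a ∈ as → Exponential χ Q (F a)) →
                        Exponential χ Q (λ i → total (λ a → F a i) as)
    exponential-total F []       ok = exponential-0
    exponential-total F (a ∷ as) ok =
      exponential-+ (ok (here ≡.refl)) (exponential-total F as (ok ∘ there))

  -- Serves two purposes: multiplying a sequence in k by a power that depends on N (with `σ` the
  -- projection), and restricting a sequence in (N , k) to N = k d (with `σ` the diagonal map).
  -- Unlike in `exponential-*`, the multiplier may depend on the index.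
  reindex : ∀ {I J I′ J′ : Set} {χ : J → I → Carrier} {χ′ : J′ → I′ → Carrier}
            {Q : J → Set} {Q′ : J′ → Set} {F : I → Carrier}
            (σ : I′ → I) (τ : J → J′) (c : I′ → Carrier) →
            (∀ j i → c i * χ j (σ i) ≈ χ′ (τ j) i) → (∀ {j} → Q j → Q′ (τ j)) →
            Exponential χ Q F → Exponential χ′ Q′ (λ i → c i * F (σ i))
  reindex {χ = χ} {χ′} {F = F} σ τ c eq-χ Q⊆Q′ (exponential d reg ts ok eq) =
    exponential d reg (map (λ (p , j) → p , τ j) ts) (All.map⁺ (All.map Q⊆Q′ ok)) λ i → begin
      d * (c i * F (σ i))                       ≈⟨ *-swap d (c i) (F (σ i)) ⟩
      c i * (d * F (σ i))                       ≈⟨ *-congˡ (eq (σ i)) ⟩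
      c i * total (λ (p , j) → p * χ j (σ i)) ts
        ≈⟨ total-* (c i) _ ts ⟨
      total (λ (p , j) → c i * (p * χ j (σ i))) ts
        ≈⟨ total-cong ts (λ {(p , j)} _ → trans (*-swap (c i) p (χ j (σ i))) (*-congˡ (eq-χ j i))) ⟩
      total (λ (p , j) → p * χ′ (τ j) i) ts
        ≡⟨ total-map (λ (p , j) → p * χ′ j i) (λ (p , j) → p , τ j) ts ⟨
      total (λ (p , j) → p * χ′ j i) (map (λ (p , j) → p , τ j) ts) ∎

  module _ {W : Set} (value : W → Carrier) where

    χ₁ : W → ℕ → Carrier
    χ₁ w k = value w ^ k

    χ₂ : W × W → ℕ × ℕ → Carrier
    χ₂ (u , w) (N , k) = value u ^ N * value w ^ k

    -- For a summand p u^N w^k of the inhomogeneity, c p (u^N - b^N) w^k / (u - b) is a particular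
    -- solution that vanishes at N = 0. Multiplying `f` by u - b and subtracting the numerator gives
    -- `g`, which has one summand less and initial values changed only by the factor u - b. The
    -- scalar `c` is general because it gains this factor at every removal.
    solveTerms : ∀ {Q} (b : W) (c : Carrier) (ts : List (Carrier × (W × W))) →
      All (λ (p , u , w) → Q (u , w) × Q (b , w) × Regular (value u + - 1# * value b)) ts →
      (f : ℕ → ℕ → Carrier) →
      Exponential χ₂ Q (λ (N , k) → value b ^ N * f 0 k) →
      (∀ N k → f (suc N) k ≈ value b * f N k + c * total (λ (p , j) → p * χ₂ j (N , k)) ts) →
      Exponential χ₂ Q (uncurry f)
    solveTerms b c [] [] f f₀ step = respect (λ (N , k) → sym (homogeneous N k)) f₀
      where
      homogeneous : ∀ N k → f N k ≈ value b ^ N * f 0 k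
      homogeneous zero    k = sym (*-identityˡ _)
      homogeneous (suc N) k = begin
        f (suc N) k                      ≈⟨ step N k ⟩
        value b * f N k + c * 0#         ≈⟨ +-congˡ (zeroʳ c) ⟩
        value b * f N k + 0#             ≈⟨ +-identityʳ _ ⟩
        value b * f N k                  ≈⟨ *-congˡ (homogeneous N k) ⟩
        value b * (value b ^ N * f 0 k)  ≈⟨ *-assoc _ _ _ ⟨
        value b * value b ^ N * f 0 k    ∎
    solveTerms {Q} b c ((p , u , w) ∷ ts) ((q , q′ , reg) ∷ ok) f f₀ step =
      exponential-cancel reg (respect split
        (exponential-+ reduced (exponential-+ (exponential-term (c * p) q) (exponential-term (s * (c * p)) q′))))
      where
      s y z : Carrier
      s = - 1#
      y = value u
      z = value b
      g : ℕ → ℕ → Carrier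
      g N k = (y + s * z) * f N k + c * p * (s * χ₂ (u , w) (N , k) + χ₂ (b , w) (N , k))
      cancel : ∀ x z → x + (z + s * z) ≈ x
      cancel x z = trans (+-congˡ (x+-1*x≈0 z)) (+-identityʳ x)
      split : ∀ ((N , k) : ℕ × ℕ) →
        g N k + (c * p * χ₂ (u , w) (N , k) + s * (c * p) * χ₂ (b , w) (N , k)) ≈ (y + s * z) * f N k
      split (N , k) = trans
        (solve-semiring 5 (λ a p U B s →
            (a :+ p :* (s :* U :+ B)) :+ (p :* U :+ (s :* p) :* B) :=
            a :+ (p :* (U :+ B) :+ s :* (p :* (U :+ B)))) refl
          ((y + s * z) * f N k) (c * p) (χ₂ (u , w) (N , k)) (χ₂ (b , w) (N , k)) s)
        (cancel _ _)
      g₀ : ∀ k → g 0 k ≈ (y + s * z) * f 0 k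
      g₀ k = trans
        (solve-semiring 4 (λ a p U s → a :+ p :* (s :* U :+ U) := a :+ (p :* U :+ s :* (p :* U))) refl
          ((y + s * z) * f 0 k) (c * p) (1# * value w ^ k) s)
        (cancel _ _)
      g-step : ∀ N k → g (suc N) k ≈
        z * g N k + (y + s * z) * c * total (λ (p , j) → p * χ₂ j (N , k)) ts
      g-step N k = trans (+-congʳ (*-congˡ (step N k))) (trans
        (solve-semiring 10 (λ y z F c p U B V S s →
            (y :+ s :* z) :* (z :* F :+ c :* (p :* (U :* V) :+ S)) :+
              (c :* p) :* (s :* ((y :* U) :* V) :+ (z :* B) :* V) :=
            (z :* ((y :+ s :* z) :* F :+ (c :* p) :* (s :* (U :* V) :+ B :* V)) :+
              ((y :+ s :* z) :* c) :* S) :+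
              (c :* p :* y :* U :* V :+ s :* (c :* p :* y :* U :* V))) refl
          y z (f N k) c p (y ^ N) (z ^ N) (value w ^ k) (total (λ (p , j) → p * χ₂ j (N , k)) ts) s)
        (cancel _ _))
      reduced : Exponential χ₂ Q (uncurry g)
      reduced = solveTerms b ((y + s * z) * c) ts ok g
        (respect (λ (N , k) → trans (*-swap (y + s * z) _ (f 0 k)) (*-congˡ (sym (g₀ k))))
          (exponential-* (y + s * z) f₀))
        g-step

    -- Multiplying `f` by the factor of `h` turns the inhomogeneity into an actual sum of terms, to
    -- which `solveTerms` applies.
    solve : ∀ {Q Q′} (b : W) (f h : ℕ → ℕ → Carrier) →
      Exponential χ₂ Q (λ (N , k) → value b ^ N * f 0 k) →
      Exponential χ₂ Q′ (uncurry h) →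
      (∀ {u w} → Q′ (u , w) → Q (u , w) × Q (b , w) × Regular (value u + - 1# * value b)) →
      (∀ N k → f (suc N) k ≈ value b * f N k + h N k) →
      Exponential χ₂ Q (uncurry f)
    solve b f h f₀ (exponential d reg ts ok eq) Q′⊆Q step = exponential-cancel reg
      (solveTerms b 1# ts (All.map Q′⊆Q ok) (λ N k → d * f N k)
        (respect (λ (N , k) → *-swap d _ (f 0 k)) (exponential-* d f₀))
        λ N k → begin
          d * f (suc N) k                      ≈⟨ *-congˡ (step N k) ⟩
          d * (value b * f N k + h N k)        ≈⟨ distribˡ d _ _ ⟩
          d * (value b * f N k) + d * h N k    ≈⟨ +-cong (*-swap d _ _) (trans (eq (N , k)) (sym (*-identityˡ _))) ⟩
          value b * (d * f N k) + 1# * total _ ts ∎)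

    -- There is one unknown sequence f B for every state B. The dependencies between these
    -- sequences are contained in ⊵, and G B collects the exponents of k in the initial
    -- values of f B.
    triangular : {S : Set} (Good : S → Set) (weight : S → W) (strict : S → List S) (E : S → ℕ)
      (_⊵_ : S → S → Set) (G : S → W → Set)
      (f : S → ℕ → ℕ → Carrier) (g : S → ℕ → Carrier) →
      (∀ {B} → B ⊵ B) → (∀ {A B C} → A ⊵ B → B ⊵ C → A ⊵ C) →
      (∀ {A B w} → A ⊵ B → G B w → G A w) →
      (∀ {B C} → Good B → C ∈ strict B → Good C × B ⊵ C × E C < E B) →
      (∀ {B C} → E C < E B → Good B → Good C → Regular (value (weight C) + - 1# * value (weight B))) →
      (∀ {B} → Good B → Exponential χ₁ (G B) (g B)) →
      (∀ {B} → Good B → ∀ k → f B 0 k ≈ g B k) →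
      (∀ {B} → Good B → ∀ N k →
        f B (suc N) k ≈ value (weight B) * f B N k + total (λ C → value (weight C) * f C N k) (strict B)) →
      ∀ {B} → Good B →
      Exponential χ₂ (λ (u , w) → ∃[ C ] Good C × B ⊵ C × u ≡ weight C × G C w) (uncurry (f B))
    triangular {S} Good weight strict E _⊵_ G f g ⊵-refl ⊵-trans G-mono descend regular-≠ g-exp initial step good =
      weaken (λ (C , gC , B⊵C , _ , u≡ , Gw) → C , gC , B⊵C , u≡ , Gw) (go (<-wellFounded _) good)
      where
      -- The bound on `E C` strengthens the induction hypothesis: its strict form `P′` guarantees
      -- that the eigenvalues below `B` differ from that of `B` by a regular element.
      P : S → W × W → Set
      P B (u , w) = ∃[ C ] Good C × B ⊵ C × E C ≤ E B × u ≡ weight C × G C w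
      P′ : S → W × W → Set
      P′ B (u , w) = ∃[ C ] Good C × B ⊵ C × E C < E B × u ≡ weight C × G C w
      go : ∀ {B} → Acc _<_ (E B) → Good B → Exponential χ₂ (P B) (uncurry (f B))
      go {B} (acc smaller) good = solve {P B} {P′ B} (weight B) (f B)
        (λ N k → total (λ C → value (weight C) * f C N k) (strict B))
        (reindex {χ = χ₁} {F = f B 0} proj₂ (weight B ,_) (λ (N , k) → value (weight B) ^ N)
          (λ j i → refl) (λ Gw → B , good , ⊵-refl , ℕ.≤-refl , ≡.refl , Gw)
          (respect (λ k → sym (initial good k)) (g-exp good)))
        (exponential-total (λ C (N , k) → value (weight C) * f C N k) (strict B) λ {C} C∈ →
          let goodC , B⊵C , C<B = descend good C∈ in
          exponential-* (value (weight C))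
            (weaken (λ (D , gD , C⊵D , D≤C , u≡ , Gw) →
                D , gD , ⊵-trans B⊵C C⊵D , ℕ.≤-<-trans D≤C C<B , u≡ , Gw)
              (go (smaller C<B) goodC)))
        (λ { (C , gC , B⊵C , C<B , ≡.refl , Gw) →
            (C , gC , B⊵C , ℕ.<⇒≤ C<B , ≡.refl , Gw) ,
            (B , good , ⊵-refl , ℕ.≤-refl , ≡.refl , G-mono B⊵C Gw) ,
            regular-≠ C<B good gC })
        (step good)

-- Linear recurrences as products of first-order difference operators.

module Recurrences (R : CommutativeRing 0ℓ 0ℓ) where
  open import Data.List.Base using (List; []; _∷_; length)
  open import Data.List.Relation.Unary.All using (All; []; _∷_)
  open import Data.List.Membership.Propositional using (_∈_)
  open import Data.List.Relation.Unary.Any using (here; there)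
  open import Data.Nat.Base as ℕ using (ℕ; suc; _≤_; _∸_; s≤s)
  import Data.Nat.Properties as ℕ
  open import Data.Product.Base using (_×_; _,_)
  open import Data.Vec.Base using (Vec; []; _∷_)
  open import Relation.Binary.PropositionalEquality as ≡ using (_≡_)

  open ExponentialSums R
  open CommutativeRing R
  open import Algebra.Solver.Ring.NaturalCoefficients.Default commutativeSemiring
    using (_:+_; _:*_; _:=_) renaming (solve to solve-semiring)
  open import Relation.Binary.Reasoning.Setoid setoid

  -- c₁ a (k - 1) + ⋯ + c_r a (k - r); for k < r the subtractions are truncated.
  lowerTerms : ∀ {r} → Vec Carrier r → (ℕ → Carrier) → ℕ → Carrier
  lowerTerms []      a k = 0#
  lowerTerms (c ∷ cs) a k = c * a (k ∸ 1) + lowerTerms cs a (k ∸ 1)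

  -- timesLinear b 1# computes the lower coefficients, in descending order, of the product
  -- of t - b with the monic polynomial whose lower coefficients are cs; the middle
  -- argument is the preceding coefficient.
  timesLinear : ∀ {r} → Carrier → Carrier → Vec Carrier r → Vec Carrier (suc r)
  timesLinear b p []       = - 1# * b * p ∷ []
  timesLinear b p (c ∷ cs) = c + - 1# * b * p ∷ timesLinear b c cs

  productCoefficients : (bs : List Carrier) → Vec Carrier (length bs)
  productCoefficients []       = []
  productCoefficients (b ∷ bs) = timesLinear b 1# (productCoefficients bs)

  -- The operator ∏ (1 - b S) with S the backward shift, which encodes the recurrence with
  -- characteristic polynomial ∏ (t - b). Truncation of `k ∸ 1` makes the first values spurious, one
  -- more for each factor; hence the bounds involving `length bs` in what follows.
  factors : List Carrier → (ℕ → Carrier) → ℕ → Carrier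
  factors []       a = a
  factors (b ∷ bs) a = factors bs λ k → a k + - 1# * b * a (k ∸ 1)

  lowerTerms-timesLinear : ∀ {r} b p (cs : Vec Carrier r) a k →
    lowerTerms (timesLinear b p cs) a k ≈
    lowerTerms cs a k + - 1# * b * (p * a (k ∸ 1) + lowerTerms cs a (k ∸ 1))
  lowerTerms-timesLinear b p [] a k = begin
    - 1# * b * p * a (k ∸ 1) + 0#         ≈⟨ +-identityʳ _ ⟩
    - 1# * b * p * a (k ∸ 1)              ≈⟨ *-assoc _ _ _ ⟩
    - 1# * b * (p * a (k ∸ 1))            ≈⟨ *-congˡ (+-identityʳ _) ⟨
    - 1# * b * (p * a (k ∸ 1) + 0#)       ≈⟨ +-identityˡ _ ⟨
    0# + - 1# * b * (p * a (k ∸ 1) + 0#)  ∎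
  lowerTerms-timesLinear b p (c ∷ cs) a k = trans
    (+-congˡ (lowerTerms-timesLinear b c cs a (k ∸ 1)))
    (solve-semiring 7 (λ c b p A S B T →
        (c :+ b :* p) :* A :+ (S :+ b :* (c :* B :+ T)) :=
        (c :* A :+ S) :+ b :* (p :* A :+ (c :* B :+ T))) refl
      c (- 1# * b) p (a (k ∸ 1)) (lowerTerms cs a (k ∸ 1)) (a (k ∸ 1 ∸ 1)) (lowerTerms cs a (k ∸ 1 ∸ 1)))

  lowerTerms-linear : ∀ {r} (cs : Vec Carrier r) d a a′ k →
    lowerTerms cs (λ i → a i + d * a′ i) k ≈ lowerTerms cs a k + d * lowerTerms cs a′ k
  lowerTerms-linear []       d a a′ k = sym (trans (+-identityˡ _) (zeroʳ d))
  lowerTerms-linear (c ∷ cs) d a a′ k = trans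
    (+-congˡ (lowerTerms-linear cs d a a′ (k ∸ 1)))
    (solve-semiring 6 (λ c d A A′ S S′ →
        c :* (A :+ d :* A′) :+ (S :+ d :* S′) := (c :* A :+ S) :+ d :* (c :* A′ :+ S′)) refl
      c d (a (k ∸ 1)) (a′ (k ∸ 1)) (lowerTerms cs a (k ∸ 1)) (lowerTerms cs a′ (k ∸ 1)))

  lowerTerms-pred : ∀ {r} (cs : Vec Carrier r) a k →
    lowerTerms cs (λ i → a (i ∸ 1)) k ≡ lowerTerms cs a (k ∸ 1)
  lowerTerms-pred []       a k = ≡.refl
  lowerTerms-pred (c ∷ cs) a k = ≡.cong (c * a (k ∸ 1 ∸ 1) +_) (lowerTerms-pred cs a (k ∸ 1))

  -- The bridge between the coefficient form of a recurrence and the factored form, in which the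
  -- roots can be treated one at a time. Both sides truncate indices alike, so they agree for small
  -- `k` as well.
  factors-expand : ∀ bs a k → a k + lowerTerms (productCoefficients bs) a k ≈ factors bs a k
  factors-expand []       a k = +-identityʳ _
  factors-expand (b ∷ bs) a k = begin
    a k + lowerTerms (timesLinear b 1# cs) a k
      ≈⟨ +-congˡ (lowerTerms-timesLinear b 1# cs a k) ⟩
    a k + (lowerTerms cs a k + d * (1# * a (k ∸ 1) + lowerTerms cs a (k ∸ 1)))
      ≈⟨ +-congˡ (+-congˡ (*-congˡ (+-congʳ (*-identityˡ _)))) ⟩
    a k + (lowerTerms cs a k + d * (a (k ∸ 1) + lowerTerms cs a (k ∸ 1)))
      ≈⟨ solve-semiring 5 (λ A S d B T → A :+ (S :+ d :* (B :+ T)) := (A :+ d :* B) :+ (S :+ d :* T)) refl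
           (a k) (lowerTerms cs a k) d (a (k ∸ 1)) (lowerTerms cs a (k ∸ 1)) ⟩
    a k + d * a (k ∸ 1) + (lowerTerms cs a k + d * lowerTerms cs a (k ∸ 1))
      ≡⟨ ≡.cong (λ s → a k + d * a (k ∸ 1) + (lowerTerms cs a k + d * s)) (lowerTerms-pred cs a k) ⟨
    a k + d * a (k ∸ 1) + (lowerTerms cs a k + d * lowerTerms cs (λ i → a (i ∸ 1)) k)
      ≈⟨ +-congˡ (lowerTerms-linear cs d a (λ i → a (i ∸ 1)) k) ⟨
    a k + d * a (k ∸ 1) + lowerTerms cs (λ i → a i + d * a (i ∸ 1)) k
      ≈⟨ factors-expand bs (λ i → a i + d * a (i ∸ 1)) k ⟩
    factors (b ∷ bs) a k ∎
    where
    cs = productCoefficients bs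
    d = - 1# * b

  private
    shrink : ∀ {k₀ r k} → k₀ ℕ.+ suc r ≤ k → suc k₀ ℕ.+ r ≤ k
    shrink {k = k} = ≡.subst (_≤ k) (ℕ.+-suc _ _)

  -- Each factor looks one step back, so the range in which the sequences are known to agree starts
  -- one later after each of them.
  factors-cong : ∀ bs {k₀ a a′} → (∀ k → k₀ ≤ k → a k ≈ a′ k) →
                 ∀ k → k₀ ℕ.+ length bs ≤ k → factors bs a k ≈ factors bs a′ k
  factors-cong []       {k₀} eq k k₀≤k = eq k (≡.subst (_≤ k) (ℕ.+-identityʳ k₀) k₀≤k)
  factors-cong (b ∷ bs) eq k k₀≤k = factors-cong bs
    (λ { (suc k) (s≤s k₀≤k) → +-cong (eq (suc k) (ℕ.m≤n⇒m≤1+n k₀≤k)) (*-congˡ (eq k k₀≤k)) }) k (shrink k₀≤k)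

  factors-linear : ∀ bs d a a′ k →
    factors bs (λ i → a i + d * a′ i) k ≈ factors bs a k + d * factors bs a′ k
  factors-linear bs d a a′ k = begin
    factors bs (λ i → a i + d * a′ i) k
      ≈⟨ factors-expand bs _ k ⟨
    a k + d * a′ k + lowerTerms cs (λ i → a i + d * a′ i) k
      ≈⟨ +-congˡ (lowerTerms-linear cs d a a′ k) ⟩
    a k + d * a′ k + (lowerTerms cs a k + d * lowerTerms cs a′ k)
      ≈⟨ solve-semiring 5 (λ A d A′ S S′ →
           (A :+ d :* A′) :+ (S :+ d :* S′) := (A :+ S) :+ d :* (A′ :+ S′)) refl
           (a k) d (a′ k) (lowerTerms cs a k) (lowerTerms cs a′ k) ⟩
    a k + lowerTerms cs a k + d * (a′ k + lowerTerms cs a′ k)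
      ≈⟨ +-cong (factors-expand bs a k) (*-congˡ (factors-expand bs a′ k)) ⟩
    factors bs a k + d * factors bs a′ k
      ∎
    where cs = productCoefficients bs

  module _ (bs : List Carrier) {k : ℕ} (r≤k : length bs ≤ k) where

    factors-0 : factors bs (λ _ → 0#) k ≈ 0#
    -- Writing the zero sequence as 0 - 0, linearity makes its image a difference of two equal
    -- values.
    factors-0 = trans (factors-cong bs (λ _ _ → sym (x+-1*x≈0 0#)) k r≤k)
      (trans (factors-linear bs (- 1#) (λ _ → 0#) (λ _ → 0#) k) (x+-1*x≈0 _))

    factors-* : ∀ c a → factors bs (λ i → c * a i) k ≈ c * factors bs a k
    factors-* c a = trans (factors-cong bs (λ _ _ → sym (+-identityˡ _)) k r≤k)
      (trans (factors-linear bs c (λ _ → 0#) a k) (trans (+-congʳ factors-0) (+-identityˡ _)))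

    factors-total : ∀ {J : Set} (χ : J → ℕ → Carrier) (ts : List (Carrier × J)) →
      factors bs (λ i → total (λ (p , j) → p * χ j i) ts) k ≈
      total (λ (p , j) → p * factors bs (χ j) k) ts
    factors-total χ []             = factors-0
    factors-total χ ((p , j) ∷ ts) = begin
      factors bs (λ i → p * χ j i + total (λ (p , j) → p * χ j i) ts) k
        ≈⟨ factors-cong bs (λ _ _ → +-comm _ _) k r≤k ⟩
      factors bs (λ i → total (λ (p , j) → p * χ j i) ts + p * χ j i) k
        ≈⟨ factors-linear bs p _ (χ j) k ⟩
      factors bs (λ i → total (λ (p , j) → p * χ j i) ts) k + p * factors bs (χ j) k
        ≈⟨ +-comm _ _ ⟩
      p * factors bs (χ j) k + factors bs (λ i → total (λ (p , j) → p * χ j i) ts) k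
        ≈⟨ +-congˡ (factors-total χ ts) ⟩
      p * factors bs (χ j) k + total (λ (p , j) → p * factors bs (χ j) k) ts
        ∎

  -- Factors before the matching one send a geometric sequence to one with the same ratio, the
  -- matching factor annihilates it, and the later ones preserve zero. The ratio is only required
  -- from `k₀` on, since every factor spoils one initial value.
  factors-geometric : ∀ bs {k₀ v a} → v ∈ bs → (∀ k → k₀ ≤ k → a (suc k) ≈ v * a k) →
                      ∀ k → k₀ ℕ.+ length bs ≤ k → factors bs a k ≈ 0#
  factors-geometric (b ∷ bs) {k₀} {a = a} (here ≡.refl) geometric k r≤k = trans
    (factors-cong bs {suc k₀} (λ { (suc k) (s≤s k₀≤k) → killed k k₀≤k }) k (shrink r≤k))
    (factors-0 bs (ℕ.≤-trans (ℕ.m≤n+m _ _) (shrink {k₀} r≤k)))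
    where
    killed : ∀ k → k₀ ≤ k → a (suc k) + - 1# * b * a k ≈ 0#
    killed k k₀≤k = trans (+-cong (geometric k k₀≤k) (*-assoc _ _ _)) (x+-1*x≈0 _)
  factors-geometric (b ∷ bs) {k₀} {v} {a} (there v∈bs) geometric k r≤k =
    factors-geometric bs {suc k₀} v∈bs (λ { (suc k) (s≤s k₀≤k) → still k k₀≤k }) k (shrink r≤k)
    where
    still : ∀ k → k₀ ≤ k →
      a (suc (suc k)) + - 1# * b * a (suc k) ≈ v * (a (suc k) + - 1# * b * a k)
    still k k₀≤k = trans
      (+-cong (geometric (suc k) (ℕ.m≤n⇒m≤1+n k₀≤k)) (*-congˡ (geometric k k₀≤k)))
      (solve-semiring 4 (λ v A d B → v :* A :+ d :* (v :* B) := v :* (A :+ d :* B)) refl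
        v (a (suc k)) (- 1# * b) (a k))

  -- The factor of the expansion is independent of k, so it passes through the operator and can be
  -- cancelled at the end by regularity.
  factors-exponential : ∀ {W : Set} (value : W → Carrier) bs {a} →
    Exponential (χ₁ value) (λ w → value w ∈ bs) a → ∀ k → length bs ≤ k → factors bs a k ≈ 0#
  factors-exponential value bs {a} (exponential d reg ts ok eq) k r≤k = reg (begin
    d * factors bs a k
      ≈⟨ factors-* bs r≤k d a ⟨
    factors bs (λ i → d * a i) k
      ≈⟨ factors-cong bs (λ i _ → eq i) k r≤k ⟩
    factors bs (λ i → total (λ (p , j) → p * χ₁ value j i) ts) k
      ≈⟨ factors-total bs r≤k (χ₁ value) ts ⟩
    total (λ (p , j) → p * factors bs (χ₁ value j) k) ts
      ≈⟨ vanish ok ⟩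
    0# ∎)
    where
    vanish : ∀ {ts} → All (λ (p , w) → value w ∈ bs) ts →
             total (λ (p , j) → p * factors bs (χ₁ value j) k) ts ≈ 0#
    vanish []       = refl
    vanish (v∈ ∷ ok) = trans
      (+-cong (trans (*-congˡ (factors-geometric bs {0} v∈ (λ _ _ → refl) k r≤k)) (zeroʳ _)) (vanish ok))
      (+-identityˡ 0#)

open import Defs
open import Data.Nat.Base using (ℕ)
open import Data.Vec.Base using (Vec)

private
  variable
    m n : ℕ

-- Formal sums as a commutative ring.

module PolynomialRing where
  open import Data.Bool.Base using (if_then_else_; true; false)
  open import Data.Integer.Base as ℤ using (ℤ; 0ℤ; 1ℤ)
  import Data.Integer.Properties as ℤ
  open import Data.Integer.Tactic.RingSolver using (solve-∀)
  open import Data.List.Base as List using (List; []; _∷_; map; filter)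
  import Data.List.Properties as List
  open import Data.List.Membership.Propositional using (_∈_)
  open import Data.List.Relation.Unary.Any using (here; there)
  open import Data.Nat.Base as ℕ using (ℕ)
  import Data.Nat.Properties as ℕ
  open import Data.Product.Base using (_,_; proj₂)
  open import Data.Vec.Base as Vec using (Vec; []; _∷_; replicate; zipWith)
  import Data.Vec.Properties as Vec
  open import Relation.Binary.Bundles using (Setoid)
  open import Relation.Binary.Structures using (IsEquivalence)
  open import Relation.Binary.PropositionalEquality
  open import Relation.Nullary using (does; yes; no; ¬?; contradiction)

  infixl 6 _+ᵥ_
  _+ᵥ_ : Vec ℕ n → Vec ℕ n → Vec ℕ n
  _+ᵥ_ = zipWith ℕ._+_

  -- The linear functional on formal sums with x^d ↦ φ d. Two formal sums are
  -- identified exactly when all these functionals agree on them, and in this form the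
  -- ring laws become statements about iterated finite sums.
  linear : (Vec ℕ n → ℤ) → Poly n → ℤ
  linear φ []            = 0ℤ
  linear φ ((c , d) ∷ p) = c ℤ.* φ d ℤ.+ linear φ p

  δ : Vec ℕ n → Vec ℕ n → ℤ
  δ e d = if does (Vec.≡-dec ℕ._≟_ d e) then 1ℤ else 0ℤ

  coeff-linear : ∀ (p : Poly n) e → coeff p e ≡ linear (δ e) p
  coeff-linear []            e = refl
  coeff-linear ((c , d) ∷ p) e with does (Vec.≡-dec ℕ._≟_ d e)
  ... | true  = cong₂ ℤ._+_ (sym (ℤ.*-identityʳ c)) (coeff-linear p e)
  ... | false = trans (coeff-linear p e)
                  (trans (sym (ℤ.+-identityˡ _)) (cong (ℤ._+ linear (δ e) p) (sym (ℤ.*-zeroʳ c))))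

  linear-cong : ∀ {φ ψ : Vec ℕ n → ℤ} → (∀ d → φ d ≡ ψ d) → ∀ p → linear φ p ≡ linear ψ p
  linear-cong φ≗ψ []            = refl
  linear-cong φ≗ψ ((c , d) ∷ p) = cong₂ (λ x y → c ℤ.* x ℤ.+ y) (φ≗ψ d) (linear-cong φ≗ψ p)

  linear-⊕ : ∀ (φ : Vec ℕ n → ℤ) p q → linear φ (p ⊕ q) ≡ linear φ p ℤ.+ linear φ q
  linear-⊕ φ []            q = sym (ℤ.+-identityˡ _)
  linear-⊕ φ ((c , d) ∷ p) q =
    trans (cong (ℤ._+_ (c ℤ.* φ d)) (linear-⊕ φ p q)) (sym (ℤ.+-assoc (c ℤ.* φ d) _ _))

  linear-⊖ : ∀ (φ : Vec ℕ n → ℤ) p → linear φ (⊖ p) ≡ ℤ.- linear φ p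
  linear-⊖ φ []            = refl
  linear-⊖ φ ((c , d) ∷ p) =
    trans (cong (ℤ._+_ (ℤ.- c ℤ.* φ d)) (linear-⊖ φ p)) (lemma c (φ d) (linear φ p))
    where
    lemma : ∀ c x y → ℤ.- c ℤ.* x ℤ.+ ℤ.- y ≡ ℤ.- (c ℤ.* x ℤ.+ y)
    lemma = solve-∀

  linear-scale : ∀ (φ : Vec ℕ n → ℤ) c d q →
    linear φ (map (λ (c′ , d′) → c ℤ.* c′ , d +ᵥ d′) q) ≡ c ℤ.* linear (λ d′ → φ (d +ᵥ d′)) q
  linear-scale φ c d []              = sym (ℤ.*-zeroʳ c)
  linear-scale φ c d ((c′ , d′) ∷ q) =
    trans (cong (ℤ._+_ (c ℤ.* c′ ℤ.* φ (d +ᵥ d′))) (linear-scale φ c d q)) (lemma c c′ _ _)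
    where
    lemma : ∀ c c′ x y → c ℤ.* c′ ℤ.* x ℤ.+ c ℤ.* y ≡ c ℤ.* (c′ ℤ.* x ℤ.+ y)
    lemma = solve-∀

  linear-⊗ : ∀ (φ : Vec ℕ n → ℤ) p q →
    linear φ (p ⊗ q) ≡ linear (λ d → linear (λ d′ → φ (d +ᵥ d′)) q) p
  linear-⊗ φ []            q = refl
  linear-⊗ φ ((c , d) ∷ p) q =
    trans (linear-⊕ φ (map _ q) (p ⊗ q)) (cong₂ ℤ._+_ (linear-scale φ c d q) (linear-⊗ φ p q))

  linear-+ : ∀ (φ ψ : Vec ℕ n → ℤ) p →
    linear (λ d → φ d ℤ.+ ψ d) p ≡ linear φ p ℤ.+ linear ψ p
  linear-+ φ ψ []            = refl
  linear-+ φ ψ ((c , d) ∷ p) =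
    trans (cong (ℤ._+_ (c ℤ.* (φ d ℤ.+ ψ d))) (linear-+ φ ψ p)) (lemma c _ _ _ _)
    where
    lemma : ∀ c x y u v → c ℤ.* (x ℤ.+ y) ℤ.+ (u ℤ.+ v) ≡ c ℤ.* x ℤ.+ u ℤ.+ (c ℤ.* y ℤ.+ v)
    lemma = solve-∀

  linear-* : ∀ c (φ : Vec ℕ n → ℤ) p → linear (λ d → c ℤ.* φ d) p ≡ c ℤ.* linear φ p
  linear-* c φ []             = sym (ℤ.*-zeroʳ c)
  linear-* c φ ((c′ , d) ∷ p) =
    trans (cong (ℤ._+_ (c′ ℤ.* (c ℤ.* φ d))) (linear-* c φ p)) (lemma c c′ _ _)
    where
    lemma : ∀ c c′ x y → c′ ℤ.* (c ℤ.* x) ℤ.+ c ℤ.* y ≡ c ℤ.* (c′ ℤ.* x ℤ.+ y)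
    lemma = solve-∀

  linear-0 : ∀ (p : Poly n) → linear (λ _ → 0ℤ) p ≡ 0ℤ
  linear-0 []            = refl
  linear-0 ((c , d) ∷ p) = cong₂ ℤ._+_ (ℤ.*-zeroʳ c) (linear-0 p)

  linear-swap : ∀ (φ : Vec ℕ n → Vec ℕ n → ℤ) p q →
    linear (λ d → linear (φ d) q) p ≡ linear (λ d′ → linear (λ d → φ d d′) p) q
  linear-swap φ []            q = sym (linear-0 q)
  linear-swap φ ((c , d) ∷ p) q =
    trans (cong₂ ℤ._+_ (sym (linear-* c (φ d) q)) (linear-swap φ p q))
          (sym (linear-+ (λ d′ → c ℤ.* φ d d′) _ q))

  remove : Vec ℕ n → Poly n → Poly n
  remove d = filter (λ t → ¬? (Vec.≡-dec ℕ._≟_ (proj₂ t) d))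

  linear-remove : ∀ (φ : Vec ℕ n → ℤ) d p →
    linear φ p ≡ coeff p d ℤ.* φ d ℤ.+ linear φ (remove d p)
  linear-remove φ d []             = refl
  linear-remove φ d ((c , d′) ∷ p) with Vec.≡-dec ℕ._≟_ d′ d
  ... | yes refl = trans (cong (ℤ._+_ (c ℤ.* φ d)) (linear-remove φ d p)) (lemma c _ _ _)
    where
    lemma : ∀ c x k y → c ℤ.* x ℤ.+ (k ℤ.* x ℤ.+ y) ≡ (c ℤ.+ k) ℤ.* x ℤ.+ y
    lemma = solve-∀
  ... | no _ = trans (cong (ℤ._+_ (c ℤ.* φ d′)) (linear-remove φ d p)) (lemma (c ℤ.* φ d′) (coeff p d ℤ.* φ d) _)
    where
    lemma : ∀ x k y → x ℤ.+ (k ℤ.+ y) ≡ k ℤ.+ (x ℤ.+ y)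
    lemma = solve-∀

  -- Induction on a list `s` of exponents that covers `p`: all terms with the same exponent are
  -- removed at once, and together they contribute a vanishing coefficient. Induction on `p` would
  -- fail, as a tail of a sum that vanishes need not vanish.
  linear-≈𝟘 : ∀ (φ : Vec ℕ n → ℤ) s p → (∀ {t} → t ∈ p → proj₂ t ∈ s) → p ≈ 𝟘 → linear φ p ≡ 0ℤ
  linear-≈𝟘 φ []      []      supp p≈𝟘 = refl
  linear-≈𝟘 φ []      (t ∷ p) supp p≈𝟘 with () ← supp (here refl)
  linear-≈𝟘 φ (d ∷ s) p       supp p≈𝟘 = begin
    linear φ p                                    ≡⟨ linear-remove φ d p ⟩
    coeff p d ℤ.* φ d ℤ.+ linear φ (remove d p)  ≡⟨ cong₂ (λ x y → x ℤ.* φ d ℤ.+ y) (p≈𝟘 d)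
                                                       (linear-≈𝟘 φ s (remove d p) supp′ removed≈𝟘) ⟩
    0ℤ                                            ∎
    where
    open ≡-Reasoning
    open import Data.List.Membership.Propositional.Properties using (∈-filter⁻)
    supp′ : ∀ {t} → t ∈ remove d p → proj₂ t ∈ s
    supp′ t∈ with ∈-filter⁻ _ {xs = p} t∈
    ... | t∈p , t≢d with supp t∈p
    ... | here t≡d  = contradiction t≡d t≢d
    ... | there t∈s = t∈s
    removed≈𝟘 : remove d p ≈ 𝟘
    removed≈𝟘 e = begin
      coeff (remove d p) e                                  ≡⟨ coeff-linear (remove d p) e ⟩
      linear (δ e) (remove d p)                             ≡⟨ ℤ.+-identityˡ _ ⟨
      0ℤ ℤ.* δ e d ℤ.+ linear (δ e) (remove d p)           ≡⟨ cong (λ x → x ℤ.* δ e d ℤ.+ linear (δ e) (remove d p)) (p≈𝟘 d) ⟨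
      coeff p d ℤ.* δ e d ℤ.+ linear (δ e) (remove d p)    ≡⟨ linear-remove (δ e) d p ⟨
      linear (δ e) p                                        ≡⟨ coeff-linear p e ⟨
      coeff p e                                             ≡⟨ p≈𝟘 e ⟩
      0ℤ                                                    ∎

  -- Unlike _≈_, which unfolds to a function type, this record lets Agda infer the two
  -- polynomials from a proof of their equality.
  infix 4 _≋_
  record _≋_ {n} (p q : Poly n) : Set where
    constructor ≋⁺
    field
      linear≡ : ∀ φ → linear φ p ≡ linear φ q

  open _≋_ public

  ≋⇒≈ : ∀ {p q : Poly n} → p ≋ q → p ≈ q
  ≋⇒≈ {p = p} {q} p≋q e = trans (coeff-linear p e) (trans (p≋q .linear≡ (δ e)) (sym (coeff-linear q e)))

  ≈⇒≋ : ∀ (p q : Poly n) → p ≈ q → p ≋ q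
  ≈⇒≋ p q p≈q .linear≡ φ = ℤ.i-j≡0⇒i≡j _ _ (begin
    linear φ p ℤ.- linear φ q          ≡⟨ cong (ℤ._+_ (linear φ p)) (linear-⊖ φ q) ⟨
    linear φ p ℤ.+ linear φ (⊖ q)     ≡⟨ linear-⊕ φ p (⊖ q) ⟨
    linear φ (p ⊕ ⊖ q)                 ≡⟨ linear-≈𝟘 φ (map proj₂ (p ⊕ ⊖ q)) (p ⊕ ⊖ q) (∈-map⁺ proj₂) diff ⟩
    0ℤ                                  ∎)
    where
    open ≡-Reasoning
    open import Data.List.Membership.Propositional.Properties using (∈-map⁺)
    diff : p ⊕ ⊖ q ≈ 𝟘
    diff e = begin
      coeff (p ⊕ ⊖ q) e                          ≡⟨ coeff-linear (p ⊕ ⊖ q) e ⟩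
      linear (δ e) (p ⊕ ⊖ q)                     ≡⟨ linear-⊕ (δ e) p (⊖ q) ⟩
      linear (δ e) p ℤ.+ linear (δ e) (⊖ q)     ≡⟨ cong₂ ℤ._+_ (sym (coeff-linear p e)) (linear-⊖ (δ e) q) ⟩
      coeff p e ℤ.- linear (δ e) q               ≡⟨ cong (λ x → coeff p e ℤ.- x) (coeff-linear q e) ⟨
      coeff p e ℤ.- coeff q e                    ≡⟨ cong (ℤ._- coeff q e) (p≈q e) ⟩
      coeff q e ℤ.- coeff q e                    ≡⟨ ℤ.+-inverseʳ (coeff q e) ⟩
      0ℤ                                          ∎

  +ᵥ-assoc : ∀ (u v w : Vec ℕ n) → u +ᵥ v +ᵥ w ≡ u +ᵥ (v +ᵥ w)
  +ᵥ-assoc = Vec.zipWith-assoc ℕ.+-assoc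

  +ᵥ-comm : ∀ (u v : Vec ℕ n) → u +ᵥ v ≡ v +ᵥ u
  +ᵥ-comm = Vec.zipWith-comm ℕ.+-comm

  +ᵥ-identityˡ : ∀ (u : Vec ℕ n) → replicate _ 0 +ᵥ u ≡ u
  +ᵥ-identityˡ = Vec.zipWith-identityˡ ℕ.+-identityˡ

  linear-𝟙 : ∀ (φ : Vec ℕ n → ℤ) → linear φ 𝟙 ≡ φ (replicate _ 0)
  linear-𝟙 φ = trans (ℤ.+-identityʳ _) (ℤ.*-identityˡ _)

  ⊗-comm : ∀ (p q : Poly n) → p ⊗ q ≋ q ⊗ p
  ⊗-comm p q = ≋⁺ λ φ → begin
    linear φ (p ⊗ q)                                    ≡⟨ linear-⊗ φ p q ⟩
    linear (λ d → linear (λ d′ → φ (d +ᵥ d′)) q) p     ≡⟨ linear-swap (λ d d′ → φ (d +ᵥ d′)) p q ⟩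
    linear (λ d′ → linear (λ d → φ (d +ᵥ d′)) p) q     ≡⟨ linear-cong (λ d′ → linear-cong (λ d → cong φ (+ᵥ-comm d d′)) p) q ⟩
    linear (λ d′ → linear (λ d → φ (d′ +ᵥ d)) p) q     ≡⟨ linear-⊗ φ q p ⟨
    linear φ (q ⊗ p)                                    ∎
    where open ≡-Reasoning

  ⊗-assoc : ∀ (p q r : Poly n) → p ⊗ q ⊗ r ≋ p ⊗ (q ⊗ r)
  ⊗-assoc p q r = ≋⁺ λ φ → begin
    linear φ (p ⊗ q ⊗ r)
      ≡⟨ linear-⊗ φ (p ⊗ q) r ⟩
    linear (λ d → linear (λ d″ → φ (d +ᵥ d″)) r) (p ⊗ q)
      ≡⟨ linear-⊗ _ p q ⟩
    linear (λ d → linear (λ d′ → linear (λ d″ → φ (d +ᵥ d′ +ᵥ d″)) r) q) p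
      ≡⟨ linear-cong (λ d → linear-cong (λ d′ → linear-cong (λ d″ → cong φ (+ᵥ-assoc d d′ d″)) r) q) p ⟩
    linear (λ d → linear (λ d′ → linear (λ d″ → φ (d +ᵥ (d′ +ᵥ d″))) r) q) p
      ≡⟨ linear-cong (λ d → linear-⊗ (λ e → φ (d +ᵥ e)) q r) p ⟨
    linear (λ d → linear (λ e → φ (d +ᵥ e)) (q ⊗ r)) p
      ≡⟨ linear-⊗ φ p (q ⊗ r) ⟨
    linear φ (p ⊗ (q ⊗ r))
      ∎
    where open ≡-Reasoning

  ⊕-cong : ∀ {p p′ q q′ : Poly n} → p ≋ p′ → q ≋ q′ → p ⊕ q ≋ p′ ⊕ q′
  ⊕-cong {p = p} {p′} {q} {q′} p≋p′ q≋q′ = ≋⁺ λ φ →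
    trans (linear-⊕ φ p q) (trans (cong₂ ℤ._+_ (linear≡ p≋p′ φ) (linear≡ q≋q′ φ)) (sym (linear-⊕ φ p′ q′)))

  ⊗-cong : ∀ {p p′ q q′ : Poly n} → p ≋ p′ → q ≋ q′ → p ⊗ q ≋ p′ ⊗ q′
  ⊗-cong {p = p} {p′} {q} {q′} p≋p′ q≋q′ = ≋⁺ λ φ → begin
    linear φ (p ⊗ q)                                     ≡⟨ linear-⊗ φ p q ⟩
    linear (λ d → linear (λ d′ → φ (d +ᵥ d′)) q) p      ≡⟨ linear-cong (λ d → linear≡ q≋q′ _) p ⟩
    linear (λ d → linear (λ d′ → φ (d +ᵥ d′)) q′) p     ≡⟨ linear≡ p≋p′ _ ⟩
    linear (λ d → linear (λ d′ → φ (d +ᵥ d′)) q′) p′    ≡⟨ linear-⊗ φ p′ q′ ⟨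
    linear φ (p′ ⊗ q′)                                   ∎
    where open ≡-Reasoning

  ⊕-comm : ∀ (p q : Poly n) → p ⊕ q ≋ q ⊕ p
  ⊕-comm p q = ≋⁺ λ φ →
    trans (linear-⊕ φ p q) (trans (ℤ.+-comm (linear φ p) _) (sym (linear-⊕ φ q p)))

  ⊖-inverseˡ : ∀ (p : Poly n) → ⊖ p ⊕ p ≋ 𝟘
  ⊖-inverseˡ p = ≋⁺ λ φ →
    trans (linear-⊕ φ (⊖ p) p) (trans (cong (ℤ._+ linear φ p) (linear-⊖ φ p)) (ℤ.+-inverseˡ (linear φ p)))

  ⊗-identityˡ : ∀ (p : Poly n) → 𝟙 ⊗ p ≋ p
  ⊗-identityˡ p = ≋⁺ λ φ →
    trans (linear-⊗ φ 𝟙 p) (trans (linear-𝟙 (λ d → linear (λ d′ → φ (d +ᵥ d′)) p)) (linear-cong (λ d → cong φ (+ᵥ-identityˡ d)) p))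

  ⊗-distribʳ : ∀ (r p q : Poly n) → (p ⊕ q) ⊗ r ≋ p ⊗ r ⊕ q ⊗ r
  ⊗-distribʳ r p q = ≋⁺ λ φ →
    trans (linear-⊗ φ (p ⊕ q) r)
      (trans (linear-⊕ _ p q)
        (trans (sym (cong₂ ℤ._+_ (linear-⊗ φ p r) (linear-⊗ φ q r))) (sym (linear-⊕ φ (p ⊗ r) (q ⊗ r)))))

  ⊕-assoc : ∀ (p q r : Poly n) → p ⊕ q ⊕ r ≋ p ⊕ (q ⊕ r)
  ⊕-assoc p q r = ≋⁺ λ φ → cong (linear φ) (List.++-assoc p q r)

  ⊖-cong : ∀ {p q : Poly n} → p ≋ q → ⊖ p ≋ ⊖ q
  ⊖-cong {p = p} {q} p≋q = ≋⁺ λ φ →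
    trans (linear-⊖ φ p) (trans (cong ℤ.-_ (linear≡ p≋q φ)) (sym (linear-⊖ φ q)))

  ≋-isEquivalence : IsEquivalence (_≋_ {n})
  ≋-isEquivalence = record
    { refl  = ≋⁺ λ φ → refl
    ; sym   = λ p≋q → ≋⁺ λ φ → sym (linear≡ p≋q φ)
    ; trans = λ p≋q q≋r → ≋⁺ λ φ → trans (linear≡ p≋q φ) (linear≡ q≋r φ)
    }

  polyRing : ℕ → CommutativeRing 0ℓ 0ℓ
  polyRing n = record
    { Carrier = Poly n ; _≈_ = _≋_ ; _+_ = _⊕_ ; _*_ = _⊗_ ; -_ = ⊖_ ; 0# = 𝟘 ; 1# = 𝟙
    ; isCommutativeRing = record
      { isRing = record
        { +-isAbelianGroup = record
          { isGroup = record
            { isMonoid = record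
              { isSemigroup = record
                { isMagma = record { isEquivalence = ≋-isEquivalence ; ∙-cong = ⊕-cong }
                ; assoc = ⊕-assoc
                }
              ; identity = comm∧idˡ⇒id ⊕-comm λ p → ≋.refl
              }
            ; inverse = comm∧invˡ⇒inv ⊕-comm ⊖-inverseˡ
            ; ⁻¹-cong = ⊖-cong
            }
          ; comm = ⊕-comm
          }
        ; *-cong = ⊗-cong
        ; *-assoc = ⊗-assoc
        ; *-identity = comm∧idˡ⇒id ⊗-comm ⊗-identityˡ
        ; distrib = comm∧distrʳ⇒distr ⊕-cong ⊗-comm ⊗-distribʳ
        }
      ; *-comm = ⊗-comm
      }
    }
    where
    module ≋ = IsEquivalence (≋-isEquivalence {n})
    ≋-setoid : Setoid 0ℓ 0ℓ
    ≋-setoid = record { isEquivalence = ≋-isEquivalence {n} }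
    open import Algebra.Consequences.Setoid ≋-setoid
      using (comm∧idˡ⇒id; comm∧invˡ⇒inv; comm∧distrʳ⇒distr)

open PolynomialRing

-- Differences of monomials of different energy are regular.

module Binomials where
  open import Data.Integer.Base as ℤ using (ℤ; 0ℤ)
  import Data.Integer.Properties as ℤ
  open import Data.List.Base using ([]; _∷_)
  open import Data.Nat.Base as ℕ using (ℕ; zero; suc; _<_)
  import Data.Nat.Properties as ℕ
  open import Data.Nat.Induction using (<-wellFounded)
  open import Data.Nat.Tactic.RingSolver renaming (solve-∀ to solveℕ-∀)
  open import Induction.WellFounded using (Acc; acc)
  open import Data.Product.Base using (_,_; ∃-syntax)
  open import Data.Vec.Base as Vec using (Vec; []; _∷_; replicate; zipWith)
  import Data.Vec.Properties as Vec
  open import Relation.Binary.PropositionalEquality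
  open import Relation.Nullary using (yes; no; contradiction; Dec)
  open import Relation.Nullary.Decidable using (map′)

  +ᵥ-cancelˡ : ∀ (u : Vec ℕ n) {v w} → u +ᵥ v ≡ u +ᵥ w → v ≡ w
  +ᵥ-cancelˡ []      {[]}     {[]}     eq = refl
  +ᵥ-cancelˡ (x ∷ u) {y ∷ v} {z ∷ w} eq =
    cong₂ _∷_ (ℕ.+-cancelˡ-≡ x y z (Vec.∷-injectiveˡ eq)) (+ᵥ-cancelˡ u (Vec.∷-injectiveʳ eq))

  divides? : ∀ (v w : Vec ℕ n) → Dec (∃[ d ] v +ᵥ d ≡ w)
  divides? v w = map′ (zipWith ℕ._∸_ w v ,_) (λ { (d , refl) → lemma v d })
                   (Vec.≡-dec ℕ._≟_ (v +ᵥ zipWith ℕ._∸_ w v) w)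
    where
    lemma : ∀ {n} (v d : Vec ℕ n) → v +ᵥ zipWith ℕ._∸_ (v +ᵥ d) v ≡ v +ᵥ d
    lemma []      []      = refl
    lemma (x ∷ v) (y ∷ d) = cong₂ _∷_ (cong (x ℕ.+_) (ℕ.m+n∸m≡n x y)) (lemma v d)

  energyFrom : ℕ → Vec ℕ n → ℕ
  energyFrom k []      = 0
  energyFrom k (x ∷ u) = k ℕ.* x ℕ.+ energyFrom (suc k) u

  -- The sum of the entries of a filling of weight u.
  energy : Vec ℕ n → ℕ
  energy = energyFrom 1

  energyFrom-+ᵥ : ∀ k (u v : Vec ℕ n) → energyFrom k (u +ᵥ v) ≡ energyFrom k u ℕ.+ energyFrom k v
  energyFrom-+ᵥ k []      []      = refl
  energyFrom-+ᵥ k (x ∷ u) (y ∷ v) =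
    trans (cong (ℕ._+_ (k ℕ.* (x ℕ.+ y))) (energyFrom-+ᵥ (suc k) u v)) (lemma k x y _ _)
    where
    lemma : ∀ k x y e f → k ℕ.* (x ℕ.+ y) ℕ.+ (e ℕ.+ f) ≡ k ℕ.* x ℕ.+ e ℕ.+ (k ℕ.* y ℕ.+ f)
    lemma = solveℕ-∀

  energyFrom-0 : ∀ k n → energyFrom k (replicate n 0) ≡ 0
  energyFrom-0 k zero    = refl
  energyFrom-0 k (suc n) = cong₂ ℕ._+_ (ℕ.*-zeroʳ k) (energyFrom-0 (suc k) n)

  δ-+ᵥ : ∀ (u e d : Vec ℕ n) → δ (u +ᵥ e) (u +ᵥ d) ≡ δ e d
  δ-+ᵥ u e d with Vec.≡-dec ℕ._≟_ d e | Vec.≡-dec ℕ._≟_ (u +ᵥ d) (u +ᵥ e)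
  ... | yes _    | yes _  = refl
  ... | yes refl | no neq = contradiction refl neq
  ... | no neq   | yes eq = contradiction (+ᵥ-cancelˡ u eq) neq
  ... | no _     | no _   = refl

  linear-x^⊗ : ∀ (φ : Vec ℕ n → ℤ) u p → linear φ (x^ u ⊗ p) ≡ linear (λ d → φ (u +ᵥ d)) p
  linear-x^⊗ φ u p = trans (linear-⊗ φ (x^ u) p) (trans (ℤ.+-identityʳ _) (ℤ.*-identityˡ _))

  -- Comparing the coefficients of u + e on both sides expresses the coefficient of e in p
  -- by one of smaller energy.
  binomial-regular : ∀ (u v : Vec ℕ n) → energy u < energy v → ∀ {p} → x^ u ⊗ p ≋ x^ v ⊗ p → p ≋ 𝟘
  binomial-regular {n} u v u<v {p} eq = ≈⇒≋ p 𝟘 λ e → trans (coeff-linear p e) (vanish e (<-wellFounded _))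
    where
    open ≡-Reasoning
    vanish : ∀ e → Acc _<_ (energy e) → linear (δ e) p ≡ 0ℤ
    vanish e (acc smaller) = trans
      (begin
        linear (δ e) p                             ≡⟨ linear-cong (δ-+ᵥ u e) p ⟨
        linear (λ d → δ (u +ᵥ e) (u +ᵥ d)) p      ≡⟨ linear-x^⊗ (δ (u +ᵥ e)) u p ⟨
        linear (δ (u +ᵥ e)) (x^ u ⊗ p)            ≡⟨ linear≡ eq (δ (u +ᵥ e)) ⟩
        linear (δ (u +ᵥ e)) (x^ v ⊗ p)            ≡⟨ linear-x^⊗ (δ (u +ᵥ e)) v p ⟩
        linear (λ d → δ (u +ᵥ e) (v +ᵥ d)) p      ∎)
      shifted
      where
      shifted : linear (λ d → δ (u +ᵥ e) (v +ᵥ d)) p ≡ 0ℤ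
      shifted with divides? v (u +ᵥ e)
      ... | yes (d , v+d≡u+e) = begin
        linear (λ d → δ (u +ᵥ e) (v +ᵥ d)) p      ≡⟨ linear-cong (λ d′ → cong (λ w → δ w (v +ᵥ d′)) (sym v+d≡u+e)) p ⟩
        linear (λ d′ → δ (v +ᵥ d) (v +ᵥ d′)) p    ≡⟨ linear-cong (δ-+ᵥ v d) p ⟩
        linear (δ d) p                             ≡⟨ vanish d (smaller d<e) ⟩
        0ℤ                                         ∎
        where
        d<e : energy d < energy e
        -- The exponent v + d = u + e has one energy, of which `v` takes a larger share than `u`.
        d<e = ℕ.+-cancelˡ-< (energy u) _ _ (ℕ.<-≤-trans
          (ℕ.+-monoˡ-< (energy d) u<v)
          (ℕ.≤-reflexive (trans (sym (energyFrom-+ᵥ 1 v d))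
            (trans (cong energy v+d≡u+e) (energyFrom-+ᵥ 1 u e)))))
      -- Here no term of x^ v ⊗ p has exponent u + e, so the coefficient is an empty sum.
      ... | no ¬divides = trans (linear-cong zeroes p) (linear-0 p)
        where
        zeroes : ∀ d → δ (u +ᵥ e) (v +ᵥ d) ≡ 0ℤ
        zeroes d with Vec.≡-dec ℕ._≟_ (v +ᵥ d) (u +ᵥ e)
        ... | yes eq′ = contradiction (d , eq′) ¬divides
        ... | no _    = refl

open Binomials

-- Products of linear factors in t, and their coefficients.

module CharacteristicPolynomials where
  open import Data.Fin.Base using (Fin; zero; suc; toℕ)
  open import Data.List.Base as List using (List; []; _∷_; map; length; _ʳ++_)
  import Data.List.Properties as List
  open import Data.Nat.Base as ℕ using (ℕ; zero; suc; _≤_; _∸_)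
  import Data.Nat.Properties as ℕ
  open import Data.Product.Base using (_,_)
  open import Data.Vec.Base using (Vec; []; _∷_; toList; lookup)
  open import Relation.Binary.PropositionalEquality as ≡ using (_≡_)

  module _ {n : ℕ} where
    open CommutativeRing (polyRing n) hiding (_≈_; zero)
    open Recurrences (polyRing n)
    open import Algebra.Properties.Ring (CommutativeRing.ring (polyRing n)) using (-1*x≈-x)
    open import Relation.Binary.Reasoning.Setoid setoid

    infix 4 _≋ₜ_
    _≋ₜ_ : Poly[t] n → Poly[t] n → Set
    p ≋ₜ q = ∀ i → coeffₜ p i ≋ coeffₜ q i

    -- The coefficients of t (p + t q) - b q, lowest degree first.
    shiftMinus : Poly n → Poly n → Poly[t] n → Poly[t] n
    shiftMinus b p []      = p ∷ []
    shiftMinus b p (x ∷ q) = p ⊕ ⊖ 𝟙 ⊗ b ⊗ x ∷ shiftMinus b x q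

    -- `monic` reverses its coefficients, and `reverse` is `_ʳ++ []`. With a general accumulator
    -- `q`, the claim is an invariant that every step of `timesLinear` preserves by computation.
    timesLinear-ʳ++ : ∀ {r} b p (cs : Vec (Poly n) r) q →
      toList (timesLinear b p cs) ʳ++ shiftMinus b p q ≡ shiftMinus b 𝟘 (toList cs ʳ++ (p ∷ q))
    timesLinear-ʳ++ b p []       q = ≡.refl
    timesLinear-ʳ++ b p (c ∷ cs) q = timesLinear-ʳ++ b c cs (p ∷ q)

    coeffₜ-⊕ₜ : ∀ p q i → coeffₜ (p ⊕ₜ q) i ≋ coeffₜ p i ⊕ coeffₜ q i
    coeffₜ-⊕ₜ []      q       i       = refl
    coeffₜ-⊕ₜ (a ∷ p) []      i       = sym (+-identityʳ _)
    coeffₜ-⊕ₜ (a ∷ p) (b ∷ q) zero    = refl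
    coeffₜ-⊕ₜ (a ∷ p) (b ∷ q) (suc i) = coeffₜ-⊕ₜ p q i

    coeffₜ-⊗ : ∀ a q i → coeffₜ (map (a ⊗_) q) i ≋ a ⊗ coeffₜ q i
    coeffₜ-⊗ a []      i       = sym (zeroʳ a)
    coeffₜ-⊗ a (b ∷ q) zero    = refl
    coeffₜ-⊗ a (b ∷ q) (suc i) = coeffₜ-⊗ a q i

    coeffₜ-shift : ∀ q i → coeffₜ (map (𝟙 ⊗_) q ⊕ₜ (𝟘 ∷ [])) i ≋ coeffₜ q i
    coeffₜ-shift q i = trans (coeffₜ-⊕ₜ (map (𝟙 ⊗_) q) (𝟘 ∷ []) i)
      (trans (+-cong (trans (coeffₜ-⊗ 𝟙 q i) (*-identityˡ _)) (zeroes i)) (+-identityʳ _))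
      where
      zeroes : ∀ i → coeffₜ (𝟘 ∷ []) i ≋ 𝟘
      zeroes zero    = refl
      zeroes (suc i) = refl

    shiftMinus-cong : ∀ b (q q′ : Poly[t] n) → q ≋ₜ q′ → (t- b) ⊗ₜ q ≋ₜ shiftMinus b 𝟘 q′
    shiftMinus-cong b q q′ q≋q′ i = trans
      (trans (coeffₜ-⊕ₜ (map (⊖ b ⊗_) q) _ i) (+-congʳ (coeffₜ-⊗ (⊖ b) q i)))
      (lemma i)
      where
      coeffₜ-shiftMinus-suc : ∀ p q i →
        coeffₜ (shiftMinus b p q) (suc i) ≋ ⊖ b ⊗ coeffₜ q (suc i) ⊕ coeffₜ q i
      coeffₜ-shiftMinus-suc p []          i       = sym (trans (+-identityʳ _) (zeroʳ (⊖ b)))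
      coeffₜ-shiftMinus-suc p (x ∷ [])    zero    = sym (trans (+-congʳ (zeroʳ (⊖ b))) (+-identityˡ x))
      coeffₜ-shiftMinus-suc p (x ∷ y ∷ q) zero    =
        trans (+-comm x _) (+-congʳ (*-congʳ (-1*x≈-x b)))
      coeffₜ-shiftMinus-suc p (x ∷ q)     (suc i) = coeffₜ-shiftMinus-suc x q i
      coeffₜ-shiftMinus-zero : ∀ q → coeffₜ (shiftMinus b 𝟘 q) zero ≋ ⊖ b ⊗ coeffₜ q zero
      coeffₜ-shiftMinus-zero []      = sym (zeroʳ (⊖ b))
      coeffₜ-shiftMinus-zero (x ∷ q) = *-congʳ (-1*x≈-x b)
      lemma : ∀ i → ⊖ b ⊗ coeffₜ q i ⊕ coeffₜ (𝟘 ∷ (map (𝟙 ⊗_) q ⊕ₜ (𝟘 ∷ []))) i ≋ coeffₜ (shiftMinus b 𝟘 q′) i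
      lemma zero    = trans (+-identityʳ _)
        (trans (*-congˡ {x = ⊖ b} (q≋q′ zero)) (sym (coeffₜ-shiftMinus-zero q′)))
      lemma (suc i) = trans (+-cong (*-congˡ {x = ⊖ b} (q≋q′ (suc i))) (trans (coeffₜ-shift q i) (q≋q′ i)))
        (sym (coeffₜ-shiftMinus-suc 𝟘 q′ i))

    ∏ₜ-linear : ∀ bs → ∏ₜ (map t-_ bs) ≋ₜ monic (productCoefficients bs)
    ∏ₜ-linear []       i = refl
    ∏ₜ-linear (b ∷ bs) i = trans (shiftMinus-cong b (∏ₜ (map t-_ bs)) (monic (productCoefficients bs)) (∏ₜ-linear bs) i)
      (reflexive (≡.cong (λ q → coeffₜ q i) (≡.sym (timesLinear-ʳ++ b 𝟙 (productCoefficients bs) []))))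

    ∑-lowerTerms : ∀ {r} (c : Vec (Poly n) r) a k →
      ∑ (List.tabulate λ (i : Fin r) → lookup c i ⊗ a (k ∸ suc (toℕ i))) ≡ lowerTerms c a k
    ∑-lowerTerms []       a k = ≡.refl
    ∑-lowerTerms (c ∷ cs) a k = ≡.cong (c ⊗ a (k ∸ 1) ⊕_) (≡.trans
      (≡.cong ∑ (List.tabulate-cong λ i →
        ≡.cong (λ j → lookup cs i ⊗ a j) (≡.sym (ℕ.∸-+-assoc k 1 (suc (toℕ i))))))
      (∑-lowerTerms cs a (k ∸ 1)))

    satisfiesLinearRecurrence : ∀ {k₀ a} bs → (∀ k → k₀ ℕ.+ length bs ≤ k → factors bs a k ≋ 𝟘) →
      SatisfiesLinearRecurrence k₀ a (∏ₜ (map t-_ bs))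
    satisfiesLinearRecurrence {a = a} bs vanish =
      length bs , productCoefficients bs , (λ i → ≋⇒≈ (∏ₜ-linear bs i)) , λ k r≤k →
        ≋⇒≈ (trans
          (+-congˡ (reflexive (∑-lowerTerms (productCoefficients bs) a k)))
          (trans (factors-expand bs a k) (vanish k r≤k)))

open CharacteristicPolynomials

-- Columns: adjacency, domination and greedy rearrangement.

module Columns where
  open import Data.Nat.Base
  open import Data.Nat.Properties
  open import Data.Product.Base using (_×_; _,_; ∃-syntax)
  open import Data.Sum.Base using (_⊎_; inj₁; inj₂)
  open import Data.Bool.Base using (if_then_else_)
  open import Data.Nat.Tactic.RingSolver renaming (solve-∀ to solveℕ-∀)
  open import Function.Base using (_∘_; case_of_)
  open import Relation.Binary.PropositionalEquality
  open import Relation.Binary.Definitions using (tri<; tri≈; tri>)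
  open import Relation.Nullary.Decidable using (_→-dec_; dec-true; dec-false)
  open import Relation.Nullary using (Dec; does; yes; no; ¬_; contradiction)

  [_]ᵢ : {P : Set} → Dec P → ℕ
  [ P? ]ᵢ = if does P? then 1 else 0

  indicator-yes : {P : Set} (P? : Dec P) → P → [ P? ]ᵢ ≡ 1
  indicator-yes (yes _) p = refl
  indicator-yes (no ¬p) p = contradiction p ¬p

  indicator-no : {P : Set} (P? : Dec P) → ¬ P → [ P? ]ᵢ ≡ 0
  indicator-no (yes p) ¬p = contradiction p ¬p
  indicator-no (no _)  ¬p = refl

  indicator-mono : {P Q : Set} (P? : Dec P) (Q? : Dec Q) → (P → Q) → [ P? ]ᵢ ≤ [ Q? ]ᵢ
  indicator-mono (no _)  Q? P→Q = z≤n
  indicator-mono (yes p) Q? P→Q = ≤-reflexive (sym (indicator-yes Q? (P→Q p)))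

  indicator≤1 : {P : Set} (P? : Dec P) → [ P? ]ᵢ ≤ 1
  indicator≤1 (yes _) = ≤-refl
  indicator≤1 (no _)  = z≤n

  sumTo : ℕ → (ℕ → ℕ) → ℕ
  sumTo zero    f = 0
  sumTo (suc h) f = f h + sumTo h f

  sumTo-cong : ∀ h {f g : ℕ → ℕ} → (∀ {i} → i < h → f i ≡ g i) → sumTo h f ≡ sumTo h g
  sumTo-cong zero    eq = refl
  sumTo-cong (suc h) eq = cong₂ _+_ (eq ≤-refl) (sumTo-cong h (eq ∘ m<n⇒m<1+n))

  sumTo-mono : ∀ h {f g : ℕ → ℕ} → (∀ {i} → i < h → f i ≤ g i) → sumTo h f ≤ sumTo h g
  sumTo-mono zero    le = z≤n
  sumTo-mono (suc h) le = +-mono-≤ (le ≤-refl) (sumTo-mono h (le ∘ m<n⇒m<1+n))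

  sumTo-head : ∀ h (f : ℕ → ℕ) → sumTo (suc h) f ≡ f 0 + sumTo h (f ∘ suc)
  sumTo-head zero    f = refl
  sumTo-head (suc h) f = trans (cong (f (suc h) +_) (sumTo-head h f)) (swap (f (suc h)) (f 0) _)
    where
    swap : ∀ x y z → x + (y + z) ≡ y + (x + z)
    swap = solveℕ-∀

  sumTo-rigid : ∀ h {f g : ℕ → ℕ} → (∀ {i} → i < h → f i ≤ g i) → sumTo h g ≤ sumTo h f →
                ∀ {i} → i < h → f i ≡ g i
  sumTo-rigid (suc h) {f} {g} le sum≤ {i} i<1+h with i ≟ h
  ... | yes refl = ≤-antisym (le ≤-refl)
    (+-cancelʳ-≤ (sumTo h f) _ _ (≤-trans (+-monoʳ-≤ (g h) (sumTo-mono h (le ∘ m<n⇒m<1+n))) sum≤))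
  ... | no i≢h = sumTo-rigid h (le ∘ m<n⇒m<1+n)
    (+-cancelˡ-≤ (f h) _ _ (≤-trans (+-monoˡ-≤ _ (le ≤-refl)) sum≤))
    (≤∧≢⇒< (s≤s⁻¹ i<1+h) i≢h)

  update : (ℕ → ℕ) → ℕ → ℕ → ℕ → ℕ
  update s q x i = if does (i ≟ q) then x else s i

  update-≡ : ∀ s {q} x {i} → i ≡ q → update s q x i ≡ x
  update-≡ s {q} x {i} i≡q = cong (λ b → if b then x else s i) (dec-true (i ≟ q) i≡q)

  update-≢ : ∀ s {q} x {i} → i ≢ q → update s q x i ≡ s i
  update-≢ s {q} x {i} i≢q = cong (λ b → if b then x else s i) (dec-false (i ≟ q) i≢q)

  sumTo-update : ∀ h (F : ℕ → ℕ) s {q} x → q < h →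
                 sumTo h (F ∘ update s q x) + F (s q) ≡ sumTo h (F ∘ s) + F x
  sumTo-update (suc h) F s {q} x q<1+h with h ≟ q
  ... | yes refl = trans
    (cong₂ (λ t u → F t + u + F (s q)) (update-≡ s x {q} refl) (sumTo-cong h λ i<h → cong F (update-≢ s x (<⇒≢ i<h))))
    (lemma (F x) _ (F (s q)))
    where
    lemma : ∀ x y z → x + y + z ≡ z + y + x
    lemma = solveℕ-∀
  ... | no h≢q = trans
    (cong (λ t → F t + sumTo h (F ∘ update s q x) + F (s q)) (update-≢ s x h≢q))
    (trans (+-assoc (F (s h)) _ _) (trans (cong (F (s h) +_) (sumTo-update h F s x (≤∧≢⇒< (s≤s⁻¹ q<1+h) (h≢q ∘ sym))))
      (sym (+-assoc (F (s h)) _ _))))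

  -- These counts replace sorting: sorted columns compare entrywise exactly when the counts compare
  -- at all thresholds `v`, and equal counts at all thresholds mean equal multisets of entries.
  atLeast : ℕ → ℕ → (ℕ → ℕ) → ℕ
  atLeast h v a = sumTo h λ i → [ v ≤? a i ]ᵢ

  atLeast-antitone : ∀ h {v u} a → v ≤ u → atLeast h u a ≤ atLeast h v a
  atLeast-antitone h a v≤u = sumTo-mono h λ {i} _ → indicator-mono (_ ≤? a i) (_ ≤? a i) (≤-trans v≤u)

  -- The difference of the counts at `v` and `u` is the number of entries in [v, u), which can only
  -- grow from the first `p` rows to the first `h`. The terms are arranged so that no subtraction
  -- occurs.
  atLeast-interval : ∀ {p h v u} c → p ≤ h → v ≤ u →
    atLeast p v c + atLeast h u c ≤ atLeast h v c + atLeast p u c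
  atLeast-interval {p} {h} {v} {u} c p≤h v≤u = go (≤⇒≤′ p≤h)
    where
    swap : ∀ x y z → x + (y + z) ≡ y + (x + z)
    swap = solveℕ-∀
    go : ∀ {h} → p ≤′ h → atLeast p v c + atLeast h u c ≤ atLeast h v c + atLeast p u c
    go ≤′-refl            = ≤-refl
    go (≤′-step {h} p≤′h) = begin
      atLeast p v c + ([ u ≤? c h ]ᵢ + atLeast h u c)  ≡⟨ swap (atLeast p v c) [ u ≤? c h ]ᵢ _ ⟩
      [ u ≤? c h ]ᵢ + (atLeast p v c + atLeast h u c)  ≤⟨ +-mono-≤ (indicator-mono (u ≤? c h) (v ≤? c h) (≤-trans v≤u)) (go p≤′h) ⟩
      [ v ≤? c h ]ᵢ + (atLeast h v c + atLeast p u c)  ≡⟨ +-assoc [ v ≤? c h ]ᵢ _ _ ⟨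
      [ v ≤? c h ]ᵢ + atLeast h v c + atLeast p u c    ∎
      where open ≤-Reasoning

  -- Again a comparison of numbers of entries in an interval: the rows from `p` on contribute
  -- nothing to [v, w).
  atLeast-gap : ∀ {p h v w} c → p ≤ h → v ≤ w → (∀ {i} → p ≤ i → i < h → c i < v ⊎ w ≤ c i) →
    atLeast h v c + atLeast p w c ≡ atLeast p v c + atLeast h w c
  atLeast-gap {p} {h} {v} {w} c p≤h v≤w gap = go (≤⇒≤′ p≤h) gap
    where
    swap : ∀ x y z → x + (y + z) ≡ y + (x + z)
    swap = solveℕ-∀
    go : ∀ {h} → p ≤′ h → (∀ {i} → p ≤ i → i < h → c i < v ⊎ w ≤ c i) →
         atLeast h v c + atLeast p w c ≡ atLeast p v c + atLeast h w c
    go ≤′-refl            gap = refl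
    go (≤′-step {h} p≤′h) gap = begin
      [ v ≤? c h ]ᵢ + atLeast h v c + atLeast p w c    ≡⟨ +-assoc [ v ≤? c h ]ᵢ _ _ ⟩
      [ v ≤? c h ]ᵢ + (atLeast h v c + atLeast p w c)  ≡⟨ cong₂ _+_ same (go p≤′h λ p≤i → gap p≤i ∘ m<n⇒m<1+n) ⟩
      [ w ≤? c h ]ᵢ + (atLeast p v c + atLeast h w c)  ≡⟨ swap [ w ≤? c h ]ᵢ (atLeast p v c) _ ⟩
      atLeast p v c + ([ w ≤? c h ]ᵢ + atLeast h w c)  ∎
      where
      open ≡-Reasoning
      same : [ v ≤? c h ]ᵢ ≡ [ w ≤? c h ]ᵢ
      same with gap (≤′⇒≤ p≤′h) ≤-refl
      ... | inj₁ c<v = trans (indicator-no (v ≤? c h) (<⇒≱ c<v))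
                         (sym (indicator-no (w ≤? c h) (<⇒≱ (<-≤-trans c<v v≤w))))
      ... | inj₂ w≤c = trans (indicator-yes (v ≤? c h) (≤-trans v≤w w≤c)) (sym (indicator-yes (w ≤? c h) w≤c))

  -- For every p ≤ h, the first p entries of c, sorted, are entrywise at most the first p
  -- entries of a, sorted. In contrast to IsNext below, this relation is transitive.
  Dominates : ℕ → (ℕ → ℕ) → (ℕ → ℕ) → Set
  Dominates h a c = ∀ {p} → p ≤ h → ∀ v → atLeast p v c ≤ atLeast p v a

  -- The column b can stand to the right of the column a, both read in the rows i < h.
  record IsNext (h : ℕ) (a b : ℕ → ℕ) : Set where
    constructor isNext
    field
      positive : ∀ {i} → i < h → 1 ≤ b i
      below    : ∀ {i} → i < h → b i ≤ a i
      noTriple : ∀ {i′} → i′ < h → ∀ {i} → i < i′ → b i′ ≤ a i → b i′ < b i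

  open IsNext public

  isNext? : ∀ h a b → Dec (IsNext h a b)
  isNext? h a b with positive? | below? | noTriple?
    where
    positive? : Dec (∀ {i} → i < h → 1 ≤ b i)
    positive? = allUpTo? (λ i → 1 ≤? b i) h
    below? : Dec (∀ {i} → i < h → b i ≤ a i)
    below? = allUpTo? (λ i → b i ≤? a i) h
    noTriple? : Dec (∀ {i′} → i′ < h → ∀ {i} → i < i′ → b i′ ≤ a i → b i′ < b i)
    noTriple? = allUpTo? (λ i′ → allUpTo? (λ i → b i′ ≤? a i →-dec b i′ <? b i) i′) h
  ... | yes p | yes q | yes r = yes (isNext p q r)
  ... | no ¬p | _     | _     = no λ next → ¬p (positive next)
  ... | _     | no ¬q | _     = no λ next → ¬q (below next)
  ... | _     | _     | no ¬r = no λ next → ¬r (noTriple next)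

  Distinct : ℕ → (ℕ → ℕ) → Set
  Distinct h a = ∀ {i j} → i < h → j < h → a i ≡ a j → i ≡ j

  record IsColumn (n h : ℕ) (a : ℕ → ℕ) : Set where
    constructor isColumn
    field
      entry≥1  : ∀ {i} → i < h → 1 ≤ a i
      entry≤n  : ∀ {i} → i < h → a i ≤ n
      distinct : Distinct h a

  open IsColumn public

  isNext⇒dominates : ∀ {h a b} → IsNext h a b → Dominates h a b
  isNext⇒dominates {a = a} {b} next p≤h v = sumTo-mono _ λ {i} i<p →
    indicator-mono (v ≤? b i) (v ≤? a i) λ v≤b → ≤-trans v≤b (below next (<-≤-trans i<p p≤h))

  -- Distinctness comes from the triples: if b i = b j with i < j, then b j ≤ a i by `below`, so
  -- `noTriple` yields b j < b i.
  isNext⇒isColumn : ∀ {n h a b} → IsColumn n h a → IsNext h a b → IsColumn n h b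
  isNext⇒isColumn {h = h} {a} {b} column next = isColumn (positive next)
    (λ i<h → ≤-trans (below next i<h) (entry≤n column i<h)) distinct′
    where
    not-equal : ∀ {i j} → i < j → j < h → b i ≢ b j
    not-equal i<j j<h eq = <-irrefl (sym eq)
      (noTriple next j<h i<j (≤-trans (≤-reflexive (sym eq)) (below next (<-trans i<j j<h))))
    distinct′ : Distinct h b
    distinct′ {i} {j} i<h j<h eq with <-cmp i j
    ... | tri< i<j _ _ = contradiction eq (not-equal i<j j<h)
    ... | tri≈ _ i≡j _ = i≡j
    ... | tri> _ _ j<i = contradiction (sym eq) (not-equal j<i i<h)

  isNext-refl : ∀ {n h a} → IsColumn n h a → IsNext h a a
  isNext-refl column = isNext (entry≥1 column) (λ _ → ≤-refl)
    λ i′<h i<i′ a≤a → ≤∧≢⇒< a≤a λ eq → <⇒≢ i<i′ (sym (distinct column i′<h (<-trans i<i′ i′<h) eq))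

  dominates-refl : ∀ {h a} → Dominates h a a
  dominates-refl _ _ = ≤-refl

  dominates-trans : ∀ {h a b c} → Dominates h a b → Dominates h b c → Dominates h a c
  dominates-trans a⊵b b⊵c p≤h v = ≤-trans (b⊵c p≤h v) (a⊵b p≤h v)

  dominates-≤ : ∀ {h h′ a b} → h′ ≤ h → Dominates h a b → Dominates h′ a b
  dominates-≤ h′≤h a⊵b p≤h′ = a⊵b (≤-trans p≤h′ h′≤h)

  isColumn-≤ : ∀ {n h h′ a} → h′ ≤ h → IsColumn n h a → IsColumn n h′ a
  isColumn-≤ h′≤h (isColumn e≥1 e≤n dist) =
    isColumn (λ i< → e≥1 (<-≤-trans i< h′≤h)) (λ i< → e≤n (<-≤-trans i< h′≤h))
      λ i< j< → dist (<-≤-trans i< h′≤h) (<-≤-trans j< h′≤h)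

  largest≤ : ∀ h (s : ℕ → ℕ) x → (∀ {i} → i < h → x < s i) ⊎
    ∃[ q ] q < h × s q ≤ x × (∀ {i} → i < h → s i ≤ x → s i ≤ s q)
  largest≤ zero    s x = inj₁ λ ()
  largest≤ (suc h) s x with largest≤ h s x | s h ≤? x
  ... | inj₁ above | no s≰x = inj₁ λ {i} i<1+h → case m<1+n⇒m<n∨m≡n i<1+h of λ where
    (inj₁ i<h)  → above i<h
    (inj₂ refl) → ≰⇒> s≰x
  ... | inj₁ above | yes s≤x = inj₂ (h , ≤-refl , s≤x , λ i<1+h si≤x → case m<1+n⇒m<n∨m≡n i<1+h of λ where
    (inj₁ i<h)  → contradiction si≤x (<⇒≱ (above i<h))
    (inj₂ refl) → ≤-refl)
  ... | inj₂ (q , q<h , sq≤x , max) | no s≰x = inj₂ (q , m<n⇒m<1+n q<h , sq≤x , λ i<1+h si≤x →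
    case m<1+n⇒m<n∨m≡n i<1+h of λ where
      (inj₁ i<h)  → max i<h si≤x
      (inj₂ refl) → contradiction si≤x s≰x)
  ... | inj₂ (q , q<h , sq≤x , max) | yes s≤x with s h ≤? s q
  ... | yes sh≤sq = inj₂ (q , m<n⇒m<1+n q<h , sq≤x , λ i<1+h si≤x →
    case m<1+n⇒m<n∨m≡n i<1+h of λ where
      (inj₁ i<h)  → max i<h si≤x
      (inj₂ refl) → sh≤sq)
  ... | no sh≰sq = inj₂ (h , ≤-refl , s≤x , λ i<1+h si≤x →
    case m<1+n⇒m<n∨m≡n i<1+h of λ where
      (inj₁ i<h)  → ≤-trans (max i<h si≤x) (≰⇒≥ sh≰sq)
      (inj₂ refl) → ≤-refl)

  -- The rearrangement of s in which every row, from top to bottom, receives the largest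
  -- remaining entry that is at most the entry of a in this row.
  record Greedy (h : ℕ) (a s : ℕ → ℕ) : Set where
    field
      arranged : ℕ → ℕ
      below    : ∀ {i} → i < h → arranged i ≤ a i
      noTriple : ∀ {i′} → i′ < h → ∀ {i} → i < i′ → arranged i′ ≤ a i → arranged i′ < arranged i
      content  : ∀ v → atLeast h v arranged ≡ atLeast h v s
      from     : ∀ {i} → i < h → ∃[ j ] j < h × arranged i ≡ s j

  -- The inequality of counts is a Hall condition. It provides an entry at most a 0 for row 0, and
  -- it is inherited by the remaining rows because the largest such entry is taken. A later entry
  -- that is at most a 0 was also available for row 0, hence is smaller than the one chosen there;
  -- this gives `noTriple`.
  greedy : ∀ h a s → Distinct h s → (∀ v → atLeast h v s ≤ atLeast h v a) → Greedy h a s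
  greedy zero a s dist s≤a = record
    { arranged = s ; below = λ () ; noTriple = λ () ; content = λ v → refl ; from = λ () }
  greedy (suc h) a s dist s≤a with largest≤ (suc h) s (a 0)
  ... | inj₁ above = contradiction impossible 1+n≰n
    where
    open ≤-Reasoning
    count : ∀ h → sumTo h (λ _ → 1) ≡ h
    count zero    = refl
    count (suc h) = cong suc (count h)
    impossible : suc h ≤ h
    -- All `suc h` entries of `s` would exceed a 0, but at most `h` entries of `a` do, since a 0
    -- itself does not.
    impossible = begin
      suc h                                                    ≡⟨ count (suc h) ⟨
      sumTo (suc h) (λ _ → 1)                                  ≡⟨ sumTo-cong (suc h) (λ {i} i< → indicator-yes (suc (a 0) ≤? s i) (above i<)) ⟨
      atLeast (suc h) (suc (a 0)) s                            ≤⟨ s≤a (suc (a 0)) ⟩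
      atLeast (suc h) (suc (a 0)) a                            ≡⟨ sumTo-head h _ ⟩
      [ suc (a 0) ≤? a 0 ]ᵢ + atLeast h (suc (a 0)) (a ∘ suc)  ≡⟨ cong (_+ atLeast h (suc (a 0)) (a ∘ suc)) (indicator-no (suc (a 0) ≤? a 0) 1+n≰n) ⟩
      atLeast h (suc (a 0)) (a ∘ suc)                          ≤⟨ sumTo-mono h (λ {i} _ → indicator≤1 (suc (a 0) ≤? a (suc i))) ⟩
      sumTo h (λ _ → 1)                                        ≡⟨ count h ⟩
      h                                                        ∎
  ... | inj₂ (q , q<1+h , sq≤a₀ , max) = record
    { arranged = arranged
    ; below    = λ { {zero} _ → sq≤a₀ ; {suc i} (s≤s i<h) → rest.below i<h }
    ; noTriple = no-triple
    ; content  = λ v → trans (sumTo-head h _) (trans (cong ([ v ≤? s q ]ᵢ +_) (rest.content v)) (sym (split v)))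
    ; from     = λ { {zero} _ → q , q<1+h , refl ; {suc i} (s≤s i<h) → rest-from i<h }
    }
    where
    -- The entry at `q` is deleted by overwriting it with entry 0 and then dropping position 0.
    s′ : ℕ → ℕ
    s′ i = update s q (s 0) (suc i)
    s′-cases : ∀ {i} → i < h → (suc i ≡ q × s′ i ≡ s 0) ⊎ (suc i ≢ q × s′ i ≡ s (suc i))
    s′-cases {i} _ with suc i ≟ q
    ... | yes eq = inj₁ (eq , update-≡ s (s 0) eq)
    ... | no neq = inj₂ (neq , update-≢ s (s 0) neq)
    update-0 : update s q (s 0) 0 ≡ s 0
    update-0 with 0 ≟ q
    ... | yes eq = update-≡ s (s 0) eq
    ... | no neq = update-≢ s (s 0) neq
    split : ∀ v → atLeast (suc h) v s ≡ [ v ≤? s q ]ᵢ + atLeast h v s′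
    split v = +-cancelʳ-≡ (F (s 0)) _ _ (begin
      atLeast (suc h) v s + F (s 0)                            ≡⟨ sumTo-update (suc h) F s (s 0) q<1+h ⟨
      sumTo (suc h) (F ∘ update s q (s 0)) + F (s q)           ≡⟨ cong (_+ F (s q)) (sumTo-head h (F ∘ update s q (s 0))) ⟩
      F (update s q (s 0) 0) + atLeast h v s′ + F (s q)        ≡⟨ cong (λ x → F x + atLeast h v s′ + F (s q)) update-0 ⟩
      F (s 0) + atLeast h v s′ + F (s q)                       ≡⟨ lemma (F (s 0)) _ (F (s q)) ⟩
      F (s q) + atLeast h v s′ + F (s 0)                       ∎)
      where
      open ≡-Reasoning
      F : ℕ → ℕ
      F x = [ v ≤? x ]ᵢ
      lemma : ∀ x y z → x + y + z ≡ z + y + x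
      lemma = solveℕ-∀
    dist′ : Distinct h s′
    dist′ {i} {j} i<h j<h eq with s′-cases i<h | s′-cases j<h
    ... | inj₁ (i≡q , _)  | inj₁ (j≡q , _)  = suc-injective (trans i≡q (sym j≡q))
    ... | inj₁ (_ , eqᵢ)  | inj₂ (_ , eqⱼ)  with () ← dist z<s (s≤s j<h) (trans (sym eqᵢ) (trans eq eqⱼ))
    ... | inj₂ (_ , eqᵢ)  | inj₁ (_ , eqⱼ)  with () ← dist (s≤s i<h) z<s (trans (sym eqᵢ) (trans eq eqⱼ))
    ... | inj₂ (_ , eqᵢ)  | inj₂ (_ , eqⱼ)  =
      suc-injective (dist (s≤s i<h) (s≤s j<h) (trans (sym eqᵢ) (trans eq eqⱼ)))
    s′≢sq : ∀ {i} → i < h → s′ i ≢ s q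
    s′≢sq i<h eq with s′-cases i<h
    ... | inj₁ (i≡q , eqᵢ) with () ← trans (dist z<s q<1+h (trans (sym eqᵢ) eq)) (sym i≡q)
    ... | inj₂ (i≢q , eqᵢ) = i≢q (dist (s≤s i<h) q<1+h (trans (sym eqᵢ) eq))
    s′-from : ∀ {i} → i < h → ∃[ j ] j < suc h × s′ i ≡ s j
    s′-from i<h with s′-cases i<h
    ... | inj₁ (_ , eqᵢ) = 0 , z<s , eqᵢ
    ... | inj₂ (_ , eqᵢ) = _ , s≤s i<h , eqᵢ
    s′≤a′ : ∀ v → atLeast h v s′ ≤ atLeast h v (a ∘ suc)
    s′≤a′ v with v ≤? s q | v ≤? a 0
    ... | yes v≤sq | _ = +-cancelˡ-≤ 1 _ _ (begin
      1 + atLeast h v s′                       ≡⟨ cong (_+ atLeast h v s′) (indicator-yes (v ≤? s q) v≤sq) ⟨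
      [ v ≤? s q ]ᵢ + atLeast h v s′           ≡⟨ split v ⟨
      atLeast (suc h) v s                      ≤⟨ s≤a v ⟩
      atLeast (suc h) v a                      ≡⟨ sumTo-head h _ ⟩
      [ v ≤? a 0 ]ᵢ + atLeast h v (a ∘ suc)    ≤⟨ +-monoˡ-≤ _ (indicator≤1 (v ≤? a 0)) ⟩
      1 + atLeast h v (a ∘ suc)                ∎)
      where open ≤-Reasoning
    ... | no v≰sq | no v≰a₀ = begin
      atLeast h v s′                           ≡⟨ cong (_+ atLeast h v s′) (indicator-no (v ≤? s q) v≰sq) ⟨
      [ v ≤? s q ]ᵢ + atLeast h v s′           ≡⟨ split v ⟨
      atLeast (suc h) v s                      ≤⟨ s≤a v ⟩
      atLeast (suc h) v a                      ≡⟨ sumTo-head h _ ⟩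
      [ v ≤? a 0 ]ᵢ + atLeast h v (a ∘ suc)    ≡⟨ cong (_+ atLeast h v (a ∘ suc)) (indicator-no (v ≤? a 0) v≰a₀) ⟩
      atLeast h v (a ∘ suc)                    ∎
      where open ≤-Reasoning
    -- The critical case: `a` loses a counted entry and `s` does not. By maximality of s q, the
    -- entries of `s` that are at least `v` exceed a 0, so the threshold can be raised to suc (a 0),
    -- where a 0 does not count.
    ... | no v≰sq | yes v≤a₀ = begin
      atLeast h v s′                                           ≡⟨ cong (_+ atLeast h v s′) (indicator-no (v ≤? s q) v≰sq) ⟨
      [ v ≤? s q ]ᵢ + atLeast h v s′                           ≡⟨ split v ⟨
      atLeast (suc h) v s                                      ≤⟨ sumTo-mono (suc h) (λ {i} i< → indicator-mono (v ≤? s i) (suc (a 0) ≤? s i) λ v≤si →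
                                                                    ≰⇒> λ si≤a₀ → v≰sq (≤-trans v≤si (max i< si≤a₀))) ⟩
      atLeast (suc h) (suc (a 0)) s                            ≤⟨ s≤a (suc (a 0)) ⟩
      atLeast (suc h) (suc (a 0)) a                            ≡⟨ sumTo-head h _ ⟩
      [ suc (a 0) ≤? a 0 ]ᵢ + atLeast h (suc (a 0)) (a ∘ suc)  ≡⟨ cong (_+ atLeast h (suc (a 0)) (a ∘ suc)) (indicator-no (suc (a 0) ≤? a 0) 1+n≰n) ⟩
      atLeast h (suc (a 0)) (a ∘ suc)                          ≤⟨ atLeast-antitone h (a ∘ suc) (m≤n⇒m≤1+n v≤a₀) ⟩
      atLeast h v (a ∘ suc)                                    ∎
      where open ≤-Reasoning
    module rest = Greedy (greedy h (a ∘ suc) s′ dist′ s′≤a′)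
    rest-from : ∀ {i} → i < h → ∃[ j ] j < suc h × rest.arranged i ≡ s j
    rest-from i<h =
      let j , j<h , eq = rest.from i<h ; k , k<1+h , eq′ = s′-from j<h in k , k<1+h , trans eq eq′
    first : ∀ {i} → i < h → rest.arranged i ≤ a 0 → rest.arranged i < s q
    first i<h c≤a₀ with rest.from i<h | rest-from i<h
    ... | j , j<h , eq | k , k<1+h , eq′ = ≤∧≢⇒<
      (≤-trans (≤-reflexive eq′) (max k<1+h (≤-trans (≤-reflexive (sym eq′)) c≤a₀)))
      λ c≡sq → s′≢sq j<h (trans (sym eq) c≡sq)
    arranged : ℕ → ℕ
    arranged zero    = s q
    arranged (suc i) = rest.arranged i
    no-triple : ∀ {i′} → i′ < suc h → ∀ {i} → i < i′ → arranged i′ ≤ a i → arranged i′ < arranged i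
    no-triple (s≤s i′<h) {zero}  (s≤s _)    c≤a₀ = first i′<h c≤a₀
    no-triple (s≤s i′<h) {suc i} (s≤s i<i′) c≤a  = rest.noTriple i′<h i<i′ c≤a

  -- For a suitable `u` at least `v`, the first `p` rows of `c′` have so many entries at least `v`
  -- that they cover all entries of `c` in [v, u) plus one for each of the first `p` entries of `a`
  -- that is at least `u`. The first `p` entries of `c` that are at least `v` cannot be more: those
  -- in [v, u) are among all such entries of `c`, and those at least `u` are bounded by domination.
  greedy-maximal : ∀ {h a c c′} → Dominates h a c → IsNext h a c′ →
                   (∀ v → atLeast h v c′ ≡ atLeast h v c) → Dominates h c′ c
  greedy-maximal {h} {a} {c} {c′} a⊵c next content {p} p≤h v =
    let u , v≤u , bound = saturated p p≤h v in
    +-cancelʳ-≤ (atLeast h u c) _ _ (begin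
      atLeast p v c + atLeast h u c    ≤⟨ atLeast-interval c p≤h v≤u ⟩
      atLeast h v c + atLeast p u c    ≤⟨ +-monoʳ-≤ (atLeast h v c) (a⊵c p≤h u) ⟩
      atLeast h v c + atLeast p u a    ≤⟨ bound ⟩
      atLeast p v c′ + atLeast h u c   ∎)
    where
    open ≤-Reasoning
    -- If v ≤ a p but c′ p < v, then the first p rows of c′ contain all entries of c between
    -- v and a p, and we continue from the threshold a p + 1.
    saturated : ∀ p → p ≤ h → ∀ v →
      ∃[ u ] v ≤ u × atLeast h v c + atLeast p u a ≤ atLeast p v c′ + atLeast h u c
    saturated zero    p≤h v = v , ≤-refl , ≤-reflexive (+-comm (atLeast h v c) 0)
    saturated (suc p) p<h v with saturated p (<⇒≤ p<h) v
    ... | u , v≤u , bound with u ≤? a p | v ≤? c′ p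
    ...   | no u≰a | _ = u , v≤u , (begin
      atLeast h v c + ([ u ≤? a p ]ᵢ + atLeast p u a)   ≡⟨ cong (λ x → atLeast h v c + (x + atLeast p u a)) (indicator-no (u ≤? a p) u≰a) ⟩
      atLeast h v c + atLeast p u a                     ≤⟨ bound ⟩
      atLeast p v c′ + atLeast h u c                    ≤⟨ +-monoˡ-≤ (atLeast h u c) (m≤n+m _ _) ⟩
      [ v ≤? c′ p ]ᵢ + atLeast p v c′ + atLeast h u c   ∎)
    ...   | yes u≤a | yes v≤c′ = u , v≤u , (begin
      atLeast h v c + ([ u ≤? a p ]ᵢ + atLeast p u a)   ≤⟨ +-monoʳ-≤ (atLeast h v c) (+-monoˡ-≤ _ (indicator≤1 (u ≤? a p))) ⟩
      atLeast h v c + suc (atLeast p u a)               ≡⟨ +-suc _ _ ⟩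
      suc (atLeast h v c + atLeast p u a)               ≤⟨ s≤s bound ⟩
      1 + atLeast p v c′ + atLeast h u c                ≡⟨ cong (λ x → x + atLeast p v c′ + atLeast h u c) (indicator-yes (v ≤? c′ p) v≤c′) ⟨
      [ v ≤? c′ p ]ᵢ + atLeast p v c′ + atLeast h u c   ∎)
    ...   | yes u≤a | no v≰c′ with saturated p (<⇒≤ p<h) (suc (a p))
    ...     | u′ , a<u′ , bound′ = u′ , ≤-trans v≤u (≤-trans u≤a (<⇒≤ a<u′)) , +-cancelʳ-≤ (atLeast p w c′) _ _ (begin
      atLeast h v c + ([ u′ ≤? a p ]ᵢ + atLeast p u′ a) + atLeast p w c′
        ≡⟨ cong (λ x → atLeast h v c + (x + atLeast p u′ a) + atLeast p w c′) (indicator-no (u′ ≤? a p) (<⇒≱ a<u′)) ⟩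
      atLeast h v c + atLeast p u′ a + atLeast p w c′
        ≡⟨ cong (λ x → x + atLeast p u′ a + atLeast p w c′) (content v) ⟨
      atLeast h v c′ + atLeast p u′ a + atLeast p w c′
        ≡⟨ lemma (atLeast h v c′) _ _ ⟩
      atLeast h v c′ + atLeast p w c′ + atLeast p u′ a
        ≡⟨ cong (_+ atLeast p u′ a) (atLeast-gap c′ (<⇒≤ p<h) v≤w gap) ⟩
      atLeast p v c′ + atLeast h w c′ + atLeast p u′ a
        ≡⟨ cong (λ x → atLeast p v c′ + x + atLeast p u′ a) (content w) ⟩
      atLeast p v c′ + atLeast h w c + atLeast p u′ a
        ≡⟨ +-assoc (atLeast p v c′) _ _ ⟩
      atLeast p v c′ + (atLeast h w c + atLeast p u′ a)
        ≤⟨ +-monoʳ-≤ (atLeast p v c′) bound′ ⟩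
      atLeast p v c′ + (atLeast p w c′ + atLeast h u′ c)
        ≡⟨ lemma′ (atLeast p v c′) _ _ ⟩
      atLeast p v c′ + atLeast h u′ c + atLeast p w c′
        ≤⟨ +-monoˡ-≤ (atLeast p w c′) (+-monoˡ-≤ (atLeast h u′ c) (m≤n+m _ [ v ≤? c′ p ]ᵢ)) ⟩
      [ v ≤? c′ p ]ᵢ + atLeast p v c′ + atLeast h u′ c + atLeast p w c′ ∎)
      where
      w : ℕ
      w = suc (a p)
      v≤w : v ≤ w
      v≤w = ≤-trans v≤u (m≤n⇒m≤1+n u≤a)
      lemma : ∀ x y z → x + y + z ≡ x + z + y
      lemma = solveℕ-∀
      lemma′ : ∀ x y z → x + (y + z) ≡ x + z + y
      lemma′ = solveℕ-∀
      -- By `noTriple`, an entry of `c′` after row `p` that is at most a p is smaller than c′ p,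
      -- which is itself below `v`.
      gap : ∀ {i} → p ≤ i → i < h → c′ i < v ⊎ w ≤ c′ i
      gap {i} p≤i i<h with m≤n⇒m<n∨m≡n p≤i | c′ i ≤? a p
      ... | inj₂ refl | _       = inj₁ (≰⇒> v≰c′)
      ... | inj₁ p<i  | yes c≤a = inj₁ (<-trans (noTriple next i<h p<i c≤a) (≰⇒> v≰c′))
      ... | inj₁ p<i  | no c≰a  = inj₂ (≰⇒> c≰a)

  rearrange : ∀ {n h a c} → IsColumn n h c → Dominates h a c →
    ∃[ c′ ] IsNext h a c′ × Dominates h c′ c × (∀ v → atLeast h v c′ ≡ atLeast h v c)
  rearrange {h = h} {a} {c} column a⊵c =
    g.arranged , next , greedy-maximal a⊵c next g.content , g.content
    where
    module g = Greedy (greedy h a c (distinct column) (a⊵c ≤-refl))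
    next : IsNext h a g.arranged
    next = isNext (λ i<h → let j , j<h , eq = g.from i<h in subst (1 ≤_) (sym eq) (entry≥1 column j<h))
      g.below g.noTriple

open Columns

-- Weights and energies of columns.

module ColumnWeights where
  open import Data.Fin.Base using (Fin; zero; suc; toℕ)
  open import Data.Nat.Base
  open import Data.Nat.Properties
  open import Data.Nat.Tactic.RingSolver renaming (solve-∀ to solveℕ-∀)
  open import Data.Vec.Base as Vec using (Vec; []; _∷_; replicate; tabulate; lookup)
  import Data.Vec.Properties as Vec
  open import Function.Base using (_∘_; case_of_)
  open import Relation.Binary.PropositionalEquality
  open import Relation.Binary.Definitions using (tri<; tri≈; tri>)
  open import Data.Sum.Base using (inj₁; inj₂)
  open import Relation.Nullary using (yes; no; contradiction)

  -- Lookup with default 0, so that shapes and columns become functions on all of ℕ and a row beyond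
  -- the vector counts as an empty row.
  at : Vec ℕ m → ℕ → ℕ
  at []      i       = 0
  at (x ∷ v) zero    = x
  at (x ∷ v) (suc i) = at v i

  at-ext : ∀ {u v : Vec ℕ m} → (∀ i → at u i ≡ at v i) → u ≡ v
  at-ext {u = []}    {[]}    eq = refl
  at-ext {u = x ∷ u} {y ∷ v} eq = cong₂ _∷_ (eq 0) (at-ext (eq ∘ suc))

  at-lookup : ∀ (v : Vec ℕ m) i → lookup v i ≡ at v (toℕ i)
  at-lookup (x ∷ v) zero    = refl
  at-lookup (x ∷ v) (suc i) = at-lookup v i

  at-map : ∀ {f : ℕ → ℕ} → f 0 ≡ 0 → ∀ (v : Vec ℕ m) i → at (Vec.map f v) i ≡ f (at v i)
  at-map f0≡0 []      i       = sym f0≡0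
  at-map f0≡0 (x ∷ v) zero    = refl
  at-map f0≡0 (x ∷ v) (suc i) = at-map f0≡0 v i

  at-beyond : ∀ (v : Vec ℕ m) {i} → m ≤ i → at v i ≡ 0
  at-beyond []      _         = refl
  at-beyond (x ∷ v) (s≤s m≤i) = at-beyond v m≤i

  at-replicate : ∀ m i → at (replicate m 0) i ≡ 0
  at-replicate zero    i       = refl
  at-replicate (suc m) zero    = refl
  at-replicate (suc m) (suc i) = at-replicate m i

  occurrences : ℕ → ℕ → (ℕ → ℕ) → ℕ
  occurrences h v a = sumTo h λ i → [ a i ≟ v ]ᵢ

  columnWeight : ∀ n → ℕ → (ℕ → ℕ) → Vec ℕ n
  columnWeight n h a = tabulate λ i → occurrences h (suc (toℕ i)) a

  occurrences-atLeast : ∀ h v a → occurrences h v a + atLeast h (suc v) a ≡ atLeast h v a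
  occurrences-atLeast zero    v a = refl
  occurrences-atLeast (suc h) v a = trans
    (lemma [ a h ≟ v ]ᵢ (occurrences h v a) [ suc v ≤? a h ]ᵢ _)
    (cong₂ _+_ here (occurrences-atLeast h v a))
    where
    lemma : ∀ x y z w → x + y + (z + w) ≡ x + z + (y + w)
    lemma = solveℕ-∀
    here : [ a h ≟ v ]ᵢ + [ suc v ≤? a h ]ᵢ ≡ [ v ≤? a h ]ᵢ
    here = case <-cmp v (a h) of λ where
      (tri< v<a v≢a _) → trans
        (cong₂ _+_ (indicator-no (a h ≟ v) (v≢a ∘ sym)) (indicator-yes (suc v ≤? a h) v<a))
        (sym (indicator-yes (v ≤? a h) (<⇒≤ v<a)))
      (tri≈ v≮a v≡a _) → trans
        (cong₂ _+_ (indicator-yes (a h ≟ v) (sym v≡a)) (indicator-no (suc v ≤? a h) v≮a))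
        (sym (indicator-yes (v ≤? a h) (≤-reflexive v≡a)))
      (tri> v≮a v≢a a<v) → trans
        (cong₂ _+_ (indicator-no (a h ≟ v) (v≢a ∘ sym)) (indicator-no (suc v ≤? a h) v≮a))
        (sym (indicator-no (v ≤? a h) (<⇒≱ a<v)))

  columnWeight-content : ∀ n h {a b} → (∀ v → atLeast h v a ≡ atLeast h v b) →
                         columnWeight n h a ≡ columnWeight n h b
  columnWeight-content n h {a} {b} eq = Vec.tabulate-cong λ i → let v = suc (toℕ i) in
    +-cancelʳ-≡ (atLeast h (suc v) a) _ _ (begin
      occurrences h v a + atLeast h (suc v) a  ≡⟨ occurrences-atLeast h v a ⟩
      atLeast h v a                            ≡⟨ eq v ⟩
      atLeast h v b                            ≡⟨ occurrences-atLeast h v b ⟨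
      occurrences h v b + atLeast h (suc v) b  ≡⟨ cong (occurrences h v b +_) (eq (suc v)) ⟨
      occurrences h v b + atLeast h (suc v) a  ∎)
    where open ≡-Reasoning

  tabulate-0 : ∀ n → tabulate {n = n} (λ _ → 0) ≡ replicate n 0
  tabulate-0 zero    = refl
  tabulate-0 (suc n) = cong (0 ∷_) (tabulate-0 n)

  tabulate-+ : ∀ {n} (f g : Fin n → ℕ) → tabulate (λ i → f i + g i) ≡ tabulate f +ᵥ tabulate g
  tabulate-+ {zero}  f g = refl
  tabulate-+ {suc n} f g = cong (f zero + g zero ∷_) (tabulate-+ (f ∘ suc) (g ∘ suc))

  private
    -- The weight of a single box with content `x`, its coordinates numbered from `k` as in
    -- `energyFrom`.
    unit : ∀ n → ℕ → ℕ → Vec ℕ n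
    unit n k x = tabulate λ i → [ x ≟ k + toℕ i ]ᵢ

    unit-suc : ∀ n k x → tabulate {n = n} (λ i → [ x ≟ k + suc (toℕ i) ]ᵢ) ≡ unit n (suc k) x
    unit-suc n k x = Vec.tabulate-cong λ i → cong (λ y → [ x ≟ y ]ᵢ) (+-suc k (toℕ i))

    energyFrom-unit-below : ∀ n {k x} → x < k → energyFrom k (unit n k x) ≡ 0
    energyFrom-unit-below zero            x<k = refl
    energyFrom-unit-below (suc n) {k} {x} x<k = cong₂ _+_
      (trans (cong (k *_) (indicator-no (x ≟ k + 0) λ x≡ → <⇒≢ x<k (trans x≡ (+-identityʳ k)))) (*-zeroʳ k))
      (trans (cong (energyFrom (suc k)) (unit-suc n k x)) (energyFrom-unit-below n (m<n⇒m<1+n x<k)))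

    energyFrom-unit : ∀ n {k x} → k ≤ x → x < k + n → energyFrom k (unit n k x) ≡ x
    energyFrom-unit zero    {k} k≤x x<k = contradiction x<k (≤⇒≯ (≤-trans (≤-reflexive (+-identityʳ k)) k≤x))
    energyFrom-unit (suc n) {k} {x} k≤x x<k+n = trans
      (cong (λ e → k * [ x ≟ k + 0 ]ᵢ + energyFrom (suc k) e) (unit-suc n k x)) (case m≤n⇒m<n∨m≡n k≤x of λ where
        (inj₁ k<x)  → cong₂ _+_
          (trans (cong (k *_) (indicator-no (x ≟ k + 0) λ x≡ → <⇒≢ k<x (sym (trans x≡ (+-identityʳ k))))) (*-zeroʳ k))
          (energyFrom-unit n k<x (subst (x <_) (+-suc k n) x<k+n))
        (inj₂ refl) → trans (cong₂ _+_
          (trans (cong (k *_) (indicator-yes (x ≟ k + 0) (sym (+-identityʳ k)))) (*-identityʳ k))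
          (energyFrom-unit-below n ≤-refl)) (+-identityʳ k))

  -- The bounds 1 and `n` on the entries enter here: a content outside them would leave no trace in
  -- the weight.
  energy-columnWeight : ∀ {n h a} → IsColumn n h a → energy (columnWeight n h a) ≡ sumTo h a
  energy-columnWeight {n} {zero}  {a} column = trans (cong energy (tabulate-0 n)) (energyFrom-0 1 n)
  energy-columnWeight {n} {suc h} {a} column = begin
    energy (columnWeight n (suc h) a)
      ≡⟨ cong energy (tabulate-+ {n} (λ i → [ a h ≟ suc (toℕ i) ]ᵢ) (λ i → occurrences h (suc (toℕ i)) a)) ⟩
    energy (unit n 1 (a h) +ᵥ columnWeight n h a)
      ≡⟨ energyFrom-+ᵥ 1 (unit n 1 (a h)) (columnWeight n h a) ⟩
    energy (unit n 1 (a h)) + energy (columnWeight n h a)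
      ≡⟨ cong₂ _+_ (energyFrom-unit n (entry≥1 column ≤-refl) (s≤s (entry≤n column ≤-refl)))
           (energy-columnWeight (isColumn-≤ (n≤1+n h) column)) ⟩
    a h + sumTo h a ∎
    where open ≡-Reasoning

  -- Entrywise inequality together with equal sums would force equality in the first `h` rows, and
  -- the rows below agree by assumption. This is what separates the eigenvalues of one height.
  energy-decreases : ∀ {m n h} {A B : Vec ℕ m} → IsColumn n h (at A) → IsNext h (at A) (at B) →
    (∀ {i} → h ≤ i → at B i ≡ at A i) → B ≢ A →
    energy (columnWeight n h (at B)) < energy (columnWeight n h (at A))
  energy-decreases {h = h} {A} {B} column next frozen B≢A = subst₂ _<_
    (sym (energy-columnWeight (isNext⇒isColumn column next))) (sym (energy-columnWeight column))
    (≰⇒> λ sum≤ → B≢A (at-ext λ i → case i <? h of λ where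
      (yes i<h) → sumTo-rigid h (below next) sum≤ i<h
      (no i≮h)  → frozen (≮⇒≥ i≮h)))

open ColumnWeights

-- Fillings, and the removal and addition of a first column.

module Fillings where
  open import Data.Fin.Base as Fin using (Fin; zero; suc; toℕ; inject₁; fromℕ<)
  import Data.Fin.Properties as Fin
  open import Data.List.Base as List using (List; []; _∷_; _++_; filter; length; take; drop)
  import Data.List.Properties as List
  open import Data.Nat.Base
  open import Data.Nat.Properties
  open import Data.Nat.Tactic.RingSolver renaming (solve-∀ to solveℕ-∀)
  open import Data.Product.Base using (_×_; _,_; ∃-syntax; Σ-syntax)
  open import Data.Vec.Base as Vec using (Vec; []; _∷_; lookup; toList)
  import Data.Vec.Properties as Vec
  open import Data.Vec.Relation.Unary.All using ([]; _∷_)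
  open import Function.Base using (_∘_)
  open import Relation.Binary.PropositionalEquality
  open import Relation.Nullary using (Dec; yes; no)

  record IsShape (h : ℕ) (Λ : Vec ℕ m) : Set where
    constructor isShape
    field
      shorter : ∀ {i i′} → i ≤ i′ → at Λ i′ ≤ at Λ i
      empty   : ∀ {i} → h ≤ i → at Λ i ≡ 0

  open IsShape public

  row<h : ∀ {h} {Λ : Vec ℕ m} → IsShape h Λ → ∀ {i j} → j < at Λ i → i < h
  row<h {h = h} sh {i} j<Λᵢ = ≰⇒> λ h≤i → n≮0 (subst (_ <_) (empty sh h≤i) j<Λᵢ)

  -- The shape with a column of height `h` put in front. Under `IsShape h` the rows from `h` on are
  -- empty, so the result is again a partition.
  bump : ℕ → Vec ℕ m → Vec ℕ m
  bump h       []      = []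
  bump zero    (l ∷ Λ) = l ∷ Λ
  bump (suc h) (l ∷ Λ) = suc l ∷ bump h Λ

  at-bump-< : ∀ {h} (Λ : Vec ℕ m) {i} → h ≤ m → i < h → at (bump h Λ) i ≡ suc (at Λ i)
  at-bump-< {h = suc h} (l ∷ Λ) {zero}  h≤m       i<h       = refl
  at-bump-< {h = suc h} (l ∷ Λ) {suc i} (s≤s h≤m) (s≤s i<h) = at-bump-< Λ h≤m i<h

  at-bump-≥ : ∀ {h} (Λ : Vec ℕ m) {i} → h ≤ i → at (bump h Λ) i ≡ at Λ i
  at-bump-≥ {h = h}     []      h≤i       = refl
  at-bump-≥ {h = zero}  (l ∷ Λ) h≤i       = refl
  at-bump-≥ {h = suc h} (l ∷ Λ) (s≤s h≤i) = at-bump-≥ Λ h≤i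

  isShape-bump : ∀ {h} {Λ : Vec ℕ m} → h ≤ m → IsShape h Λ → IsShape h (bump h Λ)
  isShape-bump {h = h} {Λ} h≤m sh = isShape shorter′ λ h≤i → trans (at-bump-≥ Λ h≤i) (empty sh h≤i)
    where
    shorter′ : ∀ {i i′} → i ≤ i′ → at (bump h Λ) i′ ≤ at (bump h Λ) i
    shorter′ {i} {i′} i≤i′ with i′ <? h
    ... | yes i′<h = subst₂ _≤_ (sym (at-bump-< Λ h≤m i′<h)) (sym (at-bump-< Λ h≤m (≤-<-trans i≤i′ i′<h)))
                       (s≤s (shorter sh i≤i′))
    ... | no i′≮h  = subst (_≤ at (bump h Λ) i)
                       (sym (trans (at-bump-≥ Λ (≮⇒≥ i′≮h)) (empty sh (≮⇒≥ i′≮h)))) z≤n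

  entryAt : {Λ : Vec ℕ m} → Vec ℕ m → Filling Λ → ℕ → ℕ → ℕ
  entryAt []      []      i       j = 0
  entryAt (b ∷ β) (r ∷ T) zero    j = at (b ∷ r) j
  entryAt (b ∷ β) (r ∷ T) (suc i) j = entryAt β T i j

  entryAt-0 : {Λ : Vec ℕ m} (β : Vec ℕ m) (T : Filling Λ) → ∀ i → entryAt β T i 0 ≡ at β i
  entryAt-0 []      []      i       = refl
  entryAt-0 (b ∷ β) (r ∷ T) zero    = refl
  entryAt-0 (b ∷ β) (r ∷ T) (suc i) = entryAt-0 β T i

  entry≡entryAt : {Λ : Vec ℕ m} (β : Vec ℕ m) (T : Filling Λ) → ∀ i j → entry β T i j ≡ entryAt β T (toℕ i) (toℕ j)
  entry≡entryAt (b ∷ β) (r ∷ T) zero    j = at-lookup (b ∷ r) j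
  entry≡entryAt (b ∷ β) (r ∷ T) (suc i) j = entry≡entryAt β T i j

  box : ∀ (Λ : Vec ℕ m) i {j} → j < at Λ i →
    ∃[ i′ ] Σ[ j′ ∈ Fin (lookup Λ i′) ] toℕ i′ ≡ i × toℕ j′ ≡ j
  box (l ∷ Λ) zero    j<l = zero , fromℕ< j<l , refl , Fin.toℕ-fromℕ< j<l
  box (l ∷ Λ) (suc i) j<Λᵢ =
    let i′ , j′ , i≡ , j≡ = box Λ i j<Λᵢ in suc i′ , j′ , cong suc i≡ , j≡

  -- For a partition shape, the comparison of row lengths in InversionTriple is automatic.
  record IsKey {Λ : Vec ℕ m} (β : Vec ℕ m) (T : Filling Λ) : Set where
    constructor isKey
    field
      positive   : ∀ {i j} → j < at Λ i → 1 ≤ entryAt β T i (suc j)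
      decreasing : ∀ {i j} → j < at Λ i → entryAt β T i (suc j) ≤ entryAt β T i j
      noTriple   : ∀ {i i′ j} → i < i′ → j < at Λ i′ → entryAt β T i′ (suc j) ≤ entryAt β T i j →
                   entryAt β T i′ (suc j) < entryAt β T i (suc j)

  module _ {Λ : Vec ℕ m} {β : Vec ℕ m} {T : Filling Λ} {h} (sh : IsShape h Λ) where

    private
      e : ℕ → ℕ → ℕ
      e = entryAt β T

      entry-suc : ∀ i (j : Fin (lookup Λ i)) → entry β T i (suc j) ≡ e (toℕ i) (suc (toℕ j))
      entry-suc i j = entry≡entryAt β T i (suc j)

      entry-inject₁ : ∀ i (j : Fin (lookup Λ i)) → entry β T i (inject₁ j) ≡ e (toℕ i) (toℕ j)
      entry-inject₁ i j = trans (entry≡entryAt β T i (inject₁ j)) (cong (e (toℕ i)) (Fin.toℕ-inject₁ j))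

      in-row : ∀ i (j : Fin (lookup Λ i)) → toℕ j < at Λ (toℕ i)
      in-row i j = subst (toℕ j <_) (at-lookup Λ i) (Fin.toℕ<n j)

    isKeyTableau⇒isKey : IsKeyTableau β T → IsKey β T
    isKeyTableau⇒isKey key = isKey positive′ decreasing′ noTriple′
      where
      positive′ : ∀ {i j} → j < at Λ i → 1 ≤ e i (suc j)
      positive′ {i} j<Λᵢ with box Λ i j<Λᵢ
      ... | i′ , j′ , refl , refl = subst (1 ≤_) (entry-suc i′ j′) (positive key i′ j′)
      decreasing′ : ∀ {i j} → j < at Λ i → e i (suc j) ≤ e i j
      decreasing′ {i} j<Λᵢ with box Λ i j<Λᵢ
      ... | i′ , j′ , refl , refl =
        subst₂ _≤_ (entry-suc i′ j′) (entry-inject₁ i′ j′) (decreasing key i′ j′)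
      noTriple′ : ∀ {i i′ j} → i < i′ → j < at Λ i′ → e i′ (suc j) ≤ e i j → e i′ (suc j) < e i (suc j)
      noTriple′ {i} {i′} i<i′ j<Λᵢ′ c≤a with box Λ i′ j<Λᵢ′ | box Λ i (<-≤-trans j<Λᵢ′ (shorter sh (<⇒≤ i<i′)))
      ... | k′ , l′ , refl , refl | k , l , refl , l≡l′ = ≰⇒> λ b≤c → noTriple key k k′ l l′
        ( i<i′ , l≡l′
        , subst₂ _≤_ (sym (at-lookup Λ k′)) (sym (at-lookup Λ k)) (shorter sh (<⇒≤ i<i′))
        , subst₂ _≤_ (sym (entry-suc k′ l′)) (trans (cong (e (toℕ k)) (sym l≡l′)) (sym (entry-inject₁ k l))) c≤a
        , subst₂ _≤_ (trans (cong (e (toℕ k) ∘ suc) (sym l≡l′)) (sym (entry-suc k l))) (sym (entry-suc k′ l′)) b≤c)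

    isKey⇒isKeyTableau : IsKey β T → IsKeyTableau β T
    isKey⇒isKeyTableau key = isKeyTableau
      (λ i j → subst (1 ≤_) (sym (entry-suc i j)) (key.positive (in-row i j)))
      (λ i j → subst₂ _≤_ (sym (entry-suc i j)) (sym (entry-inject₁ i j)) (key.decreasing (in-row i j)))
      (λ { i i′ j j′ (i<i′ , j≡j′ , _ , c≤a , b≤c) → <⇒≱
        (key.noTriple i<i′ (in-row i′ j′)
          (subst₂ _≤_ (entry-suc i′ j′) (trans (entry-inject₁ i j) (cong (e (toℕ i)) j≡j′)) c≤a))
        (subst₂ _≤_ (trans (entry-suc i j) (cong (e (toℕ i) ∘ suc) j≡j′)) (entry-suc i′ j′) b≤c) })
      where module key = IsKey key

  -- `B` is meant as the basement of `T`: the old basement becomes the first column of the new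
  -- filling.
  prepend : ∀ h → Vec ℕ m → {Λ : Vec ℕ m} → Filling Λ → Filling (bump h Λ)
  prepend h       []      {[]}    []      = []
  prepend zero    (b ∷ B) {l ∷ Λ} (r ∷ T) = r ∷ T
  prepend (suc h) (b ∷ B) {l ∷ Λ} (r ∷ T) = (b ∷ r) ∷ prepend h B T

  entryAt-prepend : ∀ {h} (A B : Vec ℕ m) {Λ} (T : Filling Λ) {i} j → i < h →
    entryAt A (prepend h B T) i (suc j) ≡ entryAt B T i j
  entryAt-prepend {h = suc h} []      []      {[]}    []      j       i<h = refl
  entryAt-prepend {h = suc h} (a ∷ A) (b ∷ B) {l ∷ Λ} (r ∷ T) {zero}  j i<h = refl
  entryAt-prepend {h = suc h} (a ∷ A) (b ∷ B) {l ∷ Λ} (r ∷ T) {suc i} j (s≤s i<h) = entryAt-prepend A B T j i<h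

  module _ {h : ℕ} {A B Λ : Vec ℕ m} {T : Filling Λ} (h≤m : h ≤ m) (sh : IsShape h Λ) where

    private
      e e′ : ℕ → ℕ → ℕ
      e = entryAt B T
      e′ = entryAt A (prepend h B T)

      e′-0 : ∀ i → e′ i 0 ≡ at A i
      e′-0 = entryAt-0 A (prepend h B T)

      e′-1 : ∀ {i} → i < h → e′ i 1 ≡ at B i
      e′-1 i<h = trans (entryAt-prepend A B T 0 i<h) (entryAt-0 B T _)

      e′-suc : ∀ {i} → i < h → ∀ j → e′ i (suc j) ≡ e i j
      e′-suc i<h j = entryAt-prepend A B T j i<h

      in-bump : ∀ {i j} → i < h → j ≤ at Λ i → j < at (bump h Λ) i
      in-bump i<h j≤ = subst (_ <_) (sym (at-bump-< Λ h≤m i<h)) (s≤s j≤)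

      in-bump⁻ : ∀ {i j} → j < at (bump h Λ) i → i < h × j ≤ at Λ i
      in-bump⁻ j< = let i<h = row<h (isShape-bump h≤m sh) j< in
        i<h , s≤s⁻¹ (subst (_ <_) (at-bump-< Λ h≤m i<h) j<)

    isKey-prepend⁻ : IsKey A (prepend h B T) → IsNext h (at A) (at B) × IsKey B T
    isKey-prepend⁻ (isKey pos dec noT) =
      isNext (λ i<h → subst (1 ≤_) (e′-1 i<h) (pos (in-bump i<h z≤n)))
             (λ {i} i<h → subst₂ _≤_ (e′-1 i<h) (e′-0 i) (dec (in-bump i<h z≤n)))
             (λ {i′} i′<h {i} i<i′ b≤a → subst₂ _<_ (e′-1 i′<h) (e′-1 (<-trans i<i′ i′<h))
               (noT i<i′ (in-bump i′<h z≤n) (subst₂ _≤_ (sym (e′-1 i′<h)) (sym (e′-0 i)) b≤a))) ,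
      isKey (λ {i} {j} j<Λᵢ → let i<h = row<h sh j<Λᵢ in
               subst (1 ≤_) (e′-suc i<h (suc j)) (pos (in-bump i<h j<Λᵢ)))
            (λ {i} {j} j<Λᵢ → let i<h = row<h sh j<Λᵢ in
               subst₂ _≤_ (e′-suc i<h (suc j)) (e′-suc i<h j) (dec (in-bump i<h j<Λᵢ)))
            (λ {i} {i′} {j} i<i′ j<Λᵢ′ c≤a → let i′<h = row<h sh j<Λᵢ′ ; i<h = <-trans i<i′ i′<h in
               subst₂ _<_ (e′-suc i′<h (suc j)) (e′-suc i<h (suc j))
                 (noT i<i′ (in-bump i′<h j<Λᵢ′)
                   (subst₂ _≤_ (sym (e′-suc i′<h (suc j))) (sym (e′-suc i<h j)) c≤a)))

    isKey-prepend⁺ : IsNext h (at A) (at B) → IsKey B T → IsKey A (prepend h B T)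
    isKey-prepend⁺ next (isKey pos dec noT) = isKey pos′ dec′ noT′
      where
      pos′ : ∀ {i j} → j < at (bump h Λ) i → 1 ≤ e′ i (suc j)
      pos′ {i} {j} j< with in-bump⁻ {i} j<
      pos′ {i} {zero}  j< | i<h , j≤ = subst (1 ≤_) (sym (e′-1 i<h)) (IsNext.positive next i<h)
      pos′ {i} {suc j} j< | i<h , j≤ = subst (1 ≤_) (sym (e′-suc i<h (suc j))) (pos j≤)
      dec′ : ∀ {i j} → j < at (bump h Λ) i → e′ i (suc j) ≤ e′ i j
      dec′ {i} {j} j< with in-bump⁻ {i} j<
      dec′ {i} {zero}  j< | i<h , j≤ =
        subst₂ _≤_ (sym (e′-1 i<h)) (sym (e′-0 i)) (below next i<h)
      dec′ {i} {suc j} j< | i<h , j≤ =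
        subst₂ _≤_ (sym (e′-suc i<h (suc j))) (sym (e′-suc i<h j)) (dec j≤)
      noT′ : ∀ {i i′ j} → i < i′ → j < at (bump h Λ) i′ → e′ i′ (suc j) ≤ e′ i j → e′ i′ (suc j) < e′ i (suc j)
      noT′ {i} {i′} {j} i<i′ j< c≤a with in-bump⁻ {i′} j<
      noT′ {i} {i′} {zero}  i<i′ j< c≤a | i′<h , j≤ =
        subst₂ _<_ (sym (e′-1 i′<h)) (sym (e′-1 (<-trans i<i′ i′<h)))
          (IsNext.noTriple next i′<h i<i′ (subst₂ _≤_ (e′-1 i′<h) (e′-0 i) c≤a))
      noT′ {i} {i′} {suc j} i<i′ j< c≤a | i′<h , j≤ =
        let i<h = <-trans i<i′ i′<h in
        subst₂ _<_ (sym (e′-suc i′<h (suc j))) (sym (e′-suc i<h (suc j)))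
          (noT i<i′ j≤ (subst₂ _≤_ (e′-suc i′<h (suc j)) (e′-suc i<h j) c≤a))

  length-filter-∷ : {A : Set} {P : A → Set} (P? : ∀ x → Dec (P x)) → ∀ x xs →
    length (filter P? (x ∷ xs)) ≡ [ P? x ]ᵢ + length (filter P? xs)
  length-filter-∷ P? x xs with P? x
  ... | yes _ = refl
  ... | no _  = refl

  weight-prepend : ∀ n {h} (B : Vec ℕ m) {Λ} (T : Filling Λ) → h ≤ m →
    weight n (prepend h B T) ≡ columnWeight n h (at B) +ᵥ weight n T
  weight-prepend n {h} B T h≤m = trans
    (Vec.tabulate-cong λ i → count (suc (toℕ i)) h≤m B T) (tabulate-+ {n} _ _)
    where
    lemma : ∀ x y z w → x + (y + (z + w)) ≡ x + z + (y + w)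
    lemma = solveℕ-∀
    length-filter-++ : ∀ v (xs ys : List ℕ) →
      length (filter (_≟ v) (xs ++ ys)) ≡ length (filter (_≟ v) xs) + length (filter (_≟ v) ys)
    length-filter-++ v xs ys = trans (cong length (List.filter-++ (_≟ v) xs ys)) (List.length-++ (filter (_≟ v) xs))
    count : ∀ v {m h} (h≤m : h ≤ m) (B : Vec ℕ m) {Λ} (T : Filling Λ) →
      length (filter (_≟ v) (contents (prepend h B T))) ≡
      occurrences h v (at B) + length (filter (_≟ v) (contents T))
    count v {h = zero}  h≤m       []      {[]}    []      = refl
    count v {h = zero}  h≤m       (b ∷ B) {l ∷ Λ} (r ∷ T) = refl
    count v {h = suc h} (s≤s h≤m) (b ∷ B) {l ∷ Λ} (r ∷ T) = begin
      length (filter (_≟ v) (b ∷ toList r ++ contents (prepend h B T)))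
        ≡⟨ length-filter-∷ (_≟ v) b _ ⟩
      [ b ≟ v ]ᵢ + length (filter (_≟ v) (toList r ++ contents (prepend h B T)))
        ≡⟨ cong ([ b ≟ v ]ᵢ +_) (length-filter-++ v (toList r) _) ⟩
      [ b ≟ v ]ᵢ + (length (filter (_≟ v) (toList r)) + length (filter (_≟ v) (contents (prepend h B T))))
        ≡⟨ cong (λ x → [ b ≟ v ]ᵢ + (length (filter (_≟ v) (toList r)) + x)) (count v h≤m B T) ⟩
      [ b ≟ v ]ᵢ + (length (filter (_≟ v) (toList r)) + (occurrences h v (at B) + length (filter (_≟ v) (contents T))))
        ≡⟨ lemma [ b ≟ v ]ᵢ (length (filter (_≟ v) (toList r))) (occurrences h v (at B)) _ ⟩
      [ b ≟ v ]ᵢ + occurrences h v (at B) + (length (filter (_≟ v) (toList r)) + length (filter (_≟ v) (contents T)))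
        ≡⟨ cong₂ _+_ (sumTo-head h λ i → [ at (b ∷ B) i ≟ v ]ᵢ) (length-filter-++ v (toList r) (contents T)) ⟨
      occurrences (suc h) v (at (b ∷ B)) + length (filter (_≟ v) (toList r ++ contents T)) ∎
      where open ≡-Reasoning

  column-empty : {Λ : Vec ℕ m} (T : Filling Λ) → (∀ i → at Λ i ≡ 0) → ∀ j → column T j ≡ []
  column-empty {Λ = []}       []       empty j = refl
  column-empty {Λ = zero ∷ Λ} ([] ∷ T) empty j =
    trans (cong (λ xs → take 1 xs ++ column T j) (List.drop-[] j)) (column-empty T (empty ∘ suc) j)
  column-empty {Λ = suc l ∷ Λ} (r ∷ T) empty j with () ← empty 0

  length-column : ∀ {h} {Λ : Vec ℕ m} (T : Filling Λ) → (∀ {i} → h ≤ i → at Λ i ≡ 0) → ∀ j →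
    length (column T j) ≤ h
  length-column {h = zero}  {Λ}     T       empty j = ≤-reflexive (cong length (column-empty T (λ i → empty {i} z≤n) j))
  length-column {h = suc h} {[]}    []      empty j = z≤n
  length-column {h = suc h} {l ∷ Λ} (r ∷ T) empty j = ≤-trans
    (≤-reflexive (List.length-++ (take 1 (drop j (toList r)))))
    (+-mono-≤ (≤-trans (≤-reflexive (List.length-take 1 (drop j (toList r)))) (m⊓n≤m 1 _)) (length-column T (empty ∘ s≤s) j))

  column-prepend-zero : ∀ {h} (B : Vec ℕ m) {Λ} (T : Filling Λ) → (∀ {i} → h ≤ i → at Λ i ≡ 0) →
    column (prepend h B T) 0 ≡ take h (toList B)
  column-prepend-zero {h = zero}  []      {[]}    []      empty = refl
  column-prepend-zero {h = suc h} []      {[]}    []      empty = refl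
  column-prepend-zero {h = zero}  (b ∷ B) {l ∷ Λ} (r ∷ T) empty = column-empty (r ∷ T) (λ i → empty {i} z≤n) 0
  column-prepend-zero {h = suc h} (b ∷ B) {l ∷ Λ} (r ∷ T) empty = cong (b ∷_) (column-prepend-zero B T (empty ∘ s≤s))

  column-prepend-suc : ∀ {h} (B : Vec ℕ m) {Λ} (T : Filling Λ) → (∀ {i} → h ≤ i → at Λ i ≡ 0) →
    ∀ j → column (prepend h B T) (suc j) ≡ column T j
  column-prepend-suc {h = zero}  []      {[]}    []      empty j = refl
  column-prepend-suc {h = suc h} []      {[]}    []      empty j = refl
  column-prepend-suc {h = zero}  (b ∷ B) {l ∷ Λ} (r ∷ T) empty j = trans
    (column-empty (r ∷ T) (λ i → empty {i} z≤n) (suc j)) (sym (column-empty (r ∷ T) (λ i → empty {i} z≤n) j))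
  column-prepend-suc {h = suc h} (b ∷ B) {l ∷ Λ} (r ∷ T) empty j =
    cong (take 1 (drop j (toList r)) ++_) (column-prepend-suc B T (empty ∘ s≤s) j)

  -- `A` supplies the entries of the rows without boxes. This makes the column unique, so that a
  -- filling determines the successor of `A` it starts with.
  firstColumn : ∀ h → Vec ℕ m → {Λ : Vec ℕ m} → Filling (bump h Λ) → Vec ℕ m
  firstColumn h       []      {[]}    []             = []
  firstColumn zero    (a ∷ A) {l ∷ Λ} (r ∷ T)       = a ∷ A
  firstColumn (suc h) (a ∷ A) {l ∷ Λ} ((b ∷ r) ∷ T) = b ∷ firstColumn h A T

  otherColumns : ∀ h {Λ : Vec ℕ m} → Filling (bump h Λ) → Filling Λ
  otherColumns h       {[]}    []             = []
  otherColumns zero    {l ∷ Λ} (r ∷ T)       = r ∷ T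
  otherColumns (suc h) {l ∷ Λ} ((b ∷ r) ∷ T) = r ∷ otherColumns h T

  prepend-firstColumn : ∀ h (A : Vec ℕ m) {Λ} (T : Filling (bump h Λ)) →
    prepend h (firstColumn h A T) (otherColumns h T) ≡ T
  prepend-firstColumn h       []      {[]}    []             = refl
  prepend-firstColumn zero    (a ∷ A) {l ∷ Λ} (r ∷ T)       = refl
  prepend-firstColumn (suc h) (a ∷ A) {l ∷ Λ} ((b ∷ r) ∷ T) = cong ((b ∷ r) ∷_) (prepend-firstColumn h A T)

  -- The rows below row h carry no boxes; there we keep the entries of the previous column.
  Frozen : ℕ → Vec ℕ m → Vec ℕ m → Set
  Frozen h A B = ∀ {i} → h ≤ i → at B i ≡ at A i

  firstColumn-frozen : ∀ h (A : Vec ℕ m) {Λ} (T : Filling (bump h Λ)) → Frozen h A (firstColumn h A T)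
  firstColumn-frozen h       []      {[]}    []             h≤i       = refl
  firstColumn-frozen zero    (a ∷ A) {l ∷ Λ} (r ∷ T)       h≤i       = refl
  firstColumn-frozen (suc h) (a ∷ A) {l ∷ Λ} ((b ∷ r) ∷ T) (s≤s h≤i) = firstColumn-frozen h A T h≤i

  firstColumn-prepend : ∀ h (A B : Vec ℕ m) {Λ} (T : Filling Λ) → Frozen h A B →
    firstColumn h A (prepend h B T) ≡ B
  firstColumn-prepend h       []      []      {[]}    []      fr = refl
  firstColumn-prepend zero    (a ∷ A) (b ∷ B) {l ∷ Λ} (r ∷ T) fr = at-ext λ i → sym (fr {i} z≤n)
  firstColumn-prepend (suc h) (a ∷ A) (b ∷ B) {l ∷ Λ} (r ∷ T) fr = cong (b ∷_) (firstColumn-prepend h A B T (fr ∘ s≤s))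

  otherColumns-prepend : ∀ h (B : Vec ℕ m) {Λ} (T : Filling Λ) → otherColumns h (prepend h B T) ≡ T
  otherColumns-prepend h       []      {[]}    []      = refl
  otherColumns-prepend zero    (b ∷ B) {l ∷ Λ} (r ∷ T) = refl
  otherColumns-prepend (suc h) (b ∷ B) {l ∷ Λ} (r ∷ T) = cong (r ∷_) (otherColumns-prepend h B T)

open Fillings

-- The transfer recurrence obtained by splitting off the first column.

module Transfer where
  open import Data.List.Base using (List; []; _∷_; [_]; filter; concat; map; upTo; cartesianProductWith)
  open import Data.List.Membership.Propositional using (_∈_)
  open import Data.List.Membership.Propositional.Properties
    using (∈-filter⁺; ∈-filter⁻; ∈-map⁺; ∈-map⁻; ∈-upTo⁺; ∈-concat⁺′; ∈-concat⁻′; ∈-cartesianProductWith⁺; ∈-cartesianProductWith⁻)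
  open import Data.List.Membership.Propositional.Properties.WithK using (unique∧set⇒bag)
  open import Data.List.Relation.Binary.BagAndSetEquality using (∼bag⇒↭)
  open import Data.List.Relation.Binary.Permutation.Propositional using (_↭_)
  open import Data.List.Relation.Unary.All as ListAll using ([]; _∷_)
  import Data.List.Relation.Unary.All.Properties as ListAll
  open import Data.List.Relation.Unary.AllPairs as AllPairs using ([]; _∷_)
  import Data.List.Relation.Unary.AllPairs.Properties as AllPairs
  open import Data.List.Relation.Unary.Any using (here; there)
  open import Data.List.Relation.Unary.Unique.Propositional using (Unique)
  import Data.List.Relation.Unary.Unique.Propositional.Properties as Unique
  open import Data.Nat.Base hiding (_+_; _*_; _^_)
  open import Data.Nat.Properties using (suc-injective; _≟_)
  open import Data.Product.Base using (_×_; _,_; proj₁; proj₂)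
  open import Data.Vec.Base as Vec using (Vec; []; _∷_)
  import Data.Vec.Properties as Vec
  open import Function.Base using (_∘_)
  open import Function.Bundles using (mk⇔; Equivalence)
  open import Relation.Binary.PropositionalEquality as ≡ using (_≡_; _≢_; cong; subst)
  open import Relation.Nullary using (yes; no; ¬?)
  open import Relation.Nullary.Decidable using (_×-dec_)

  boundedColumns : ℕ → Vec ℕ m → List (Vec ℕ m)
  boundedColumns h       []      = [ [] ]
  boundedColumns zero    (a ∷ A) = [ a ∷ A ]
  boundedColumns (suc h) (a ∷ A) = cartesianProductWith _∷_ (map suc (upTo a)) (boundedColumns h A)

  boundedColumns-unique : ∀ h (A : Vec ℕ m) → Unique (boundedColumns h A)
  boundedColumns-unique h       []      = [] ∷ []
  boundedColumns-unique zero    (a ∷ A) = [] ∷ []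
  boundedColumns-unique (suc h) (a ∷ A) = Unique.cartesianProductWith⁺ _∷_ Vec.∷-injective
    (Unique.map⁺ suc-injective (Unique.upTo⁺ a)) (boundedColumns-unique h A)

  ∈-boundedColumns⁺ : ∀ h (A B : Vec ℕ m) → (∀ {i} → i < h → 1 ≤ at B i) → (∀ {i} → i < h → at B i ≤ at A i) →
    Frozen h A B → B ∈ boundedColumns h A
  ∈-boundedColumns⁺ h       []      []      pos low frozen = here ≡.refl
  ∈-boundedColumns⁺ zero    (a ∷ A) B       pos low frozen = here (at-ext λ i → frozen {i} z≤n)
  ∈-boundedColumns⁺ (suc h) (a ∷ A) (zero ∷ B)  pos low frozen with () ← pos z<s
  ∈-boundedColumns⁺ (suc h) (a ∷ A) (suc b ∷ B) pos low frozen = ∈-cartesianProductWith⁺ _∷_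
    (∈-map⁺ suc (∈-upTo⁺ (low z<s))) (∈-boundedColumns⁺ h A B (pos ∘ s≤s) (low ∘ s≤s) (frozen ∘ s≤s))

  ∈-boundedColumns⁻ : ∀ h (A : Vec ℕ m) {B} → B ∈ boundedColumns h A → Frozen h A B
  ∈-boundedColumns⁻ h       []      (here ≡.refl) h≤i = ≡.refl
  ∈-boundedColumns⁻ zero    (a ∷ A) (here ≡.refl) h≤i = ≡.refl
  ∈-boundedColumns⁻ (suc h) (a ∷ A) B∈ (s≤s h≤i)
    with _ , _ , _ , B∈′ , ≡.refl ← ∈-cartesianProductWith⁻ _∷_ (map suc (upTo a)) (boundedColumns h A) B∈ =
    ∈-boundedColumns⁻ h A B∈′ h≤i

  properSuccessors : ℕ → Vec ℕ m → List (Vec ℕ m)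
  properSuccessors h A = filter (λ B → isNext? h (at A) (at B) ×-dec ¬? (Vec.≡-dec _≟_ B A)) (boundedColumns h A)

  ∈-properSuccessors : ∀ h (A : Vec ℕ m) {B} → B ∈ properSuccessors h A →
    IsNext h (at A) (at B) × Frozen h A B × B ≢ A
  ∈-properSuccessors h A B∈ =
    let B∈′ , next , B≢A = ∈-filter⁻ _ {xs = boundedColumns h A} B∈ in next , ∈-boundedColumns⁻ h A B∈′ , B≢A

  -- `A` heads the list: its term carries the eigenvalue, and the tail is the strict part in the
  -- sense of `triangular`.
  successors : ℕ → Vec ℕ m → List (Vec ℕ m)
  successors h A = A ∷ properSuccessors h A

  successors-unique : ∀ h (A : Vec ℕ m) → Unique (successors h A)
  successors-unique h A =
    ListAll.tabulate (λ B∈ A≡B → proj₂ (proj₂ (∈-properSuccessors h A B∈)) (≡.sym A≡B)) ∷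
    Unique.filter⁺ _ (boundedColumns-unique h A)

  ∈-successors⁺ : ∀ h (A : Vec ℕ m) {B} → IsNext h (at A) (at B) → Frozen h A B → B ∈ successors h A
  ∈-successors⁺ h A {B} next frozen with Vec.≡-dec _≟_ B A
  ... | yes B≡A = here B≡A
  ... | no B≢A  = there (∈-filter⁺ _
    (∈-boundedColumns⁺ h A B (positive next) (below next) frozen) (next , B≢A))

  ∈-successors⁻ : ∀ h (A : Vec ℕ m) {B} → IsColumn n h (at A) → B ∈ successors h A →
    IsNext h (at A) (at B) × Frozen h A B
  ∈-successors⁻ h A column (here ≡.refl) = isNext-refl column , λ _ → ≡.refl
  ∈-successors⁻ h A column (there B∈) = let next , frozen , _ = ∈-properSuccessors h A B∈ in next , frozen

  keyTableaux-bump : ∀ {h} (A {Λ} : Vec ℕ m) → h ≤ m → IsShape h Λ → IsColumn n h (at A) →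
    keyTableaux A (bump h Λ) ↭ concat (map (λ B → map (prepend h B) (keyTableaux B Λ)) (successors h A))
  keyTableaux-bump {h = h} A {Λ} h≤m sh column =
    ∼bag⇒↭ (unique∧set⇒bag (keyTableaux-unique A (bump h Λ)) unique (mk⇔ to from))
    where
    starting : Vec ℕ _ → List (Filling (bump h Λ))
    starting B = map (prepend h B) (keyTableaux B Λ)
    unique : Unique (concat (map starting (successors h A)))
    unique = Unique.concat⁺
      (ListAll.map⁺ (ListAll.tabulate λ {B} _ → Unique.map⁺
        (λ {T} {T′} eq → ≡.trans (≡.sym (otherColumns-prepend h B T))
          (≡.trans (cong (otherColumns h) eq) (otherColumns-prepend h B T′)))
        (keyTableaux-unique B Λ)))
      (AllPairs.map⁺ (allPairs (successors-unique h A) λ B∈ → proj₂ (∈-successors⁻ h A column B∈)))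
      where
      open import Data.List.Relation.Binary.Disjoint.Propositional using (Disjoint)
      disjoint : ∀ {B B′} → Frozen h A B → Frozen h A B′ → B ≢ B′ → Disjoint (starting B) (starting B′)
      disjoint {B} {B′} frozen frozen′ B≢B′ (S∈ , S∈′)
        with T , _ , ≡.refl ← ∈-map⁻ (prepend h B) S∈ | T′ , _ , eq ← ∈-map⁻ (prepend h B′) S∈′ =
        B≢B′ (≡.trans (≡.sym (firstColumn-prepend h A B T frozen))
          (≡.trans (cong (firstColumn h A) eq) (firstColumn-prepend h A B′ T′ frozen′)))
      allPairs : ∀ {Bs} → Unique Bs → (∀ {B} → B ∈ Bs → Frozen h A B) →
        AllPairs.AllPairs (λ B B′ → Disjoint (starting B) (starting B′)) Bs
      allPairs []        frozen = []
      allPairs {B ∷ Bs} (B∉ ∷ u) frozen =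
        ListAll.tabulate (λ {B′} B′∈ → disjoint {B} {B′} (frozen (here ≡.refl)) (frozen (there B′∈)) (ListAll.lookup B∉ B′∈)) ∷
        allPairs u (frozen ∘ there)
    to : ∀ {S} → S ∈ keyTableaux A (bump h Λ) → S ∈ concat (map starting (successors h A))
    to {S} S∈ = ∈-concat⁺′
      (subst (_∈ starting B) (prepend-firstColumn h A S)
        (∈-map⁺ (prepend h B) (Equivalence.from (∈-keyTableaux B Λ T) (isKey⇒isKeyTableau sh key))))
      (∈-map⁺ starting (∈-successors⁺ h A next (firstColumn-frozen h A S)))
      where
      B = firstColumn h A S
      T = otherColumns h S
      split : IsNext h (at A) (at B) × IsKey B T
      split = isKey-prepend⁻ h≤m sh (subst (IsKey A) (≡.sym (prepend-firstColumn h A S))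
        (isKeyTableau⇒isKey (isShape-bump h≤m sh) (Equivalence.to (∈-keyTableaux A (bump h Λ) S) S∈)))
      next = proj₁ split
      key = proj₂ split
    from : ∀ {S} → S ∈ concat (map starting (successors h A)) → S ∈ keyTableaux A (bump h Λ)
    from S∈ with ∈-concat⁻′ (map starting (successors h A)) S∈
    ... | _ , S∈′ , starting∈ with ∈-map⁻ starting starting∈
    ... | B , B∈ , ≡.refl with ∈-map⁻ (prepend h B) S∈′
    ... | T , T∈ , ≡.refl = Equivalence.from (∈-keyTableaux A (bump h Λ) _)
      (isKey⇒isKeyTableau (isShape-bump h≤m sh) (isKey-prepend⁺ h≤m sh (proj₁ (∈-successors⁻ h A column B∈))
        (isKeyTableau⇒isKey sh (Equivalence.to (∈-keyTableaux B Λ T) T∈))))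

  module _ {n : ℕ} where
    open CommutativeRing (polyRing n) hiding (zero)
    open ExponentialSums (polyRing n)
    open import Relation.Binary.Reasoning.Setoid setoid

    tableauSum : (β Λ : Vec ℕ m) → Poly n
    tableauSum β Λ = total (λ T → x^ weight n T) (keyTableaux β Λ)

    tableauSum-bump : ∀ {h} (A {Λ} : Vec ℕ m) → h ≤ m → IsShape h Λ → IsColumn n h (at A) →
      tableauSum A (bump h Λ) ≋
      total (λ B → x^ columnWeight n h (at B) ⊗ tableauSum B Λ) (successors h A)
    tableauSum-bump {h = h} A {Λ} h≤m sh column = begin
      tableauSum A (bump h Λ)
        ≈⟨ total-↭ weightMonomial (keyTableaux-bump A h≤m sh column) ⟩
      total weightMonomial (concat (map (λ B → map (prepend h B) (keyTableaux B Λ)) (successors h A)))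
        ≈⟨ total-concat weightMonomial (λ B → map (prepend h B) (keyTableaux B Λ)) (successors h A) ⟩
      total (λ B → total weightMonomial (map (prepend h B) (keyTableaux B Λ))) (successors h A)
        ≈⟨ total-cong (successors h A) (λ {B} _ → step B) ⟩
      total (λ B → x^ columnWeight n h (at B) ⊗ tableauSum B Λ) (successors h A) ∎
      where
      weightMonomial : ∀ {Λ : Vec ℕ _} → Filling Λ → Poly n
      weightMonomial T = x^ weight n T
      step : ∀ B → total weightMonomial (map (prepend h B) (keyTableaux B Λ)) ≋
                   x^ columnWeight n h (at B) ⊗ tableauSum B Λ
      step B = trans
        (reflexive (total-map weightMonomial (prepend h B) (keyTableaux B Λ)))
        (trans (total-cong (keyTableaux B Λ) λ {T} _ →
            reflexive (cong x^_ (weight-prepend n B T h≤m)))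
          (total-* (x^ columnWeight n h (at B)) weightMonomial (keyTableaux B Λ)))

open Transfer

-- Stretched shapes: the exponential expansion and the realisation of its exponents.

module Stretching where
  open import Data.List.Base as List using (List; []; _∷_; length; take)
  import Data.List.Properties as List
  open import Data.Nat.Base hiding (_^_)
  open import Data.Nat.Properties
  open import Data.Nat.Tactic.RingSolver renaming (solve-∀ to solveℕ-∀)
  open import Data.Product.Base using (_×_; _,_; proj₁; Σ-syntax; uncurry)
  open import Data.Vec.Base as Vec using (Vec; []; _∷_; replicate; toList)
  import Data.Vec.Properties as Vec
  open import Data.Vec.Relation.Unary.All using ([]; _∷_)
  open import Data.Fin.Base using (toℕ)
  open import Function.Base using (_∘_)
  open import Relation.Binary.PropositionalEquality as ≡ using (_≡_; refl; cong; cong₂; subst; subst₂; sym; trans)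
  open import Relation.Nullary using (yes; no; contradiction)

  bumps : ℕ → ℕ → Vec ℕ m → Vec ℕ m
  bumps zero    h Λ = Λ
  bumps (suc N) h Λ = bump h (bumps N h Λ)

  at-bumps-< : ∀ N {h} (Λ : Vec ℕ m) {i} → h ≤ m → i < h → at (bumps N h Λ) i ≡ N + at Λ i
  at-bumps-< zero    Λ h≤m i<h = refl
  at-bumps-< (suc N) Λ h≤m i<h = trans (at-bump-< (bumps N _ Λ) h≤m i<h) (cong suc (at-bumps-< N Λ h≤m i<h))

  at-bumps-≥ : ∀ N {h} (Λ : Vec ℕ m) {i} → h ≤ i → at (bumps N h Λ) i ≡ at Λ i
  at-bumps-≥ zero    Λ h≤i = refl
  at-bumps-≥ (suc N) Λ h≤i = trans (at-bump-≥ (bumps N _ Λ) h≤i) (at-bumps-≥ N Λ h≤i)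

  isShape-bumps : ∀ N {h} {Λ : Vec ℕ m} → h ≤ m → IsShape h Λ → IsShape h (bumps N h Λ)
  isShape-bumps zero    h≤m sh = sh
  isShape-bumps (suc N) h≤m sh = isShape-bump h≤m (isShape-bumps N h≤m sh)

  isShape-suc : ∀ {h} {Λ : Vec ℕ m} → IsShape h Λ → IsShape (suc h) Λ
  isShape-suc (isShape sh em) = isShape sh λ h<i → em (<⇒≤ h<i)

  ·-+ᵥ : ∀ k (u v : Vec ℕ n) → k · (u +ᵥ v) ≡ k · u +ᵥ k · v
  ·-+ᵥ k []      []      = refl
  ·-+ᵥ k (x ∷ u) (y ∷ v) = cong₂ _∷_ (*-distribˡ-+ k x y) (·-+ᵥ k u v)

  ·-· : ∀ k l (u : Vec ℕ n) → k · (l · u) ≡ (k * l) · u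
  ·-· k l []      = refl
  ·-· k l (x ∷ u) = cong₂ _∷_ (sym (*-assoc k l x)) (·-· k l u)

  suc-· : ∀ k (u : Vec ℕ n) → suc k · u ≡ u +ᵥ k · u
  suc-· k []      = refl
  suc-· k (x ∷ u) = cong (x + k * x ∷_) (suc-· k u)

  0-· : ∀ (u : Vec ℕ n) → 0 · u ≡ replicate n 0
  0-· []      = refl
  0-· (x ∷ u) = cong (0 ∷_) (0-· u)

  -- Here `j` and `j′` range over all of ℕ; columns beyond the width are empty and agree, and
  -- prepending a column requires no computation of widths.
  EqualLengthColumnsAgree : {Λ : Vec ℕ m} → Filling Λ → Set
  EqualLengthColumnsAgree T = ∀ j j′ → length (column T j) ≡ length (column T j′) → column T j ≡ column T j′

  HeightFilled : ℕ → List ℕ → {Λ : Vec ℕ m} → Filling Λ → Set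
  HeightFilled h c T = ∀ j → length (column T j) ≡ h → column T j ≡ c

  length-take-toList : ∀ {h} (B : Vec ℕ m) → h ≤ m → length (take h (toList B)) ≡ h
  length-take-toList {h = h} B h≤m = trans (List.length-take h (toList B))
    (trans (cong (h ⊓_) (Vec.length-toList B)) (m≤n⇒m⊓n≡m h≤m))

  agree-prepend : ∀ {h} (B : Vec ℕ m) {Λ} (T : Filling Λ) → h ≤ m → IsShape h Λ →
    EqualLengthColumnsAgree T → HeightFilled h (take h (toList B)) T →
    EqualLengthColumnsAgree (prepend h B T) × HeightFilled h (take h (toList B)) (prepend h B T)
  agree-prepend {h = h} B T h≤m sh agree filled = agree′ , filled′
    where
    first : column (prepend h B T) 0 ≡ take h (toList B)
    first = column-prepend-zero B T (empty sh)
    later : ∀ j → column (prepend h B T) (suc j) ≡ column T j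
    later = column-prepend-suc B T (empty sh)
    filled′ : HeightFilled h (take h (toList B)) (prepend h B T)
    filled′ zero    _  = first
    filled′ (suc j) eq = trans (later j) (filled j (trans (sym (cong length (later j))) eq))
    length-first : length (column (prepend h B T) 0) ≡ h
    length-first = trans (cong length first) (length-take-toList B h≤m)
    agree′ : EqualLengthColumnsAgree (prepend h B T)
    agree′ zero    j′       eq = trans first (sym (filled′ j′ (trans (sym eq) length-first)))
    agree′ (suc j) zero     eq = trans (filled′ (suc j) (trans eq length-first)) (sym first)
    agree′ (suc j) (suc j′) eq = trans (later j)
      (trans (agree j j′ (trans (sym (cong length (later j))) (trans eq (cong length (later j′))))) (sym (later j′)))

  emptyFilling : (Λ : Vec ℕ m) → (∀ i → at Λ i ≡ 0) → Filling Λ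
  emptyFilling []         empty = []
  emptyFilling (zero ∷ Λ) empty = [] ∷ emptyFilling Λ (empty ∘ suc)
  emptyFilling (suc l ∷ Λ) empty with () ← empty 0

  contents-empty : {Λ : Vec ℕ m} (T : Filling Λ) → (∀ i → at Λ i ≡ 0) → contents T ≡ []
  contents-empty {Λ = []}        []       empty = refl
  contents-empty {Λ = zero ∷ Λ}  ([] ∷ T) empty = contents-empty T (empty ∘ suc)
  contents-empty {Λ = suc l ∷ Λ} (r ∷ T)  empty with () ← empty 0

  splice : ℕ → (ℕ → ℕ) → Vec ℕ m → Vec ℕ m
  splice h       c []      = []
  splice zero    c (a ∷ A) = a ∷ A
  splice (suc h) c (a ∷ A) = c 0 ∷ splice h (c ∘ suc) A

  at-splice : ∀ {h} c (A : Vec ℕ m) → h ≤ m → ∀ {i} → i < h → at (splice h c A) i ≡ c i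
  at-splice {h = suc h} c (a ∷ A) h≤m       {zero}  i<h       = refl
  at-splice {h = suc h} c (a ∷ A) (s≤s h≤m) {suc i} (s≤s i<h) = at-splice (c ∘ suc) A h≤m i<h

  isNext-cong : ∀ {h a b b′} → (∀ {i} → i < h → b′ i ≡ b i) → IsNext h a b → IsNext h a b′
  isNext-cong {a = a} eq (isNext pos low noT) = isNext
    (λ i<h → subst (1 ≤_) (sym (eq i<h)) (pos i<h))
    (λ {i} i<h → subst (_≤ a i) (sym (eq i<h)) (low i<h))
    (λ i′<h i<i′ b≤a → subst₂ _<_ (sym (eq i′<h)) (sym (eq (<-trans i<i′ i′<h)))
      (noT i′<h i<i′ (subst (_≤ a _) (eq i′<h) b≤a)))

  atLeast-cong : ∀ h v {a b} → (∀ {i} → i < h → a i ≡ b i) → atLeast h v a ≡ atLeast h v b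
  atLeast-cong h v eq = sumTo-cong h λ i<h → cong (λ x → [ v ≤? x ]ᵢ) (eq i<h)

  -- The k-fold stretching of a partition Λ is built up in stages: for every h, the columns of
  -- k Λ of height at most h form the shape k · stage h, and to pass from k · stage h to
  -- k · stage (suc h) one prepends k · multiplicity h columns of height suc h.
  module Stages {m : ℕ} (Λ : Vec ℕ m) (sorted : ∀ {i i′} → i ≤ i′ → at Λ i′ ≤ at Λ i) (n : ℕ) where

    -- The first `at Λ h` columns are those that reach row `h`, counted from 0, that is, those of
    -- height more than `h`.
    stage : ℕ → Vec ℕ m
    stage h = Vec.map (_∸ at Λ h) Λ

    multiplicity : ℕ → ℕ
    multiplicity h = at Λ h ∸ at Λ (suc h)

    at-stage : ∀ k h i → at (k · stage h) i ≡ k * (at Λ i ∸ at Λ h)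
    at-stage k h i = trans (at-map (*-zeroʳ k) (stage h) i) (cong (k *_) (at-map (0∸n≡0 (at Λ h)) Λ i))

    isShape-stage : ∀ k h → IsShape h (k · stage h)
    isShape-stage k h = isShape
      (λ {i} {i′} i≤i′ → subst₂ _≤_ (sym (at-stage k h i′)) (sym (at-stage k h i))
        (*-monoʳ-≤ k (∸-monoˡ-≤ (at Λ h) (sorted i≤i′))))
      (λ {i} h≤i → trans (at-stage k h i) (trans (cong (k *_) (m≤n⇒m∸n≡0 (sorted h≤i))) (*-zeroʳ k)))

    bumps-stage : ∀ k h → suc h ≤ m → bumps (k * multiplicity h) (suc h) (k · stage h) ≡ k · stage (suc h)
    bumps-stage k h h<m = at-ext λ i → trans (lemma i) (sym (at-stage k (suc h) i))
      where
      open ≡.≡-Reasoning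
      lemma : ∀ i → at (bumps (k * multiplicity h) (suc h) (k · stage h)) i ≡ k * (at Λ i ∸ at Λ (suc h))
      lemma i with i <? suc h
      ... | yes i<1+h = begin
        at (bumps (k * multiplicity h) (suc h) (k · stage h)) i  ≡⟨ at-bumps-< (k * multiplicity h) (k · stage h) h<m i<1+h ⟩
        k * multiplicity h + at (k · stage h) i                  ≡⟨ cong (k * multiplicity h +_) (at-stage k h i) ⟩
        k * multiplicity h + k * (at Λ i ∸ at Λ h)               ≡⟨ *-distribˡ-+ k (multiplicity h) _ ⟨
        k * (multiplicity h + (at Λ i ∸ at Λ h))                 ≡⟨ cong (k *_) (+-comm (multiplicity h) _) ⟩
        k * (at Λ i ∸ at Λ h + (at Λ h ∸ at Λ (suc h)))          ≡⟨ cong (k *_) (+-∸-assoc (at Λ i ∸ at Λ h) (sorted (n≤1+n h))) ⟨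
        k * (at Λ i ∸ at Λ h + at Λ h ∸ at Λ (suc h))            ≡⟨ cong (λ x → k * (x ∸ at Λ (suc h))) (m∸n+n≡m (sorted (s≤s⁻¹ i<1+h))) ⟩
        k * (at Λ i ∸ at Λ (suc h))                              ∎
      ... | no i≮1+h = begin
        at (bumps (k * multiplicity h) (suc h) (k · stage h)) i  ≡⟨ at-bumps-≥ (k * multiplicity h) (k · stage h) (≮⇒≥ i≮1+h) ⟩
        at (k · stage h) i                                       ≡⟨ empty (isShape-stage k h) (<⇒≤ (≮⇒≥ i≮1+h)) ⟩
        0                                                        ≡⟨ *-zeroʳ k ⟨
        k * 0                                                    ≡⟨ cong (k *_) (m≤n⇒m∸n≡0 (sorted (≮⇒≥ i≮1+h))) ⟨
        k * (at Λ i ∸ at Λ (suc h))                              ∎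

    -- Row `m` lies beyond `Λ`, where `at` takes its default value 0, so nothing is cut off.
    stage-m : ∀ k → k · stage m ≡ k · Λ
    stage-m k = at-ext λ i → trans (at-stage k m i)
      (trans (cong (λ x → k * (at Λ i ∸ x)) (at-beyond Λ ≤-refl)) (sym (at-map (*-zeroʳ k) Λ i)))

    stage-0 : ∀ k → k · stage 0 ≡ replicate m 0
    stage-0 k = at-ext λ i → trans (empty (isShape-stage k 0) z≤n) (sym (at-replicate m i))

    -- The weights of the sequences of columns of heights h, h - 1, …, 1, each dominated by
    -- its predecessor, where the column of height suc i is used multiplicity i times.
    data Chain : ℕ → Vec ℕ m → Vec ℕ n → Set where
      []  : ∀ {A} → Chain 0 A (replicate n 0)
      _▷_ : ∀ {h A C w} → IsColumn n (suc h) (at C) × Dominates (suc h) (at A) (at C) → Chain h C w →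
            Chain (suc h) A (multiplicity h · columnWeight n (suc h) (at C) +ᵥ w)

    chain-dominates : ∀ {h A B w} → Dominates h (at A) (at B) → Chain h B w → Chain h A w
    chain-dominates A⊵B []                       = []
    chain-dominates A⊵B ((column , B⊵C) ▷ chain) = (column , dominates-trans A⊵B B⊵C) ▷ chain

    private module Poly = CommutativeRing (polyRing n)
    open Poly using (setoid)
    open ExponentialSums (polyRing n)
    open import Algebra.Properties.CommutativeSemiring.Exp Poly.commutativeSemiring using (_^_)
    open import Algebra.Properties.Ring Poly.ring using (-1*x≈-x; x∙y⁻¹≈ε⇒x≈y)

    binomial-regular′ : ∀ (u v : Vec ℕ n) → energy u < energy v → Regular (x^ u ⊕ ⊖ 𝟙 ⊗ x^ v)
    binomial-regular′ u v u<v {p} eq = binomial-regular u v u<v (x∙y⁻¹≈ε⇒x≈y _ _ (begin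
      x^ u ⊗ p ⊕ ⊖ (x^ v ⊗ p)              ≈⟨ Poly.+-congˡ {x^ u ⊗ p} (-1*x≈-x (x^ v ⊗ p)) ⟨
      x^ u ⊗ p ⊕ ⊖ 𝟙 ⊗ (x^ v ⊗ p)          ≈⟨ Poly.+-congˡ {x^ u ⊗ p} (Poly.*-assoc (⊖ 𝟙) (x^ v) p) ⟨
      x^ u ⊗ p ⊕ ⊖ 𝟙 ⊗ x^ v ⊗ p            ≈⟨ Poly.distribʳ p (x^ u) (⊖ 𝟙 ⊗ x^ v) ⟨
      (x^ u ⊕ ⊖ 𝟙 ⊗ x^ v) ⊗ p              ≈⟨ eq ⟩
      𝟘                                      ∎))
      where open import Relation.Binary.Reasoning.Setoid setoid

    x^-^ : ∀ (u : Vec ℕ n) k → (x^ u) ^ k ≋ x^ (k · u)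
    x^-^ u zero    = Poly.reflexive (cong x^_ (sym (0-· u)))
    x^-^ u (suc k) = Poly.trans (Poly.*-congˡ {x^ u} (x^-^ u k)) (Poly.reflexive (cong x^_ (sym (suc-· k u))))

    χ₂-diagonal : ∀ d (u w : Vec ℕ n) k → 𝟙 ⊗ χ₂ x^_ (u , w) (k * d , k) ≋ χ₁ x^_ (d · u +ᵥ w) k
    χ₂-diagonal d u w k = begin
      𝟙 ⊗ ((x^ u) ^ (k * d) ⊗ (x^ w) ^ k)  ≈⟨ Poly.*-identityˡ _ ⟩
      (x^ u) ^ (k * d) ⊗ (x^ w) ^ k        ≈⟨ Poly.*-cong (x^-^ u (k * d)) (x^-^ w k) ⟩
      x^ ((k * d) · u +ᵥ k · w)            ≡⟨ cong (λ v → x^ (v +ᵥ k · w)) (·-· k d u) ⟨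
      x^ (k · (d · u) +ᵥ k · w)            ≡⟨ cong x^_ (·-+ᵥ k (d · u) w) ⟨
      x^ (k · (d · u +ᵥ w))                ≈⟨ x^-^ (d · u +ᵥ w) k ⟨
      (x^ (d · u +ᵥ w)) ^ k                ∎
      where open import Relation.Binary.Reasoning.Setoid setoid

    -- Induction over the stages. With N columns of height `suc h` in front of k · stage h, the
    -- transfer recurrence in N is a triangular system whose initial values at N = 0 are the sums of
    -- the previous stage; the diagonal N = k * multiplicity h is the next stage.
    chain-exponential : ∀ h → h ≤ m → ∀ {A} → IsColumn n h (at A) →
      Exponential (χ₁ x^_) (Chain h A) (λ k → tableauSum A (k · stage h))
    chain-exponential zero h≤m {A} column =
      -- Without columns the sum does not depend on k: it is geometric with ratio the monomial 1,
      -- the weight of the empty chain.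
      respect constant (exponential-term (tableauSum A (replicate m 0)) [])
      where
      constant : ∀ k → tableauSum A (replicate m 0) ⊗ (x^ replicate n 0) ^ k ≋ tableauSum A (k · stage 0)
      constant k = Poly.trans (Poly.*-congˡ {tableauSum A (replicate m 0)} (Poly.trans (x^-^ (replicate n 0) k)
          (Poly.reflexive (cong x^_ (trans (Vec.map-replicate (k *_) 0 n) (cong (replicate n) (*-zeroʳ k)))))))
        (Poly.trans (Poly.*-identityʳ _) (Poly.reflexive (cong (tableauSum A) (sym (stage-0 k)))))
    chain-exponential (suc h) h<m {A} column = respect
      (λ k → Poly.trans (Poly.*-identityˡ (f A (k * multiplicity h) k)) (Poly.reflexive (cong (tableauSum A) (bumps-stage k h h<m))))
      (reindex {F = uncurry (f A)} (λ k → k * multiplicity h , k) (λ (u , w) → multiplicity h · u +ᵥ w) (λ _ → 𝟙)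
        (λ (u , w) k → χ₂-diagonal (multiplicity h) u w k)
        (λ { (C , column , A⊵C , refl , chain) → (column , A⊵C) ▷ chain })
        (triangular x^_ (λ B → IsColumn n (suc h) (at B)) weightOf (properSuccessors (suc h)) (energy ∘ weightOf)
          (λ B C → Dominates (suc h) (at B) (at C)) (Chain h)
          f (λ B k → tableauSum B (k · stage h))
          dominates-refl dominates-trans
          (λ A⊵B → chain-dominates (dominates-≤ (n≤1+n h) A⊵B))
          (λ {B} column C∈ → let next , frozen , C≢B = ∈-properSuccessors (suc h) B C∈ in
            isNext⇒isColumn column next , isNext⇒dominates next , energy-decreases column next frozen C≢B)
          (λ C<B _ _ → binomial-regular′ _ _ C<B)
          (λ column → chain-exponential h (<⇒≤ h<m) (isColumn-≤ (n≤1+n h) column))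
          (λ _ k → Poly.refl)
          (λ {B} column N k → tableauSum-bump B h<m
            (isShape-bumps N h<m (isShape-suc (isShape-stage k h))) column)
          {A} column))
      where
      weightOf : Vec ℕ m → Vec ℕ n
      weightOf B = columnWeight n (suc h) (at B)
      f : Vec ℕ m → ℕ → ℕ → Poly n
      f B N k = tableauSum B (bumps N (suc h) (k · stage h))

    Realised : Vec ℕ m → Vec ℕ n → Vec ℕ m → Set
    Realised A w Λ′ = Σ[ T ∈ Filling Λ′ ] IsKey A T × weight n T ≡ w × EqualLengthColumnsAgree T

    -- Only the leftmost copy of `C` has to be a right neighbour of `A`. Each of the other `d`
    -- copies follows an equal column, which is allowed because the entries of a column are
    -- distinct.
    realise-bumps : ∀ {h A C w Λ′} → suc h ≤ m → IsColumn n (suc h) (at C) → IsNext (suc h) (at A) (at C) →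
      IsShape h Λ′ → Realised C w Λ′ → ∀ d →
      Realised A (suc d · columnWeight n (suc h) (at C) +ᵥ w) (bumps (suc d) (suc h) Λ′)
    realise-bumps {h} {A} {C} {w} {Λ′} h<m column next sh (T , key , weight≡ , agree) d =
      let T′ , key′ , weight≡′ , agree′ , filled = repeated d in
      prepend (suc h) C T′ , isKey-prepend⁺ h<m (sh-bumps d) next key′ ,
      trans (weight-prepend n C T′ h<m) (trans (cong (u +ᵥ_) weight≡′) (suc-weight d)) ,
      proj₁ (agree-prepend C T′ h<m (sh-bumps d) agree′ filled)
      where
      u = columnWeight n (suc h) (at C)
      sh-bumps : ∀ d → IsShape (suc h) (bumps d (suc h) Λ′)
      sh-bumps d = isShape-bumps d h<m (isShape-suc sh)
      suc-weight : ∀ d → u +ᵥ (d · u +ᵥ w) ≡ suc d · u +ᵥ w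
      suc-weight d = trans (sym (+ᵥ-assoc u (d · u) w)) (cong (_+ᵥ w) (sym (suc-· d u)))
      repeated : ∀ d → Σ[ T ∈ Filling (bumps d (suc h) Λ′) ]
        IsKey C T × weight n T ≡ d · u +ᵥ w × EqualLengthColumnsAgree T ×
        HeightFilled (suc h) (take (suc h) (toList C)) T
      repeated zero = T , key ,
        trans weight≡ (sym (trans (cong (_+ᵥ w) (0-· u)) (+ᵥ-identityˡ w))) , agree ,
        -- `T` has at most `h` nonempty rows, hence no column of height `suc h`, and the invariant
        -- holds vacuously.
        λ j eq → contradiction (≤-trans (≤-reflexive (sym eq)) (length-column T (empty sh) j)) 1+n≰n
      repeated (suc d) =
        let T′ , key′ , weight≡′ , agree′ , filled = repeated d
            agree″ , filled′ = agree-prepend C T′ h<m (sh-bumps d) agree′ filled in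
        prepend (suc h) C T′ , isKey-prepend⁺ h<m (sh-bumps d) (isNext-refl column) key′ ,
        trans (weight-prepend n C T′ h<m) (trans (cong (u +ᵥ_) weight≡′) (suc-weight d)) ,
        agree″ , filled′

    bumps-multiplicity : ∀ {h d} → suc h ≤ m → multiplicity h ≡ d →
      bumps d (suc h) (1 · stage h) ≡ 1 · stage (suc h)
    bumps-multiplicity {h} h<m refl =
      trans (cong (λ N → bumps N (suc h) (1 · stage h)) (sym (*-identityˡ (multiplicity h)))) (bumps-stage 1 h h<m)

    realise : ∀ h → h ≤ m → ∀ {A w} → IsColumn n h (at A) → Chain h A w → Realised A w (1 · stage h)
    realise zero h≤m column [] = T ,
      isKey (λ j< → contradiction (row<h sh j<) n≮0) (λ j< → contradiction (row<h sh j<) n≮0)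
        (λ {i} {i′} i<i′ j< → contradiction (row<h sh {i′} j<) n≮0) ,
      trans (Vec.tabulate-cong λ i → cong (λ xs → length (List.filter (_≟ suc (toℕ i)) xs)) (contents-empty T no-boxes))
        (tabulate-0 n) ,
      λ j j′ _ → trans (column-empty T no-boxes j) (sym (column-empty T no-boxes j′))
      where
      sh = isShape-stage 1 0
      no-boxes : ∀ i → at (1 · stage 0) i ≡ 0
      no-boxes i = empty sh z≤n
      T = emptyFilling (1 · stage 0) no-boxes
    realise (suc h) h<m {A} column (_▷_ {C = C} {w} (columnC , A⊵C) chain) with multiplicity h in eq
    -- The height `suc h` does not occur in the shape. The link `C` contributes weight 0 and is
    -- removed by transitivity: the rest of the chain starts at `A`.
    ... | zero =
      let T , key , weight≡ , agree = realise h (<⇒≤ h<m) (isColumn-≤ (n≤1+n h) column)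
                                        (chain-dominates (dominates-≤ (n≤1+n h) A⊵C) chain)
      in subst (Realised A _) (bumps-multiplicity h<m eq)
        (T , key , trans weight≡ (sym (trans (cong (_+ᵥ w) (0-· _)) (+ᵥ-identityˡ w))) , agree)
    ... | suc d with rearrange columnC A⊵C
    -- Since the rearranged column still dominates `C`, the rest of the chain may be attached to it,
    -- and the recursion continues from there.
    ...   | c′ , next , c′⊵C , content = subst (Realised A _) (bumps-multiplicity h<m eq)
      (subst (λ u → Realised A (suc d · u +ᵥ w) (bumps (suc d) (suc h) (1 · stage h)))
        (columnWeight-content n (suc h) λ v → trans (atLeast-cong (suc h) v agrees) (content v))
        (realise-bumps {C = C′} h<m columnC′ next′ (isShape-stage 1 h)
          (realise h (<⇒≤ h<m) (isColumn-≤ (n≤1+n h) columnC′)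
            (chain-dominates (dominates-≤ (n≤1+n h) C′⊵C) chain)) d))
      where
      C′ = splice (suc h) c′ A
      agrees : ∀ {i} → i < suc h → at C′ i ≡ c′ i
      agrees = at-splice c′ A h<m
      next′ : IsNext (suc h) (at A) (at C′)
      next′ = isNext-cong agrees next
      columnC′ : IsColumn n (suc h) (at C′)
      columnC′ = isNext⇒isColumn column next′
      C′⊵C : Dominates (suc h) (at C′) (at C)
      C′⊵C p≤h v = ≤-trans (c′⊵C p≤h v)
        (≤-reflexive (sym (atLeast-cong _ v λ i<p → agrees (<-≤-trans i<p p≤h))))

open Stretching

-- From compositions to sorted basements and shapes, and the final assembly.

module Rows where
  open import Data.Bool.Base using (if_then_else_)
  open import Data.Bool.Properties using (if-float; if-cong; if-cong-else)
  open import Data.Fin.Base using (toℕ)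
  open import Data.List.Base as List using (List; []; _∷_; length; map; filter; foldr; zip; downFrom)
  import Data.List.Properties as List
  open import Data.List.Membership.Propositional using (_∈_)
  open import Data.List.Membership.Propositional.Properties using (∈-map⁺; ∈-filter⁺; ∈-deduplicate⁺; ∈-downFrom⁻)
  open import Data.List.Relation.Unary.All as ListAll using (All; []; _∷_)
  import Data.List.Relation.Unary.All.Properties as ListAll
  open import Data.List.Relation.Unary.AllPairs as AllPairs using (AllPairs; []; _∷_)
  import Data.List.Relation.Unary.AllPairs.Properties as AllPairs
  open import Data.List.Relation.Unary.Unique.Propositional using (Unique)
  import Data.List.Relation.Unary.Unique.Propositional.Properties as Unique
  open import Data.Nat.Base
  open import Data.Nat.Properties
  open import Data.Product.Base using (_×_; _,_; proj₁; proj₂; map₂)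
  open import Data.Vec.Base as Vec using (Vec; []; _∷_; toList; fromList)
  import Data.Vec.Properties as Vec
  open import Function.Base using (_∘_; id)
  open import Function.Bundles using (mk⇔; Equivalence)
  open import Relation.Binary.Definitions using (Symmetric)
  open import Relation.Binary.PropositionalEquality using (_≡_; _≢_; refl; cong; cong₂; subst; sym; trans; ≢-sym)
  open import Relation.Nullary using (Dec; does; yes; no; ¬_; ¬?; contradiction)
  open import Relation.Nullary.Decidable using (does-⇔)

  if-does-elim : {A Q : Set} (P : A → Set) (Q? : Dec Q) {x y : A} →
                 (Q → P x) → (¬ Q → P y) → P (if does Q? then x else y)
  if-does-elim P (yes q) then else = then q
  if-does-elim P (no ¬q) then else = else ¬q

  All-insertRow : ∀ {P : ℕ × ℕ → Set} {r} rs → P r → All P rs → All P (insertRow r rs)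
  All-insertRow         []       p []       = p ∷ []
  All-insertRow {P} {r} (x ∷ rs) p (q ∷ qs) = if-does-elim (All P) (proj₂ x ≤? proj₂ r)
    (λ _ → p ∷ q ∷ qs) (λ _ → q ∷ All-insertRow rs p qs)

  -- Symmetry of `R` compensates for the change of order: the inserted row may end up behind rows
  -- that it preceded.
  AllPairs-insertRow : ∀ {R : ℕ × ℕ → ℕ × ℕ → Set} → Symmetric R → ∀ {r} rs →
    All (R r) rs → AllPairs R rs → AllPairs R (insertRow r rs)
  AllPairs-insertRow         R-sym     []       []       []        = [] ∷ []
  AllPairs-insertRow {R = R} R-sym {r} (x ∷ rs) (p ∷ ps) (qs ∷ qss) = if-does-elim (AllPairs R) (proj₂ x ≤? proj₂ r)
    (λ _ → (p ∷ ps) ∷ qs ∷ qss) (λ _ → All-insertRow rs (R-sym p) qs ∷ AllPairs-insertRow R-sym rs ps qss)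

  Longer : ℕ × ℕ → ℕ × ℕ → Set
  Longer r r′ = proj₂ r′ ≤ proj₂ r

  sorted-insertRow : ∀ r rs → AllPairs Longer rs → AllPairs Longer (insertRow r rs)
  sorted-insertRow r []       []         = [] ∷ []
  sorted-insertRow r (x ∷ rs) (qs ∷ qss) = if-does-elim (AllPairs Longer) (proj₂ x ≤? proj₂ r)
    (λ x≤r → (x≤r ∷ ListAll.map (λ q → ≤-trans q x≤r) qs) ∷ qs ∷ qss)
    (λ x≰r → All-insertRow rs (≰⇒≥ x≰r) qs ∷ sorted-insertRow r rs qss)

  All-sort : ∀ {P : ℕ × ℕ → Set} rs → All P rs → All P (foldr insertRow [] rs)
  All-sort []       []       = []
  All-sort (r ∷ rs) (p ∷ ps) = All-insertRow (foldr insertRow [] rs) p (All-sort rs ps)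

  AllPairs-sort : ∀ {R : ℕ × ℕ → ℕ × ℕ → Set} → Symmetric R → ∀ rs →
    AllPairs R rs → AllPairs R (foldr insertRow [] rs)
  AllPairs-sort R-sym []       []         = []
  AllPairs-sort R-sym (r ∷ rs) (ps ∷ pss) =
    AllPairs-insertRow R-sym (foldr insertRow [] rs) (All-sort rs ps) (AllPairs-sort R-sym rs pss)

  sorted-sort : ∀ rs → AllPairs Longer (foldr insertRow [] rs)
  sorted-sort []       = []
  sorted-sort (r ∷ rs) = sorted-insertRow r (foldr insertRow [] rs) (sorted-sort rs)

  All-zip : {P : ℕ → Set} {xs : List ℕ} (ys : List ℕ) → All P xs → All (P ∘ proj₁) (zip xs ys)
  All-zip ys       []       = []
  All-zip []       (p ∷ ps) = []
  All-zip (y ∷ ys) (p ∷ ps) = p ∷ All-zip ys ps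

  AllPairs-zip : {R : ℕ → ℕ → Set} {xs : List ℕ} (ys : List ℕ) → AllPairs R xs →
    AllPairs (λ r r′ → R (proj₁ r) (proj₁ r′)) (zip xs ys)
  AllPairs-zip ys       []         = []
  AllPairs-zip []       (ps ∷ pss) = []
  AllPairs-zip (y ∷ ys) (ps ∷ pss) = All-zip ys ps ∷ AllPairs-zip ys pss

  module _ (α : Vec ℕ n) where

    rows-sorted : AllPairs Longer (rows α)
    rows-sorted = sorted-sort (filter (λ r → ¬? (proj₂ r ≟ 0)) (labelledRows α))

    labels-bounded : All (λ r → 1 ≤ proj₁ r × proj₁ r ≤ n) (rows α)
    labels-bounded = All-sort (filter (λ r → ¬? (proj₂ r ≟ 0)) (labelledRows α)) (ListAll.filter⁺ _
      (All-zip (toList α) (ListAll.map⁺ (ListAll.tabulate λ i∈ → s≤s z≤n , ∈-downFrom⁻ i∈))))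

    labels-distinct : AllPairs (λ r r′ → proj₁ r ≢ proj₁ r′) (rows α)
    labels-distinct = AllPairs-sort ≢-sym (filter (λ r → ¬? (proj₂ r ≟ 0)) (labelledRows α)) (AllPairs.filter⁺ _
      (AllPairs-zip (toList α) (Unique.map⁺ suc-injective (Unique.downFrom⁺ n))))

  All-at : ∀ {P : ℕ → Set} {rs : List (ℕ × ℕ)} {f : ℕ × ℕ → ℕ} → All (P ∘ f) rs →
    ∀ {i} → i < length rs → P (at (Vec.map f (fromList rs)) i)
  All-at (p ∷ ps) {zero}  i<        = p
  All-at {P} (p ∷ ps) {suc i} (s≤s i<) = All-at {P} ps i<

  distinct-at : ∀ {rs : List (ℕ × ℕ)} → AllPairs (λ r r′ → proj₁ r ≢ proj₁ r′) rs →
    Distinct (length rs) (at (Vec.map proj₁ (fromList rs)))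
  distinct-at (ps ∷ pss) {zero}  {zero}  i<       j<       eq = refl
  distinct-at (ps ∷ pss) {zero}  {suc j} i<       (s≤s j<) eq = contradiction eq (All-at {P = _ ≢_} ps j<)
  distinct-at (ps ∷ pss) {suc i} {zero}  (s≤s i<) j<       eq = contradiction (sym eq) (All-at {P = _ ≢_} ps i<)
  distinct-at (ps ∷ pss) {suc i} {suc j} (s≤s i<) (s≤s j<) eq = cong suc (distinct-at pss i< j< eq)

  sorted-at : ∀ {rs : List (ℕ × ℕ)} → AllPairs Longer rs → ∀ {i i′} → i ≤ i′ →
    at (Vec.map proj₂ (fromList rs)) i′ ≤ at (Vec.map proj₂ (fromList rs)) i
  sorted-at []                                              i≤i′       = z≤n
  sorted-at (ps ∷ pss)                {zero}  {zero}        i≤i′       = ≤-refl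
  sorted-at {r ∷ rs} (ps ∷ pss) {zero}  {suc i′}      i≤i′ with i′ <? length rs
  ... | yes i′< = All-at {P = _≤ proj₂ r} ps i′<
  ... | no i′≮  = subst (_≤ proj₂ r) (sym (at-beyond (Vec.map proj₂ (fromList rs)) (≮⇒≥ i′≮))) z≤n
  sorted-at (ps ∷ pss)                {suc i} {suc i′} (s≤s i≤i′)      = sorted-at pss i≤i′

  module _ (k : ℕ) where

    -- The factor `suc k` is positive, so that comparisons of row lengths are reflected and no
    -- nonempty row becomes empty.
    stretchRow : ℕ × ℕ → ℕ × ℕ
    stretchRow = map₂ (suc k *_)

    insertRow-stretch : ∀ r rs → insertRow (stretchRow r) (map stretchRow rs) ≡ map stretchRow (insertRow r rs)
    insertRow-stretch r       []       = refl
    insertRow-stretch (b , l) (x ∷ rs) = trans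
      (if-cong (does-⇔ (mk⇔ (*-cancelˡ-≤ (suc k)) (*-monoʳ-≤ (suc k))) (suc k * proj₂ x ≤? suc k * l) (proj₂ x ≤? l)))
      (trans (if-cong-else (does (proj₂ x ≤? l)) (cong (stretchRow x ∷_) (insertRow-stretch (b , l) rs)))
        (sym (if-float (map stretchRow) (does (proj₂ x ≤? l)))))

    sort-stretch : ∀ rs → foldr insertRow [] (map stretchRow rs) ≡ map stretchRow (foldr insertRow [] rs)
    sort-stretch []       = refl
    sort-stretch (r ∷ rs) = trans (cong (insertRow (stretchRow r)) (sort-stretch rs))
      (insertRow-stretch r (foldr insertRow [] rs))

    nonzero-stretch : ∀ rs → filter (λ r → ¬? (proj₂ r ≟ 0)) (map stretchRow rs) ≡
                             map stretchRow (filter (λ r → ¬? (proj₂ r ≟ 0)) rs)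
    nonzero-stretch []                 = refl
    nonzero-stretch ((b , zero) ∷ rs)  = trans
      (List.filter-reject (λ r → ¬? (proj₂ r ≟ 0)) (λ neq → neq (*-zeroʳ (suc k)))) (nonzero-stretch rs)
    nonzero-stretch ((b , suc l) ∷ rs) = cong (stretchRow (b , suc l) ∷_) (nonzero-stretch rs)

    rows-stretch : (α : Vec ℕ n) → rows (suc k · α) ≡ map stretchRow (rows α)
    rows-stretch {n} α = trans
      (cong (λ rs → foldr insertRow [] (filter (λ r → ¬? (proj₂ r ≟ 0)) rs)) labelled)
      (trans (cong (foldr insertRow []) (nonzero-stretch (labelledRows α)))
        (sort-stretch (filter (λ r → ¬? (proj₂ r ≟ 0)) (labelledRows α))))
      where
      labels = map suc (downFrom n)
      labelled : labelledRows (suc k · α) ≡ map stretchRow (labelledRows α)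
      labelled = trans
        (cong₂ zip (sym (List.map-id labels)) (Vec.toList-map (suc k *_) α))
        (List.zip-map id (suc k *_) labels (toList α))

    -- The two lists have only propositionally equal lengths, so their vectors live in different
    -- types. Quantifying over `F` equates the dependent triples without a transport; the recursion
    -- moves the head row into `F`.
    fromList-stretch : {X : Set} (F : ∀ m → Vec ℕ m → Vec ℕ m → X) → ∀ rs →
      F (length (map stretchRow rs)) (Vec.map proj₁ (fromList (map stretchRow rs))) (Vec.map proj₂ (fromList (map stretchRow rs))) ≡
      F (length rs) (Vec.map proj₁ (fromList rs)) (suc k · Vec.map proj₂ (fromList rs))
    fromList-stretch F []             = refl
    fromList-stretch F ((b , l) ∷ rs) = fromList-stretch (λ m β Λ → F (suc m) (b ∷ β) (suc k * l ∷ Λ)) rs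

    keyPolynomial-stretch : (α : Vec ℕ n) → keyPolynomial (suc k · α) ≡ tableauSum (basement α) (suc k · shape α)
    keyPolynomial-stretch {n} α = trans (cong sumOver (rows-stretch α)) (trans
      (fromList-stretch (λ m → weightSum {m}) (rows α))
      (weightSum≡tableauSum (basement α) (suc k · shape α)))
      where
      open ExponentialSums (polyRing n) using (total-map)
      weightSum : (β Λ : Vec ℕ m) → Poly n
      weightSum β Λ = ∑ (map (λ T → x^ weight n T) (keyTableaux β Λ))
      weightSum≡tableauSum : (β Λ : Vec ℕ m) → weightSum β Λ ≡ tableauSum β Λ
      weightSum≡tableauSum β Λ = total-map id (λ T → x^ weight n T) (keyTableaux β Λ)
      sumOver : List (ℕ × ℕ) → Poly n
      sumOver rs = weightSum (Vec.map proj₁ (fromList rs)) (Vec.map proj₂ (fromList rs))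

  module _ (n : ℕ) {m : ℕ} (β Λ : Vec ℕ m) (sorted : ∀ {i i′} → i ≤ i′ → at Λ i′ ≤ at Λ i) where
    private module Poly = CommutativeRing (polyRing n)
    open ExponentialSums (polyRing n)
    open Recurrences (polyRing n)
    open Stages Λ sorted n

    columnConstantWeightsOf : List (Vec ℕ n)
    columnConstantWeightsOf = List.deduplicate (Vec.≡-dec _≟_)
      (map (weight n) (filter equalHeightColumnsAgree? (keyTableaux β Λ)))

    chain-weight : IsColumn n m (at β) → ∀ {w} → Chain m β w → w ∈ columnConstantWeightsOf
    chain-weight isColumn-β {w} chain
      with subst (Realised β w) (trans (stage-m 1) (trans (Vec.map-cong *-identityˡ Λ) (Vec.map-id Λ)))
             (realise m ≤-refl isColumn-β chain)
    ... | T , key , refl , columns = ∈-deduplicate⁺ (Vec.≡-dec _≟_) (∈-map⁺ (weight n)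
      (∈-filter⁺ equalHeightColumnsAgree?
        (Equivalence.from (∈-keyTableaux β Λ T) (isKey⇒isKeyTableau (isShape sorted (at-beyond Λ)) key))
        (λ j j′ → columns (toℕ j) (toℕ j′))))

    stretched-recurrence : IsColumn n m (at β) → (a : ℕ → Poly n) → (∀ k → a (suc k) ≡ tableauSum β (suc k · Λ)) →
      SatisfiesLinearRecurrence 1 a (∏ₜ (map (λ w → t- (x^ w)) columnConstantWeightsOf))
    stretched-recurrence isColumn-β a stretch =
      subst (SatisfiesLinearRecurrence 1 a ∘ ∏ₜ) (sym (List.map-∘ columnConstantWeightsOf))
        (satisfiesLinearRecurrence monomials λ k r<k → Poly.trans
          -- The two sequences are known to agree only from k = 1 on, which shifts the start of the
          -- recurrence from 0 to 1.
          (factors-cong monomials {1} agree k r<k)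
          (factors-exponential x^_ monomials
            (weaken (∈-map⁺ x^_ ∘ chain-weight isColumn-β) (chain-exponential m ≤-refl isColumn-β)) k (<⇒≤ r<k)))
      where
      monomials : List (Poly n)
      monomials = map x^_ columnConstantWeightsOf
      agree : ∀ k → 1 ≤ k → a k ≋ tableauSum β (k · stage m)
      agree (suc k) _ = Poly.reflexive (trans (stretch k) (cong (tableauSum β) (sym (stage-m (suc k)))))

open Rows

open import Data.List.Base using (length)
open import Data.Nat.Base using (_≤_; _<_)
open import Data.Product.Base using (_×_; _,_; proj₁; proj₂)
open import Function.Base using (_∘_)

theorem18 : (n : ℕ) (α : Vec ℕ n) →
    SatisfiesLinearRecurrence 1 (λ k → keyPolynomial (k · α)) (characteristicPolynomial α)
theorem18 n α = stretched-recurrence n (basement α) (shape α) (sorted-at (rows-sorted α))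
  (isColumn (proj₁ ∘ bounds) (proj₂ ∘ bounds) (distinct-at (labels-distinct α)))
  (λ k → keyPolynomial (k · α)) (λ k → keyPolynomial-stretch k α)
  where
  bounds : ∀ {i} → i < length (rows α) → 1 ≤ at (basement α) i × at (basement α) i ≤ n
  bounds = All-at {P = λ b → 1 ≤ b × b ≤ n} (labels-bounded α)
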